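{- Let $\alpha,\beta\ge 2$, and let $\kappa=\kappa(\alpha,\beta)$ be the complete bipartite graph on $\alpha$ white and $\beta$ black vertices. Then $$K_\epsilon(C^\star(\Lambda_t'(\kappa)))\cong K_\epsilon(C^\star(\Lambda'(\kappa)))$$ for $\epsilon=0,1$ and all integers $t\ge 1$, where $\Lambda'_t(\kappa)$ is the $2$-rank graph of the unpointed $2t$-gon system of $\kappa$ and $\Lambda'(\kappa)$ is the $2$-rank graph of the unpointed tile system of $\kappa$.
   Context: Unpointed tile system of $\kappa=\kappa(\alpha,\beta)$. Let $U=\{u_i^1,u_i^2,\bar u_i^1,\bar u_i^2: 1\le i\le\alpha\}$ and $V=\{v_j^1,v_j^2,\bar v_j^1,\bar v_j^2:1\le j\le\beta\}$ be sets of $4\alpha$ and $4\beta$ distinct elements, with fixed-point-free involutions $x\mapsto\bar x$ exchanging $u_i^r\leftrightarrow\bar u_i^r$ and $v_j^r\leftrightarrow\bar v_j^r$. The set of pointed tiles $\mathcal S(\kappa)\subseteq U\times V\times U\times V$ consists of the $4\alpha\beta$ tuples $[u_i^1,v_j^1,u_i^2,v_j^2]$, $[\bar u_i^1,\bar v_j^2,\bar u_i^2,\bar v_j^1]$, $[u_i^2,v_j^2,u_i^1,v_j^1]$, $[\bar u_i^2,\bar v_j^1,\bar u_i^1,\bar v_j^2]$. For $A=[x_1,y_1,x_2,y_2]$, $B=[x_3,y_3,x_4,y_4]$ in $\mathcal S(\kappa)$: $M_1(A,B)=1$ if $y_1=\bar y_4$ and $x_1\ne\bar x_3$, and $0$ otherwise;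 $M_2(A,B)=1$ if $x_2=\bar x_3$ and $y_1\neq\bar y_3$, and $0$ otherwise. For each $(i,j)$ identify the four pointed tiles listed above; the set of equivalence classes is $\mathcal S'(\kappa)$ (the unpointed tiles). For $A',B'\in\mathcal S'(\kappa)$ and $\ell=1,2$, $M'_\ell(A',B')=1$ if $M_\ell(A_\bullet,B_\bullet)=1$ for some representatives $A_\bullet$ of $A'$ and $B_\bullet$ of $B'$, and $0$ otherwise. Unpointed $2t$-gon system of $\kappa$. The set $\mathcal S'_t(\kappa)$ consists of the $\alpha\beta$ unpointed $2t$-gons $A_{ij}=(u_i^1,v_j^1,\dots,u_i^t,v_j^t)$, $1\le i\le\alpha$, $1\le j\le\beta$ (labels read around the boundary, disregarding basepoint and orientation). $A_{ij}$ and $A_{kl}$ are $V$-adjacent if they have the same $V$-labels and different $U$-labels, i.e. $j=l$ and $i\ne k$; they are $U$-adjacent if they have the same $U$-labels and different $V$-labels, i.e. $i=k$ and $j\ne l$. Let $M'_U,M'_V$ be the corresponding $\{0,1\}$ adjacency matrices. Higher-rank graphs. A $k$-rank graph is a countable small category $\Lambda$ (objects identified with identity morphisms; $r(\lambda)$ is the codomain and $s(\lambda)$ the domain of $\lambda$) with a functor $d:\Lambda\to\mathbb N^k$ ($0\in\mathbb N$) such that whenever $d(\lambda)=\mathbf m+\mathbf n$ there are unique $\mu,\nu$ with $\lambda=\nu\mu$, $d(\mu)=\mathbf m$, $d(\nu)=\mathbf n$. Write $\Lambda^{\mathbf n}=d^{ -1}(\mathbf n)$ (so $\Lambda^{\mathbf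 0}$ is the set of vertices) and $\Lambda^{\mathbf n}(v)=\{\lambda\in\Lambda^{\mathbf n}: r(\lambda)=v\}$. $\Lambda$ is row-finite if all $\Lambda^{\mathbf n}(v)$ are finite, and has no sources if all are non-empty. For a finite set $S$ and commuting $\{0,1\}$-valued $S\times S$ matrices $N_1,N_2$ with $N_1N_2$ also $\{0,1\}$-valued, $\Lambda(S;N_1,N_2)$ is the $2$-rank graph whose morphisms of degree $(m,n)$ are the maps $\varphi:\{0,\dots,m\}\times\{0,\dots,n\}\to S$ with $N_1(\varphi(p,q),\varphi(p+1,q))=1$ and $N_2(\varphi(p,q),\varphi(p,q+1))=1$ whenever defined; $r(\varphi)=\varphi(0,0)$, $s(\varphi)=\varphi(m,n)$; and if $s(\varphi_1)=r(\varphi_2)$, where $\varphi_i$ has degree $(m_i,n_i)$, the composite $\varphi_1\varphi_2$ is the unique morphism $\chi$ of degree $(m_1+m_2,n_1+n_2)$ with $\chi(p,q)=\varphi_1(p,q)$ and $\chi(m_1+p,n_1+q)=\varphi_2(p,q)$. Put $\Lambda'(\kappa)=\Lambda(\mathcal S'(\kappa);M'_1,M'_2)$ and $\Lambda'_t(\kappa)=\Lambda(\mathcal S'_t(\kappa);M'_U,M'_V)$. For a row-finite $k$-rank graph $\Lambda$ with no sources, $C^\star(\Lambda)$ is the universal $C^\star$-algebra generated by partial isometries $\{s_\lambda:\lambda\in\Lambda\}$ such that: (a) $(s_v)^2=s_v=s_v^*$ for $v\in\Lambda^{\mathbf 0}$ and $s_us_v=0$ for $u\ne v$ in $\Lambda^{\mathbf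 0}$; (b) $s_{\mu\lambda}=s_\mu s_\lambda$ whenever $r(\lambda)=s(\mu)$; (c) $s_\lambda^*s_\lambda=s_{s(\lambda)}$; (d) $s_v=\sum_{\lambda\in\Lambda^{\mathbf n}(v)}s_\lambda s_\lambda^*$ for all $v\in\Lambda^{\mathbf 0}$, $\mathbf n\in\mathbb N^k$. -}

module Defs where

module Reals where

  open import Level using (0ℓ)
  open import Algebra.Bundles using (CommutativeRing)
  import Algebra.Properties.AbelianGroup as AbelianGroupProperties
  import Algebra.Properties.Group as GroupProperties
  import Algebra.Properties.Ring as RingProperties
  import Algebra.Solver.Ring.NaturalCoefficients.Default as NaturalCoefficients
  open import Data.Nat.Base as ℕ using (ℕ; zero; suc)
  import Data.Nat.Properties as ℕ
  open import Data.Rational.Base as ℚ using (ℚ; 0ℚ; 1ℚ; ½; Positive)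
  import Data.Rational.Properties as ℚ
  open import Data.Rational.Solver using (module +-*-Solver)
  open import Data.Product.Base using (_×_; _,_; ∃-syntax; proj₁; proj₂)
  open import Data.Sum.Base using (_⊎_; inj₁; inj₂)
  open import Relation.Binary.Structures using (IsEquivalence)
  open import Relation.Binary.PropositionalEquality as ≡ using (_≡_)

  open +-*-Solver using (solve; _:=_; _:+_; _:*_; :-_)

  -- Cauchy sequences of rationals, taken modulo _≃_ below.
  record ℝ : Set where
    no-eta-equality
    field
      seq    : ℕ → ℚ
      cauchy : ∀ ε → Positive ε →
               ∃[ N ] ∀ m n → N ℕ.≤ m → N ℕ.≤ n → ℚ.∣ seq m ℚ.- seq n ∣ ℚ.≤ ε

  open ℝ public

  infix 4 _≃_ _≤ʳ_

  record _≃_ (x y : ℝ) : Set where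
    constructor mk≃
    field close : ∀ ε → Positive ε → ∃[ N ] ∀ n → N ℕ.≤ n → ℚ.∣ seq x n ℚ.- seq y n ∣ ℚ.≤ ε

  record _≤ʳ_ (x y : ℝ) : Set where
    constructor mk≤
    field below : ∀ ε → Positive ε → ∃[ N ] ∀ n → N ℕ.≤ n → seq x n ℚ.≤ seq y n ℚ.+ ε

  private
    half⁺ : ∀ ε → Positive ε → Positive (½ ℚ.* ε)
    half⁺ ε p = ℚ.pos*pos⇒pos ½ ε {{p}}

    half+half : ∀ ε → ½ ℚ.* ε ℚ.+ ½ ℚ.* ε ≡ ε
    half+half ε = ≡.trans (≡.sym (ℚ.*-distribʳ-+ ε ½ ½)) (ℚ.*-identityˡ ε)

    split-≤ : ∀ x a b → x ≡ a ℚ.+ b → ℚ.∣ x ∣ ℚ.≤ ℚ.∣ a ∣ ℚ.+ ℚ.∣ b ∣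
    split-≤ x a b e = ℚ.≤-trans (ℚ.≤-reflexive (≡.cong ℚ.∣_∣ e)) (ℚ.∣p+q∣≤∣p∣+∣q∣ a b)

    ≤-by : ∀ x a b ε → x ≡ a ℚ.+ b →
           ℚ.∣ a ∣ ℚ.≤ ½ ℚ.* ε → ℚ.∣ b ∣ ℚ.≤ ½ ℚ.* ε → ℚ.∣ x ∣ ℚ.≤ ε
    ≤-by x a b ε e a≤ b≤ =
      ℚ.≤-trans (split-≤ x a b e)
        (ℚ.≤-trans (ℚ.+-mono-≤ a≤ b≤) (ℚ.≤-reflexive (half+half ε)))

    0≤pos : ∀ ε → Positive ε → 0ℚ ℚ.≤ ε
    0≤pos ε p = ℚ.<⇒≤ (ℚ.positive⁻¹ ε {{p}})

    ∣x-y∣-sym : ∀ x y → ℚ.∣ x ℚ.- y ∣ ≡ ℚ.∣ y ℚ.- x ∣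
    ∣x-y∣-sym x y = ≡.trans (≡.sym (ℚ.∣-p∣≡∣p∣ (x ℚ.- y)))
      (≡.cong ℚ.∣_∣ (solve 2 (λ x y → :- (x :+ :- y) := y :+ :- x) ≡.refl x y))

    telescope : ∀ x y z → x ℚ.- z ≡ (x ℚ.- y) ℚ.+ (y ℚ.- z)
    telescope = solve 3 (λ x y z → x :+ :- z := (x :+ :- y) :+ (y :+ :- z)) ≡.refl

    ∣x-x∣≤ : ∀ x y ε → Positive ε → x ≡ y → ℚ.∣ x ℚ.- y ∣ ℚ.≤ ε
    ∣x-x∣≤ x .x ε p ≡.refl = ℚ.≤-trans (ℚ.≤-reflexive (≡.cong ℚ.∣_∣ (ℚ.+-inverseʳ x))) (0≤pos ε p)

  ≃-pointwise : ∀ {x y} → (∀ n → seq x n ≡ seq y n) → x ≃ y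
  ≃-pointwise {x} {y} e = mk≃ λ ε p → 0 , λ n _ → ∣x-x∣≤ (seq x n) (seq y n) ε p (e n)

  ≃-refl : ∀ {x} → x ≃ x
  ≃-refl = ≃-pointwise (λ _ → ≡.refl)

  ≃-sym : ∀ {x y} → x ≃ y → y ≃ x
  ≃-sym {x} {y} (mk≃ e) = mk≃ λ ε p → let N , h = e ε p in
    N , λ n b → ℚ.≤-trans (ℚ.≤-reflexive (∣x-y∣-sym (seq y n) (seq x n))) (h n b)

  ≃-trans : ∀ {x y z} → x ≃ y → y ≃ z → x ≃ z
  ≃-trans {x} {y} {z} (mk≃ e) (mk≃ f) = mk≃ λ ε p →
    let M , h = e (½ ℚ.* ε) (half⁺ ε p)
        N , k = f (½ ℚ.* ε) (half⁺ ε p)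
    in M ℕ.⊔ N , λ n b → ≤-by (seq x n ℚ.- seq z n)
         (seq x n ℚ.- seq y n) (seq y n ℚ.- seq z n) ε
         (telescope (seq x n) (seq y n) (seq z n))
         (h n (ℕ.m⊔n≤o⇒m≤o M N b)) (k n (ℕ.m⊔n≤o⇒n≤o M N b))

  fromℚ : ℚ → ℝ
  fromℚ q = record { seq = λ _ → q ; cauchy = λ ε p → 0 , λ _ _ _ _ → ∣x-x∣≤ q q ε p ≡.refl }

  0ℝ 1ℝ : ℝ
  0ℝ = fromℚ 0ℚ
  1ℝ = fromℚ 1ℚ

  infixl 6 _+ʳ_ _-ʳ_
  infixl 7 _*ʳ_
  infix  8 -ʳ_

  private
    +-diff : ∀ a b c d → (a ℚ.+ b) ℚ.- (c ℚ.+ d) ≡ (a ℚ.- c) ℚ.+ (b ℚ.- d)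
    +-diff = solve 4 (λ a b c d → (a :+ b) :+ :- (c :+ d) := (a :+ :- c) :+ (b :+ :- d)) ≡.refl

    neg-diff : ∀ a b → ℚ.∣ (ℚ.- a) ℚ.- (ℚ.- b) ∣ ≡ ℚ.∣ a ℚ.- b ∣
    neg-diff a b = ≡.trans
      (≡.cong ℚ.∣_∣ (solve 2 (λ a b → :- a :+ :- (:- b) := :- (a :+ :- b)) ≡.refl a b))
      (ℚ.∣-p∣≡∣p∣ (a ℚ.- b))

  _+ʳ_ : ℝ → ℝ → ℝ
  seq    (x +ʳ y) n = seq x n ℚ.+ seq y n
  cauchy (x +ʳ y) ε p =
    let M , h = cauchy x (½ ℚ.* ε) (half⁺ ε p)
        N , k = cauchy y (½ ℚ.* ε) (half⁺ ε p)
    in M ℕ.⊔ N , λ m n b c → ≤-by ((seq x m ℚ.+ seq y m) ℚ.- (seq x n ℚ.+ seq y n))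
         (seq x m ℚ.- seq x n) (seq y m ℚ.- seq y n) ε
         (+-diff (seq x m) (seq y m) (seq x n) (seq y n))
         (h m n (ℕ.m⊔n≤o⇒m≤o M N b) (ℕ.m⊔n≤o⇒m≤o M N c))
         (k m n (ℕ.m⊔n≤o⇒n≤o M N b) (ℕ.m⊔n≤o⇒n≤o M N c))

  -ʳ_ : ℝ → ℝ
  seq    (-ʳ x) n = ℚ.- seq x n
  cauchy (-ʳ x) ε p with N , h ← cauchy x ε p =
    N , λ m n b c → ℚ.≤-trans (ℚ.≤-reflexive (neg-diff (seq x m) (seq x n))) (h m n b c)

  _-ʳ_ : ℝ → ℝ → ℝ
  x -ʳ y = x +ʳ (-ʳ y)

  ∣_∣ʳ : ℝ → ℝ
  seq    ∣ x ∣ʳ n = ℚ.∣ seq x n ∣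
  cauchy ∣ x ∣ʳ ε p with N , h ← cauchy x ε p =
    N , λ m n b c → ℚ.≤-trans (abs-diff (seq x m) (seq x n)) (h m n b c)
    where
    one : ∀ a b → ℚ.∣ a ∣ ℚ.- ℚ.∣ b ∣ ℚ.≤ ℚ.∣ a ℚ.- b ∣
    one a b = ℚ.≤-trans
      (ℚ.+-monoˡ-≤ (ℚ.- ℚ.∣ b ∣)
        (split-≤ a (a ℚ.- b) b (solve 2 (λ a b → a := (a :+ :- b) :+ b) ≡.refl a b)))
      (ℚ.≤-reflexive (solve 2 (λ u v → (u :+ v) :+ :- v := u) ≡.refl ℚ.∣ a ℚ.- b ∣ ℚ.∣ b ∣))

    abs-diff : ∀ a b → ℚ.∣ ℚ.∣ a ∣ ℚ.- ℚ.∣ b ∣ ∣ ℚ.≤ ℚ.∣ a ℚ.- b ∣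
    abs-diff a b with ℚ.∣p∣≡p∨∣p∣≡-p (ℚ.∣ a ∣ ℚ.- ℚ.∣ b ∣)
    ... | inj₁ e = ℚ.≤-trans (ℚ.≤-reflexive e) (one a b)
    ... | inj₂ e = ℚ.≤-trans (ℚ.≤-reflexive (≡.trans e
        (solve 2 (λ u v → :- (u :+ :- v) := v :+ :- u) ≡.refl ℚ.∣ a ∣ ℚ.∣ b ∣)))
        (ℚ.≤-trans (one b a) (ℚ.≤-reflexive (∣x-y∣-sym b a)))

  private
    bounded : ∀ x → ∃[ B ] Positive B × ∃[ N ] ∀ n → N ℕ.≤ n → ℚ.∣ seq x n ∣ ℚ.≤ B
    bounded x with N , h ← cauchy x 1ℚ _ =
      1ℚ ℚ.+ ℚ.∣ seq x N ∣ ,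
      ℚ.positive (ℚ.<-≤-trans (ℚ.positive⁻¹ 1ℚ)
        (ℚ.≤-trans (ℚ.≤-reflexive (≡.sym (ℚ.+-identityʳ 1ℚ)))
          (ℚ.+-monoʳ-≤ 1ℚ (ℚ.0≤∣p∣ (seq x N))))) ,
      N , λ n b → ℚ.≤-trans
        (split-≤ (seq x n) (seq x n ℚ.- seq x N) (seq x N)
          (solve 2 (λ a b → a := (a :+ :- b) :+ b) ≡.refl (seq x n) (seq x N)))
        (ℚ.+-monoˡ-≤ ℚ.∣ seq x N ∣ (h n N b ℕ.≤-refl))

    over : ∀ B → Positive B → ℚ → ℚ
    over B p ε = (ℚ.1/ B) {{ℚ.pos⇒nonZero B {{p}}}} ℚ.* (½ ℚ.* ε)

    over⁺ : ∀ B p ε → Positive ε → Positive (over B p ε)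
    over⁺ B p ε q = ℚ.pos*pos⇒pos ((ℚ.1/ B) {{ℚ.pos⇒nonZero B {{p}}}}) {{ℚ.1/pos⇒pos B {{p}}}} (½ ℚ.* ε) {{half⁺ ε q}}

    B*over : ∀ B p ε → B ℚ.* over B p ε ≡ ½ ℚ.* ε
    B*over B p ε = ≡.trans (≡.sym (ℚ.*-assoc B ((ℚ.1/ B) {{ℚ.pos⇒nonZero B {{p}}}}) (½ ℚ.* ε)))
      (≡.trans (≡.cong (ℚ._* (½ ℚ.* ε)) (ℚ.*-inverseʳ B {{ℚ.pos⇒nonZero B {{p}}}}))
             (ℚ.*-identityˡ (½ ℚ.* ε)))

    ∣ab∣≤ : ∀ a b A δ → Positive A → ℚ.∣ a ∣ ℚ.≤ A → ℚ.∣ b ∣ ℚ.≤ δ → ℚ.∣ a ℚ.* b ∣ ℚ.≤ A ℚ.* δ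
    ∣ab∣≤ a b A δ p a≤ b≤ = ℚ.≤-trans (ℚ.≤-reflexive (ℚ.∣p*q∣≡∣p∣*∣q∣ a b))
      (ℚ.≤-trans (ℚ.*-monoʳ-≤-nonNeg ℚ.∣ b ∣ {{ℚ.∣-∣-nonNeg b}} a≤)
                 (ℚ.*-monoˡ-≤-nonNeg A {{ℚ.pos⇒nonNeg A {{p}}}} b≤))

    *-diff : ∀ a b c d → a ℚ.* b ℚ.- c ℚ.* d ≡ a ℚ.* (b ℚ.- d) ℚ.+ d ℚ.* (a ℚ.- c)
    *-diff = solve 4 (λ a b c d → a :* b :+ :- (c :* d) := a :* (b :+ :- d) :+ d :* (a :+ :- c)) ≡.refl

    *-close : ∀ a b c d A D ε (p : Positive A) (q : Positive D) →
              ℚ.∣ a ∣ ℚ.≤ A → ℚ.∣ d ∣ ℚ.≤ D →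
              ℚ.∣ b ℚ.- d ∣ ℚ.≤ over A p ε → ℚ.∣ a ℚ.- c ∣ ℚ.≤ over D q ε →
              ℚ.∣ a ℚ.* b ℚ.- c ℚ.* d ∣ ℚ.≤ ε
    *-close a b c d A D ε p q a≤ d≤ bd ac = ≤-by (a ℚ.* b ℚ.- c ℚ.* d) (a ℚ.* (b ℚ.- d)) (d ℚ.* (a ℚ.- c)) ε (*-diff a b c d)
      (ℚ.≤-trans (∣ab∣≤ a (b ℚ.- d) A (over A p ε) p a≤ bd) (ℚ.≤-reflexive (B*over A p ε)))
      (ℚ.≤-trans (∣ab∣≤ d (a ℚ.- c) D (over D q ε) q d≤ ac) (ℚ.≤-reflexive (B*over D q ε)))

  _*ʳ_ : ℝ → ℝ → ℝ
  seq    (x *ʳ y) n = seq x n ℚ.* seq y n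
  cauchy (x *ʳ y) ε p =
    let A , a⁺ , K , f = bounded x
        D , d⁺ , L , g = bounded y
        M , h = cauchy y (over A a⁺ ε) (over⁺ A a⁺ ε p)
        N , k = cauchy x (over D d⁺ ε) (over⁺ D d⁺ ε p)
    in (K ℕ.⊔ L) ℕ.⊔ (M ℕ.⊔ N) , λ m n b c →
      let b₁ = ℕ.m⊔n≤o⇒m≤o (K ℕ.⊔ L) _ b
          c₁ = ℕ.m⊔n≤o⇒m≤o (K ℕ.⊔ L) _ c
          b₂ = ℕ.m⊔n≤o⇒n≤o (K ℕ.⊔ L) _ b
          c₂ = ℕ.m⊔n≤o⇒n≤o (K ℕ.⊔ L) _ c
      in *-close (seq x m) (seq y m) (seq x n) (seq y n) A D ε a⁺ d⁺
           (f m (ℕ.m⊔n≤o⇒m≤o K L b₁)) (g n (ℕ.m⊔n≤o⇒n≤o K L c₁))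
           (h m n (ℕ.m⊔n≤o⇒m≤o M N b₂) (ℕ.m⊔n≤o⇒m≤o M N c₂))
           (k m n (ℕ.m⊔n≤o⇒n≤o M N b₂) (ℕ.m⊔n≤o⇒n≤o M N c₂))

  +ʳ-cong : ∀ {x x′ y y′} → x ≃ x′ → y ≃ y′ → (x +ʳ y) ≃ (x′ +ʳ y′)
  +ʳ-cong {x} {x′} {y} {y′} (mk≃ e) (mk≃ f) = mk≃ λ ε p →
    let M , h = e (½ ℚ.* ε) (half⁺ ε p)
        N , k = f (½ ℚ.* ε) (half⁺ ε p)
    in M ℕ.⊔ N , λ n b → ≤-by ((seq x n ℚ.+ seq y n) ℚ.- (seq x′ n ℚ.+ seq y′ n))
         (seq x n ℚ.- seq x′ n) (seq y n ℚ.- seq y′ n) ε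
         (+-diff (seq x n) (seq y n) (seq x′ n) (seq y′ n))
         (h n (ℕ.m⊔n≤o⇒m≤o M N b)) (k n (ℕ.m⊔n≤o⇒n≤o M N b))

  -ʳ-cong : ∀ {x y} → x ≃ y → (-ʳ x) ≃ (-ʳ y)
  -ʳ-cong {x} {y} (mk≃ e) = mk≃ λ ε p → let N , h = e ε p in
    N , λ n b → ℚ.≤-trans (ℚ.≤-reflexive (neg-diff (seq x n) (seq y n))) (h n b)

  *ʳ-cong : ∀ {x x′ y y′} → x ≃ x′ → y ≃ y′ → (x *ʳ y) ≃ (x′ *ʳ y′)
  *ʳ-cong {x} {x′} {y} {y′} (mk≃ e) (mk≃ f) = mk≃ λ ε p →
    let A , a⁺ , K , i = bounded x
        D , d⁺ , L , j = bounded y′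
        M , h = f (over A a⁺ ε) (over⁺ A a⁺ ε p)
        N , k = e (over D d⁺ ε) (over⁺ D d⁺ ε p)
    in (K ℕ.⊔ L) ℕ.⊔ (M ℕ.⊔ N) , λ n b →
      let b₁ = ℕ.m⊔n≤o⇒m≤o (K ℕ.⊔ L) _ b
          b₂ = ℕ.m⊔n≤o⇒n≤o (K ℕ.⊔ L) _ b
      in *-close (seq x n) (seq y n) (seq x′ n) (seq y′ n) A D ε a⁺ d⁺
           (i n (ℕ.m⊔n≤o⇒m≤o K L b₁)) (j n (ℕ.m⊔n≤o⇒n≤o K L b₁))
           (h n (ℕ.m⊔n≤o⇒m≤o M N b₂)) (k n (ℕ.m⊔n≤o⇒n≤o M N b₂))

  ≃-isEquivalence : IsEquivalence _≃_
  ≃-isEquivalence = record { refl = ≃-refl ; sym = ≃-sym ; trans = ≃-trans }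

  ℝ-commutativeRing : CommutativeRing 0ℓ 0ℓ
  ℝ-commutativeRing = record
    { Carrier = ℝ ; _≈_ = _≃_ ; _+_ = _+ʳ_ ; _*_ = _*ʳ_ ; -_ = -ʳ_ ; 0# = 0ℝ ; 1# = 1ℝ
    ; isCommutativeRing = record
      { isRing = record
        { +-isAbelianGroup = record
          { isGroup = record
            { isMonoid = record
              { isSemigroup = record
                { isMagma = record { isEquivalence = ≃-isEquivalence ; ∙-cong = +ʳ-cong }
                ; assoc = λ x y z → ≃-pointwise (λ n → ℚ.+-assoc (seq x n) (seq y n) (seq z n)) }
              ; identity = (λ x → ≃-pointwise (λ n → ℚ.+-identityˡ (seq x n)))
                         , (λ x → ≃-pointwise (λ n → ℚ.+-identityʳ (seq x n))) }
            ; inverse = (λ x → ≃-pointwise (λ n → ℚ.+-inverseˡ (seq x n)))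
                      , (λ x → ≃-pointwise (λ n → ℚ.+-inverseʳ (seq x n)))
            ; ⁻¹-cong = -ʳ-cong }
          ; comm = λ x y → ≃-pointwise (λ n → ℚ.+-comm (seq x n) (seq y n)) }
        ; *-cong = *ʳ-cong
        ; *-assoc = λ x y z → ≃-pointwise (λ n → ℚ.*-assoc (seq x n) (seq y n) (seq z n))
        ; *-identity = (λ x → ≃-pointwise (λ n → ℚ.*-identityˡ (seq x n)))
                     , (λ x → ≃-pointwise (λ n → ℚ.*-identityʳ (seq x n)))
        ; distrib = (λ x y z → ≃-pointwise (λ n → ℚ.*-distribˡ-+ (seq x n) (seq y n) (seq z n)))
                  , (λ x y z → ≃-pointwise (λ n → ℚ.*-distribʳ-+ (seq x n) (seq y n) (seq z n))) }
      ; *-comm = λ x y → ≃-pointwise (λ n → ℚ.*-comm (seq x n) (seq y n))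
      }
    }

  record ℂ : Set where
    constructor _+i_
    field
      re im : ℝ

  open ℂ public

  infix 4 _≈ᶜ_

  record _≈ᶜ_ (z w : ℂ) : Set where
    constructor _,ᶜ_
    field
      re≃ : re z ≃ re w
      im≃ : im z ≃ im w

  infixl 6 _+ᶜ_
  infixl 7 _*ᶜ_

  _+ᶜ_ _*ᶜ_ : ℂ → ℂ → ℂ
  z +ᶜ w = (re z +ʳ re w) +i (im z +ʳ im w)
  z *ᶜ w = (re z *ʳ re w -ʳ im z *ʳ im w) +i (re z *ʳ im w +ʳ im z *ʳ re w)

  -ᶜ_ conj : ℂ → ℂ
  -ᶜ z   = (-ʳ re z) +i (-ʳ im z)
  conj z = re z +i (-ʳ im z)

  0ᶜ 1ᶜ : ℂ
  0ᶜ = 0ℝ +i 0ℝ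
  1ᶜ = 1ℝ +i 0ℝ

  ∣_∣² : ℂ → ℝ
  ∣ z ∣² = re z *ʳ re z +ʳ im z *ʳ im z

  private
    -- The laws of multiplication in R[i], for R commutative; the solver only knows
    -- commutative semirings, so a variable n stands for -1.
    module ComplexLaws {c ℓ} (R : CommutativeRing c ℓ) where
      open CommutativeRing R
      open RingProperties ring
      open GroupProperties +-group using (⁻¹-involutive)
      open AbelianGroupProperties +-abelianGroup using (⁻¹-∙-comm)
      open NaturalCoefficients commutativeSemiring
        using () renaming (solve to solve′; _:=_ to _≔_; _:+_ to _⊞_; _:*_ to _⊠_)

      neg : ∀ x → - x ≈ - 1# * x
      neg x = sym (-1*x≈-x x)

      assoc-re : ∀ a b c d e f →
        (a * c - b * d) * e - (a * d + b * c) * f ≈ a * (c * e - d * f) - b * (c * f + d * e)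
      assoc-re a b c d e f = trans
        (+-cong (*-congʳ (+-congˡ (neg _))) (neg _))
        (trans (go (- 1#) a b c d e f) (sym (+-cong (*-congˡ (+-congˡ (neg _))) (neg _))))
        where
        go : ∀ n a b c d e f →
          (a * c + n * (b * d)) * e + n * ((a * d + b * c) * f) ≈
          a * (c * e + n * (d * f)) + n * (b * (c * f + d * e))
        go = solve′ 7 (λ n a b c d e f →
          (a ⊠ c ⊞ n ⊠ (b ⊠ d)) ⊠ e ⊞ n ⊠ ((a ⊠ d ⊞ b ⊠ c) ⊠ f) ≔
          a ⊠ (c ⊠ e ⊞ n ⊠ (d ⊠ f)) ⊞ n ⊠ (b ⊠ (c ⊠ f ⊞ d ⊠ e))) refl

      assoc-im : ∀ a b c d e f →
        (a * c - b * d) * f + (a * d + b * c) * e ≈ a * (c * f + d * e) + b * (c * e - d * f)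
      assoc-im a b c d e f = trans
        (+-congʳ (*-congʳ (+-congˡ (neg _))))
        (trans (go (- 1#) a b c d e f) (sym (+-congˡ (*-congˡ (+-congˡ (neg _))))))
        where
        go : ∀ n a b c d e f →
          (a * c + n * (b * d)) * f + (a * d + b * c) * e ≈
          a * (c * f + d * e) + b * (c * e + n * (d * f))
        go = solve′ 7 (λ n a b c d e f →
          (a ⊠ c ⊞ n ⊠ (b ⊠ d)) ⊠ f ⊞ (a ⊠ d ⊞ b ⊠ c) ⊠ e ≔
          a ⊠ (c ⊠ f ⊞ d ⊠ e) ⊞ b ⊠ (c ⊠ e ⊞ n ⊠ (d ⊠ f))) refl

      comm-re : ∀ a b c d → a * c - b * d ≈ c * a - d * b
      comm-re a b c d = +-cong (*-comm a c) (-‿cong (*-comm b d))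

      comm-im : ∀ a b c d → a * d + b * c ≈ c * b + d * a
      comm-im a b c d = trans (+-cong (*-comm a d) (*-comm b c)) (+-comm _ _)

      dist-re : ∀ a b c d e f → a * (c + e) - b * (d + f) ≈ (a * c - b * d) + (a * e - b * f)
      dist-re a b c d e f = trans (+-congˡ (neg _))
        (trans (go (- 1#) a b c d e f) (sym (+-cong (+-congˡ (neg _)) (+-congˡ (neg _)))))
        where
        go : ∀ n a b c d e f →
          a * (c + e) + n * (b * (d + f)) ≈ (a * c + n * (b * d)) + (a * e + n * (b * f))
        go = solve′ 7 (λ n a b c d e f →
          a ⊠ (c ⊞ e) ⊞ n ⊠ (b ⊠ (d ⊞ f)) ≔
          (a ⊠ c ⊞ n ⊠ (b ⊠ d)) ⊞ (a ⊠ e ⊞ n ⊠ (b ⊠ f))) refl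

      dist-im : ∀ a b c d e f → a * (d + f) + b * (c + e) ≈ (a * d + b * c) + (a * f + b * e)
      dist-im = solve′ 6 (λ a b c d e f →
        a ⊠ (d ⊞ f) ⊞ b ⊠ (c ⊞ e) ≔ (a ⊠ d ⊞ b ⊠ c) ⊞ (a ⊠ f ⊞ b ⊠ e)) refl

      id-re : ∀ a b → 1# * a - 0# * b ≈ a
      id-re a b = trans (+-cong (*-identityˡ a) (trans (-‿cong (zeroˡ b)) -0#≈0#)) (+-identityʳ a)

      id-im : ∀ a b → 1# * b + 0# * a ≈ b
      id-im a b = trans (+-cong (*-identityˡ b) (zeroˡ a)) (+-identityʳ b)

      conj-re : ∀ a b c d → a * c - b * d ≈ c * a - (- d) * (- b)
      conj-re a b c d = trans (comm-re a b c d) (+-congˡ (-‿cong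
        (trans (sym (⁻¹-involutive (d * b)))
          (trans (-‿cong (-‿distribʳ-* d b)) (-‿distribˡ-* d (- b))))))

      conj-im : ∀ a b c d → - (a * d + b * c) ≈ c * (- b) + (- d) * a
      conj-im a b c d = trans (-‿cong (comm-im a b c d)) (trans (sym (⁻¹-∙-comm _ _))
        (+-cong (-‿distribʳ-* c b) (-‿distribˡ-* d a)))

      neg-+ : ∀ a b → - (a + b) ≈ - a + - b
      neg-+ a b = sym (⁻¹-∙-comm a b)

      neg-neg : ∀ a → - (- a) ≈ a
      neg-neg = ⁻¹-involutive

    module ℝᵣ = CommutativeRing ℝ-commutativeRing
    module L = ComplexLaws ℝ-commutativeRing

  ≈ᶜ-isEquivalence : IsEquivalence _≈ᶜ_
  ≈ᶜ-isEquivalence = record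
    { refl  = ≃-refl ,ᶜ ≃-refl
    ; sym   = λ (e ,ᶜ f) → ≃-sym e ,ᶜ ≃-sym f
    ; trans = λ (e ,ᶜ f) (g ,ᶜ h) → ≃-trans e g ,ᶜ ≃-trans f h
    }

  conj-cong : ∀ {z w} → z ≈ᶜ w → conj z ≈ᶜ conj w
  conj-cong (e ,ᶜ f) = e ,ᶜ -ʳ-cong f

  private
    *ᶜ-comm : ∀ z w → z *ᶜ w ≈ᶜ w *ᶜ z
    *ᶜ-comm z w = L.comm-re (re z) (im z) (re w) (im w) ,ᶜ L.comm-im (re z) (im z) (re w) (im w)

    *ᶜ-distribˡ : ∀ x y z → x *ᶜ (y +ᶜ z) ≈ᶜ x *ᶜ y +ᶜ x *ᶜ z
    *ᶜ-distribˡ x y z =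
      L.dist-re (re x) (im x) (re y) (im y) (re z) (im z) ,ᶜ
      L.dist-im (re x) (im x) (re y) (im y) (re z) (im z)

    *ᶜ-identityˡ : ∀ z → 1ᶜ *ᶜ z ≈ᶜ z
    *ᶜ-identityˡ z = L.id-re (re z) (im z) ,ᶜ L.id-im (re z) (im z)

  ℂ-commutativeRing : CommutativeRing 0ℓ 0ℓ
  ℂ-commutativeRing = record
    { Carrier = ℂ ; _≈_ = _≈ᶜ_ ; _+_ = _+ᶜ_ ; _*_ = _*ᶜ_ ; -_ = -ᶜ_ ; 0# = 0ᶜ ; 1# = 1ᶜ
    ; isCommutativeRing = record
      { isRing = record
        { +-isAbelianGroup = record
          { isGroup = record
            { isMonoid = record
              { isSemigroup = record
                { isMagma = record
                  { isEquivalence = ≈ᶜ-isEquivalence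
                  ; ∙-cong = λ (e ,ᶜ f) (g ,ᶜ h) → +ʳ-cong e g ,ᶜ +ʳ-cong f h }
                ; assoc = λ x y z → ℝᵣ.+-assoc (re x) (re y) (re z) ,ᶜ ℝᵣ.+-assoc (im x) (im y) (im z) }
              ; identity = (λ x → ℝᵣ.+-identityˡ (re x) ,ᶜ ℝᵣ.+-identityˡ (im x))
                         , (λ x → ℝᵣ.+-identityʳ (re x) ,ᶜ ℝᵣ.+-identityʳ (im x)) }
            ; inverse = (λ x → ℝᵣ.-‿inverseˡ (re x) ,ᶜ ℝᵣ.-‿inverseˡ (im x))
                      , (λ x → ℝᵣ.-‿inverseʳ (re x) ,ᶜ ℝᵣ.-‿inverseʳ (im x))
            ; ⁻¹-cong = λ (e ,ᶜ f) → -ʳ-cong e ,ᶜ -ʳ-cong f }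
          ; comm = λ x y → ℝᵣ.+-comm (re x) (re y) ,ᶜ ℝᵣ.+-comm (im x) (im y) }
        ; *-cong = λ (e ,ᶜ f) (g ,ᶜ h) →
            +ʳ-cong (*ʳ-cong e g) (-ʳ-cong (*ʳ-cong f h)) ,ᶜ +ʳ-cong (*ʳ-cong e h) (*ʳ-cong f g)
        ; *-assoc = λ x y z →
            L.assoc-re (re x) (im x) (re y) (im y) (re z) (im z) ,ᶜ
            L.assoc-im (re x) (im x) (re y) (im y) (re z) (im z)
        ; *-identity = *ᶜ-identityˡ , λ z → ≈-trans (*ᶜ-comm z 1ᶜ) (*ᶜ-identityˡ z)
        ; distrib = *ᶜ-distribˡ , λ x y z → ≈-trans (*ᶜ-comm (y +ᶜ z) x)
            (≈-trans (*ᶜ-distribˡ x y z) (+ᶜ-cong (*ᶜ-comm x y) (*ᶜ-comm x z)))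
        }
      ; *-comm = *ᶜ-comm
      }
    }
    where
    open IsEquivalence ≈ᶜ-isEquivalence using () renaming (trans to ≈-trans)
    +ᶜ-cong : ∀ {z z′ w w′} → z ≈ᶜ z′ → w ≈ᶜ w′ → z +ᶜ w ≈ᶜ z′ +ᶜ w′
    +ᶜ-cong (e ,ᶜ f) (g ,ᶜ h) = +ʳ-cong e g ,ᶜ +ʳ-cong f h

  conj-+ : ∀ z w → conj (z +ᶜ w) ≈ᶜ conj z +ᶜ conj w
  conj-+ z w = ≃-refl ,ᶜ L.neg-+ (im z) (im w)

  conj-* : ∀ z w → conj (z *ᶜ w) ≈ᶜ conj w *ᶜ conj z
  conj-* z w = L.conj-re (re z) (im z) (re w) (im w) ,ᶜ L.conj-im (re z) (im z) (re w) (im w)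

  conj-involutive : ∀ z → conj (conj z) ≈ᶜ z
  conj-involutive z = ≃-refl ,ᶜ L.neg-neg (im z)

module HigherRankGraphs where

  open import Level using (0ℓ)
  open import Data.Bool.Base using (Bool; true; false; not; if_then_else_)
  open import Data.Bool.Properties using () renaming (_≟_ to _≟ᵇ_)
  open import Data.Fin.Base as Fin using (Fin)
  open import Data.Fin.Patterns using (0F; 1F; 2F; 3F)
  import Data.Fin.Properties as Fin
  open import Data.List.Base as List using (List; []; _∷_)
  import Data.List.Membership.DecPropositional as DecMembership
  open import Data.List.Membership.Propositional using (_∈_)
  open import Data.List.Membership.Propositional.Properties using (∈-map⁻; ∈-map⁺; ∈-tabulate⁺; ∈-tabulate⁻)
  import Data.List.Membership.Setoid as SetoidMembership
  import Data.List.Membership.Setoid.Properties as Membership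
  open import Data.List.Properties using (map-tabulate)
  open import Data.List.Relation.Unary.All as All using (All)
  import Data.List.Relation.Unary.All.Properties as All
  open import Data.List.Relation.Unary.Any as Any using (Any; here)
  import Data.List.Relation.Unary.Any.Properties as Any
  import Data.List.Relation.Unary.Unique.DecSetoid.Properties as Unique
  import Data.List.Relation.Unary.Unique.Setoid as UniqueSetoid
  open import Data.Nat.Base using (ℕ; zero; suc; _+_; _*_; _∸_; _⊓_; _≤_; _<_; z≤n; s≤s; s≤s⁻¹)
  open import Data.Nat.Properties
  open import Data.Product.Base using (_×_; _,_; ∃-syntax; proj₁; proj₂)
  open import Data.Product.Properties using (≡-dec)
  open import Data.Sum.Base using (inj₁; inj₂)
  open import Data.Vec.Base using (Vec; []; _∷_; zipWith; replicate)
  open import Function.Base using (_∘_)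
  open import Function.Bundles using (_↔_; Injection; Inverse)
  open import Function.Properties.Inverse using (↔-sym)
  open import Relation.Binary.Bundles using (Setoid; DecSetoid)
  open import Relation.Binary.Definitions using (DecidableEquality)
  open import Relation.Binary.PropositionalEquality as ≡ using (_≡_; _≢_; refl; sym; trans; cong; cong₂; subst)
  open import Relation.Binary.Structures using (IsEquivalence)
  open import Relation.Nullary using (¬_; Dec; yes; no; contradiction)
  open import Relation.Nullary.Decidable using (recompute; map′; _×-dec_; ¬?; does)
  import Algebra.Properties.CommutativeMonoid.Sum as Sum

  Degree : ℕ → Set
  Degree k = Vec ℕ k

  infixl 6 _⊕ᵈ_
  _⊕ᵈ_ : ∀ {k} → Degree k → Degree k → Degree k
  _⊕ᵈ_ = zipWith _+_

  0ᵈ : ∀ {k} → Degree k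
  0ᵈ = replicate _ 0

  -- Single-sorted categories: an object is identified with its identity
  -- morphism, so r and s land in Mor.
  record GradedCategory (k : ℕ) : Set₁ where
    infix 4 _≈_
    field
      Mor           : Set
      _≈_           : Mor → Mor → Set
      isEquivalence : IsEquivalence _≈_

    setoid : Setoid 0ℓ 0ℓ
    setoid = record { isEquivalence = isEquivalence }

    field
      r s    : Mor → Mor
      r-cong : ∀ {f g} → f ≈ g → r f ≈ r g
      s-cong : ∀ {f g} → f ≈ g → s f ≈ s g
      comp   : ∀ f g → s f ≈ r g → Mor

      comp-cong : ∀ {f f′ g g′} e e′ → f ≈ f′ → g ≈ g′ → comp f g e ≈ comp f′ g′ e′

      r-r : ∀ f → r (r f) ≈ r f
      s-r : ∀ f → s (r f) ≈ r f
      r-s : ∀ f → r (s f) ≈ s f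
      s-s : ∀ f → s (s f) ≈ s f

      r-comp : ∀ f g e → r (comp f g e) ≈ r f
      s-comp : ∀ f g e → s (comp f g e) ≈ s g

      identityˡ : ∀ f e → comp (r f) f e ≈ f
      identityʳ : ∀ f e → comp f (s f) e ≈ f
      assoc     : ∀ f g h e e′ e″ e‴ →
                  comp (comp f g e) h e′ ≈ comp f (comp g h e″) e‴

      countable : Injection setoid (≡.setoid ℕ)

      d      : Mor → Degree k
      d-cong : ∀ {f g} → f ≈ g → d f ≡ d g
      d-r    : ∀ f → d (r f) ≡ 0ᵈ
      d-s    : ∀ f → d (s f) ≡ 0ᵈ
      d-comp : ∀ f g e → d (comp f g e) ≡ d f ⊕ᵈ d g

    record Factorisation (f : Mor) (m n : Degree k) : Set where
      field
        μ ν        : Mor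
        composable : s ν ≈ r μ
        f≈νμ       : f ≈ comp ν μ composable
        dμ         : d μ ≡ m
        dν         : d ν ≡ n

  record HigherRankGraph (k : ℕ) : Set₁ where
    field gradedCategory : GradedCategory k

    open GradedCategory gradedCategory public

    field
      factorise : ∀ f m n → d f ≡ m ⊕ᵈ n → Factorisation f m n
      factorise-unique : ∀ {f m n} (F G : Factorisation f m n) →
        Factorisation.μ F ≈ Factorisation.μ G × Factorisation.ν F ≈ Factorisation.ν G

    Vertex : Mor → Set
    Vertex v = d v ≡ 0ᵈ

    _∈Λ[_,_] : Mor → Degree k → Mor → Set
    f ∈Λ[ n , v ] = d f ≡ n × r f ≈ v

    record Enumerates (fs : List Mor) (n : Degree k) (v : Mor) : Set where
      field
        sound    : All (_∈Λ[ n , v ]) fs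
        complete : ∀ f → f ∈Λ[ n , v ] → SetoidMembership._∈_ setoid f fs
        distinct : UniqueSetoid.Unique setoid fs

    RowFinite : Set
    RowFinite = ∀ n v → Vertex v → ∃[ fs ] Enumerates fs n v

    NoSources : Set
    NoSources = ∀ n v → Vertex v → ∃[ f ] f ∈Λ[ n , v ]

  Matrix : Set → Set
  Matrix S = S → S → ℕ

  module _ {S : Set} {N : ℕ} (finite : S ↔ Fin N) where

    infixl 7 _·_
    _·_ : Matrix S → Matrix S → Matrix S
    (M · M′) a c = sum (λ k → M a (elem k) * M′ (elem k) c)
      where
      open Sum +-0-commutativeMonoid using (sum)
      elem = Inverse.from finite

  record GridSystem : Set₁ where
    field
      S      : Set
      size   : ℕ
      finite : S ↔ Fin size
      N₁ N₂  : Matrix S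
      N₁≤1   : ∀ a b → N₁ a b ≤ 1
      N₂≤1   : ∀ a b → N₂ a b ≤ 1
      N₁N₂≤1 : ∀ a c → _·_ finite N₁ N₂ a c ≤ 1
      commute : ∀ a c → _·_ finite N₁ N₂ a c ≡ _·_ finite N₂ N₁ a c

  -- A morphism of degree (m , n).  The bounds are irrelevant, so at is a map on
  -- {0,…,m} × {0,…,n}.
  record Grid {S : Set} (N₁ N₂ : Matrix S) (m n : ℕ) : Set where
    no-eta-equality
    field
      at    : ∀ p q → .(p ≤ m) → .(q ≤ n) → S
      hstep : ∀ p q .(b : p < m) .(c : q ≤ n) → N₁ (at p q (<⇒≤ b) c) (at (suc p) q b c) ≡ 1
      vstep : ∀ p q .(b : p ≤ m) .(c : q < n) → N₂ (at p q b (<⇒≤ c)) (at p (suc q) b c) ≡ 1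

  open Grid public

  private
    variable
      X : Set
      H V : Matrix X
      m n m′ n′ : ℕ

  at-cong : ∀ (φ : Grid H V m n) {p p′ q q′} → p ≡ p′ → q ≡ q′ →
            .{b : p ≤ m} .{b′ : p′ ≤ m} .{c : q ≤ n} .{c′ : q′ ≤ n} →
            at φ p q b c ≡ at φ p′ q′ b′ c′
  at-cong φ refl refl = refl

  transpose : Grid H V m n → Grid V H n m
  transpose φ = record
    { at    = λ p q b c → at φ q p c b
    ; hstep = λ p q b c → vstep φ q p c b
    ; vstep = λ p q b c → hstep φ q p c b
    }

  -- The block of φ of size (m , n) whose lowest corner is (i , j).
  block : (φ : Grid H V m′ n′) (i j : ℕ) → .(i + m ≤ m′) → .(j + n ≤ n′) → Grid H V m n
  block {H = H} {V = V} {m = m} {n = n} φ i j B C = record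
    { at    = λ p q b c → at φ (i + p) (j + q)
                (≤-trans (+-monoʳ-≤ i b) B) (≤-trans (+-monoʳ-≤ j c) C)
    ; hstep = λ p q b c → trans (cong₂ H refl (at-cong φ (+-suc i p) refl))
                (hstep φ (i + p) (j + q)
                  (≤-trans (≤-reflexive (sym (+-suc i p))) (≤-trans (+-monoʳ-≤ i b) B)) _)
    ; vstep = λ p q b c → trans (cong₂ V refl (at-cong φ refl (+-suc j q)))
                (vstep φ (i + p) (j + q) _
                  (≤-trans (≤-reflexive (sym (+-suc j q))) (≤-trans (+-monoʳ-≤ j c) C)))
    }

  module _ {H V : Matrix X} (L : Grid H V m n) (R : Grid H V m′ n)
           (match : ∀ q .(c : q ≤ n) → at L m q ≤-refl c ≡ at R 0 q z≤n c) where

    glue-at : ∀ p q → .(p ≤ m + m′) → .(q ≤ n) → Dec (p ≤ m) → X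
    glue-at p q b c (yes p≤m) = at L p q p≤m c
    glue-at p q b c (no  _)   = at R (p ∸ m) q (m≤n+o⇒m∸n≤o p m b) c

    glue-left : ∀ p q .b .c d → (p≤m : p ≤ m) → glue-at p q b c d ≡ at L p q p≤m c
    glue-left p q b c (yes _) p≤m = refl
    glue-left p q b c (no p≰m) p≤m = contradiction p≤m p≰m

    glue-right : ∀ p q .b .c d (p′ : ℕ) .(b′ : p′ ≤ m′) → p ≡ m + p′ →
                 glue-at p q b c d ≡ at R p′ q b′ c
    glue-right p q b c (yes p≤m) zero b′ e =
      trans (at-cong L (trans e (+-identityʳ m)) refl) (match q c)
    glue-right p q b c (yes p≤m) (suc p′) b′ e =
      contradiction (≤-trans (m<m+n m {suc p′} (s≤s z≤n)) (≤-trans (≤-reflexive (sym e)) p≤m)) (<-irrefl refl)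
    glue-right p q b c (no _) p′ b′ refl = at-cong R (m+n∸m≡n m p′) refl

    glue-hstep : ∀ p q .(b : p < m + m′) .(c : q ≤ n) d d′ →
      H (glue-at p q (<⇒≤ b) c d) (glue-at (suc p) q b c d′) ≡ 1
    glue-hstep p q b c d (yes p<m) rewrite glue-left p q (<⇒≤ b) c d (<⇒≤ p<m) = hstep L p q p<m c
    glue-hstep p q b c d d′@(no p≮m) =
      trans (cong₂ H
        (glue-right p q (<⇒≤ b) c d (p ∸ m) (<⇒≤ k<m′) p≡)
        (glue-right (suc p) q b c d′ (suc (p ∸ m)) k<m′
          (trans (cong suc p≡) (sym (+-suc m (p ∸ m))))))
        (hstep R (p ∸ m) q k<m′ c)
      where
      m≤p : m ≤ p
      m≤p = ≮⇒≥ p≮m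
      p≡ : p ≡ m + (p ∸ m)
      p≡ = sym (m+[n∸m]≡n m≤p)
      k<m′ : p ∸ m < m′
      k<m′ = ≤-trans (≤-reflexive (sym (+-∸-assoc 1 m≤p))) (m≤n+o⇒m∸n≤o (suc p) m (recompute (_ ≤? _) b))

    glue-vstep : ∀ p q .(b : p ≤ m + m′) .(c : q < n) d →
      V (glue-at p q b (<⇒≤ c) d) (glue-at p (suc q) b c d) ≡ 1
    glue-vstep p q b c (yes p≤m) = vstep L p q p≤m c
    glue-vstep p q b c (no _)    = vstep R (p ∸ m) q (m≤n+o⇒m∸n≤o p m b) c

    hglue : Grid H V (m + m′) n
    hglue = record
      { at    = λ p q b c → glue-at p q b c (p ≤? m)
      ; hstep = λ p q b c → glue-hstep p q b c (p ≤? m) (suc p ≤? m)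
      ; vstep = λ p q b c → glue-vstep p q b c (p ≤? m)
      }

    hglue-left : ∀ p q .b .c (p≤m : p ≤ m) → at hglue p q b c ≡ at L p q p≤m c
    hglue-left p q b c = glue-left p q b c (p ≤? m)

    hglue-right : ∀ p q .b .c .(b′ : p ≤ m′) → at hglue (m + p) q b c ≡ at R p q b′ c
    hglue-right p q b c b′ = glue-right (m + p) q b c (m + p ≤? m) p b′ refl

  -- Filling a unit square from the path through one of its corners.
  record Fill {X : Set} (H V : Matrix X) : Set where
    field
      fill   : X → X → X
      fill-H : ∀ {a b c} → V a b ≡ 1 → H b c ≡ 1 → H a (fill a c) ≡ 1
      fill-V : ∀ {a b c} → V a b ≡ 1 → H b c ≡ 1 → V (fill a c) c ≡ 1
      unique : ∀ {a b b′ c} → H a b ≡ 1 → V b c ≡ 1 → H a b′ ≡ 1 → V b′ c ≡ 1 → b ≡ b′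

  open Fill

  -- The grid with left column w (read downwards) and top row h.
  module Corner {H V : Matrix X} (F : Fill H V) (m n : ℕ) (h w : ℕ → X)
                (h-step : ∀ p → p < m → H (h p) (h (suc p)) ≡ 1)
                (w-step : ∀ q → q < n → V (w (suc q)) (w q) ≡ 1)
                (h≡w : h 0 ≡ w 0) where

    c : ℕ → ℕ → X
    c p       zero    = h p
    c zero    (suc q) = w (suc q)
    c (suc p) (suc q) = fill F (c p (suc q)) (c (suc p) q)

    c-left : ∀ q → c 0 q ≡ w q
    c-left zero    = h≡w
    c-left (suc q) = refl

    c-H : ∀ p q → p < m → q ≤ n → H (c p q) (c (suc p) q) ≡ 1
    c-V : ∀ p q → p ≤ m → q < n → V (c p (suc q)) (c p q) ≡ 1

    c-H p zero    p<m q≤n = h-step p p<m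
    c-H p (suc q) p<m q<n = fill-H F (c-V p q (<⇒≤ p<m) q<n) (c-H p q p<m (<⇒≤ q<n))

    c-V zero    q p≤m q<n = trans (cong₂ V refl (c-left q)) (w-step q q<n)
    c-V (suc p) q p<m q<n = fill-V F (c-V p q (<⇒≤ p<m) q<n) (c-H p q p<m (<⇒≤ q<n))

    corner : Grid H V m n
    corner = record
      { at    = λ p q _ _ → c p (n ∸ q)
      ; hstep = λ p q p<m q≤n → c-H p (n ∸ q) (recompute (_ ≤? _) p<m) (m∸n≤m n q)
      ; vstep = λ p q p≤m q<n → v p q (recompute (_ ≤? _) p≤m) (recompute (_ ≤? _) q<n)
      }
      where
      v : ∀ p q → p ≤ m → q < n → V (c p (n ∸ q)) (c p (n ∸ suc q)) ≡ 1
      v p q p≤m q<n = trans (cong (λ k → V (c p k) (c p (n ∸ suc q))) n∸q≡)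
        (c-V p (n ∸ suc q) p≤m (≤-trans (≤-reflexive (sym n∸q≡)) (m∸n≤m n q)))
        where
        n∸q≡ : n ∸ q ≡ suc (n ∸ suc q)
        n∸q≡ = +-∸-assoc 1 q<n

    corner-left : ∀ q .b .c′ → at corner 0 q b c′ ≡ w (n ∸ q)
    corner-left q _ _ = c-left (n ∸ q)

    corner-top : ∀ p .b .c′ → at corner p n b c′ ≡ h p
    corner-top p _ _ = cong (c p) (n∸n≡0 n)

  module LowerRight {H V : Matrix X} (F : Fill H V)
                    (φ₁ : Grid H V m n) (φ₂ : Grid H V m′ n′)
                    (e : at φ₁ m n ≤-refl ≤-refl ≡ at φ₂ 0 0 z≤n z≤n) where

    h w : ℕ → X
    h p = at φ₂ (p ⊓ m′) 0 (m⊓n≤n p m′) z≤n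
    w q = at φ₁ m (n ∸ q) ≤-refl (m∸n≤m n q)

    h-at : ∀ p .(b : p ≤ m′) → h p ≡ at φ₂ p 0 b z≤n
    h-at p b = at-cong φ₂ (m≤n⇒m⊓n≡m (recompute (_ ≤? _) b)) refl

    h-step : ∀ p → p < m′ → H (h p) (h (suc p)) ≡ 1
    h-step p b = trans (cong₂ H (h-at p (<⇒≤ b)) (h-at (suc p) b)) (hstep φ₂ p 0 b z≤n)

    w-step : ∀ q → q < n → V (w (suc q)) (w q) ≡ 1
    w-step q b = trans (cong (V (w (suc q))) (at-cong φ₁ refl (+-∸-assoc 1 b)))
      (vstep φ₁ m (n ∸ suc q) ≤-refl (≤-trans (≤-reflexive (sym (+-∸-assoc 1 b))) (m∸n≤m n q)))

    open Corner F m′ n h w h-step w-step (sym e) public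

    left : ∀ q .(c : q ≤ n) → at φ₁ m q ≤-refl c ≡ at corner 0 q z≤n c
    left q c = trans (at-cong φ₁ refl (sym (m∸[m∸n]≡n (recompute (_ ≤? _) c))))
      (sym (corner-left q z≤n c))

    top : ∀ p .(b : p ≤ m′) → at corner p n b ≤-refl ≡ at φ₂ p 0 b z≤n
    top p b = trans (corner-top p b ≤-refl) (h-at p b)

  module Compose {H V : Matrix X} (F : Fill H V) (F′ : Fill V H)
                 (φ₁ : Grid H V m n) (φ₂ : Grid H V m′ n′)
                 (e : at φ₁ m n ≤-refl ≤-refl ≡ at φ₂ 0 0 z≤n z≤n) where

    module LR = LowerRight F φ₁ φ₂ e
    module UL = LowerRight F′ (transpose φ₁) (transpose φ₂) e

    lower : Grid H V (m + m′) n
    lower = hglue φ₁ LR.corner LR.left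

    upper : Grid H V (m + m′) n′
    upper = hglue (transpose UL.corner) φ₂ (λ q c → UL.top q c)

    middle : ∀ p .(b : p ≤ m + m′) → at lower p n b ≤-refl ≡ at upper p 0 b z≤n
    middle p b with p ≤? m
    ... | yes p≤m = UL.left p p≤m
    ... | no  _   = LR.top (p ∸ m) (m≤n+o⇒m∸n≤o p m b)

    match : ∀ q .(c : q ≤ m + m′) → at (transpose lower) n q ≤-refl c ≡ at (transpose upper) 0 q z≤n c
    match = middle

    composite : Grid H V (m + m′) (n + n′)
    composite = transpose (hglue (transpose lower) (transpose upper) match)

    composite-₁ : ∀ p q .b .c (p≤m : p ≤ m) (q≤n : q ≤ n) → at composite p q b c ≡ at φ₁ p q p≤m q≤n
    composite-₁ p q b c p≤m q≤n = trans
      (hglue-left (transpose lower) (transpose upper) match q p c b q≤n)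
      (hglue-left φ₁ LR.corner LR.left p q b q≤n p≤m)

    composite-₂ : ∀ p q .b .c .(p≤m′ : p ≤ m′) .(q≤n′ : q ≤ n′) →
                  at composite (m + p) (n + q) b c ≡ at φ₂ p q p≤m′ q≤n′
    composite-₂ p q b c p≤m′ q≤n′ = trans
      (hglue-right (transpose lower) (transpose upper) match q (m + p) c b q≤n′)
      (hglue-right (transpose UL.corner) φ₂ (λ q c → UL.top q c) p q b q≤n′ p≤m′)

  module HalfUnique {H V : Matrix X} (F : Fill H V) (χ χ′ : Grid H V m′ n′) (m n : ℕ)
    (m≤m′ : m ≤ m′) (n≤n′ : n ≤ n′)
    (agree₁ : ∀ p q .b .c → p ≤ m → q ≤ n → at χ p q b c ≡ at χ′ p q b c)
    (agree₂ : ∀ p q .b .c → m ≤ p → n ≤ q → at χ p q b c ≡ at χ′ p q b c) where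

    lower-right : ∀ i j p q .(b : p ≤ m′) .(c : q ≤ n′) → p ≡ m + i → q + j ≡ n →
                  at χ p q b c ≡ at χ′ p q b c
    lower-right zero j p q b c ep eq =
      agree₁ p q b c (≤-reflexive (trans ep (+-identityʳ m))) (≤-trans (m≤m+n q j) (≤-reflexive eq))
    lower-right (suc i) zero p q b c ep eq =
      agree₂ p q b c (≤-trans (m≤m+n m (suc i)) (≤-reflexive (sym ep)))
        (≤-reflexive (sym (trans (sym (+-identityʳ q)) eq)))
    lower-right (suc i) (suc j) zero q b c ep eq =
      contradiction (trans ep (+-suc m i)) λ ()
    lower-right (suc i) (suc j) (suc p) q b c ep eq =
      unique F (hstep χ p q b c) (vstep χ (suc p) q b q<)
        (trans (cong (λ x → H x (at χ′ (suc p) q b c))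
                 (lower-right i (suc j) p q (<⇒≤ b) c (suc-injective (trans ep (+-suc m i))) eq))
               (hstep χ′ p q b c))
        (trans (cong (V (at χ′ (suc p) q b c))
                 (lower-right (suc i) j (suc p) (suc q) b q< ep (trans (sym (+-suc q j)) eq)))
               (vstep χ′ (suc p) q b q<))
      where
      q< : q < n′
      q< = ≤-trans (≤-trans (m≤m+n (suc q) j) (≤-reflexive (trans (sym (+-suc q j)) eq))) n≤n′

  module GridUnique {H V : Matrix X} (F : Fill H V) (F′ : Fill V H) (χ χ′ : Grid H V m′ n′) (m n : ℕ)
    (m≤m′ : m ≤ m′) (n≤n′ : n ≤ n′)
    (agree₁ : ∀ p q .b .c → p ≤ m → q ≤ n → at χ p q b c ≡ at χ′ p q b c)
    (agree₂ : ∀ p q .b .c → m ≤ p → n ≤ q → at χ p q b c ≡ at χ′ p q b c) where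

    module U = HalfUnique F χ χ′ m n m≤m′ n≤n′ agree₁ agree₂
    module U′ = HalfUnique F′ (transpose χ) (transpose χ′) n m n≤n′ m≤m′
      (λ p q b c d e → agree₁ q p c b e d) (λ p q b c d e → agree₂ q p c b e d)

    agree : ∀ p q .b .c → at χ p q b c ≡ at χ′ p q b c
    agree p q b c with ≤-total p m | ≤-total q n
    ... | inj₁ p≤m | inj₁ q≤n = agree₁ p q b c p≤m q≤n
    ... | inj₂ m≤p | inj₂ n≤q = agree₂ p q b c m≤p n≤q
    ... | inj₂ m≤p | inj₁ q≤n =
      U.lower-right (p ∸ m) (n ∸ q) p q b c (sym (m+[n∸m]≡n m≤p)) (m+[n∸m]≡n q≤n)
    ... | inj₁ p≤m | inj₂ n≤q =
      U′.lower-right (q ∸ n) (m ∸ p) q p c b (sym (m+[n∸m]≡n n≤q)) (m+[n∸m]≡n p≤m)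

  module SumLemmas where
    open Sum +-0-commutativeMonoid using (sum; sum-cong-≗; sum-remove; sum-replicate-zero)

    term≤sum : ∀ {N} (f : Fin N → ℕ) i → f i ≤ sum f
    term≤sum f Fin.zero    = m≤m+n _ _
    term≤sum f (Fin.suc i) = ≤-trans (term≤sum (f ∘ Fin.suc) i) (m≤n+m _ (f Fin.zero))

    two≤sum : ∀ {N} (f : Fin N → ℕ) i j → i ≢ j → f i + f j ≤ sum f
    two≤sum f Fin.zero    Fin.zero    i≢j = contradiction refl i≢j
    two≤sum f Fin.zero    (Fin.suc j) _   = +-monoʳ-≤ (f Fin.zero) (term≤sum (f ∘ Fin.suc) j)
    two≤sum f (Fin.suc i) Fin.zero    _   = ≤-trans (≤-reflexive (+-comm (f (Fin.suc i)) _))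
      (+-monoʳ-≤ (f Fin.zero) (term≤sum (f ∘ Fin.suc) i))
    two≤sum f (Fin.suc i) (Fin.suc j) i≢j =
      ≤-trans (two≤sum (f ∘ Fin.suc) i j (i≢j ∘ cong Fin.suc)) (m≤n+m _ (f Fin.zero))

    positive-term : ∀ {N} (f : Fin N → ℕ) → 1 ≤ sum f → ∃[ i ] 1 ≤ f i
    positive-term {suc N} f 1≤ with f Fin.zero in eq
    ... | suc _ = Fin.zero , ≤-trans (s≤s z≤n) (≤-reflexive (sym eq))
    ... | zero  with positive-term (f ∘ Fin.suc) 1≤
    ...   | i , p = Fin.suc i , p

    sum-single : ∀ {N} (f : Fin N → ℕ) k → (∀ i → i ≢ k → f i ≡ 0) → sum f ≡ f k
    sum-single {suc N} f Fin.zero z = trans (cong (f Fin.zero +_)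
      (trans (sum-cong-≗ (λ i → z (Fin.suc i) λ ())) (sum-replicate-zero N))) (+-identityʳ _)
    sum-single {suc N} f (Fin.suc k) z = trans
      (cong₂ _+_ (z Fin.zero λ ()) (sum-single (f ∘ Fin.suc) k (λ i i≢k → z (Fin.suc i) (i≢k ∘ Fin.suc-injective))))
      refl

  open SumLemmas

  factors-1 : ∀ a b → a ≤ 1 → b ≤ 1 → 1 ≤ a * b → a ≡ 1 × b ≡ 1
  factors-1 1 1 _ _ _ = refl , refl
  factors-1 1 0 _ _ ()
  factors-1 (suc (suc a)) b (s≤s ()) _ _
  factors-1 1 (suc (suc b)) _ (s≤s ()) _

  module _ {S : Set} {N : ℕ} (finite : S ↔ Fin N) where
    private
      elem : Fin N → S
      elem = Inverse.from finite

      index : S → Fin N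
      index = Inverse.to finite

      elem-index : ∀ b → elem (index b) ≡ b
      elem-index b = Inverse.strictlyInverseʳ finite b

    mkFill : (H V : Matrix S) → (∀ a b → H a b ≤ 1) → (∀ a b → V a b ≤ 1) →
             (∀ a c → _·_ finite V H a c ≡ _·_ finite H V a c) →
             (∀ a c → _·_ finite H V a c ≤ 1) → Fill H V
    mkFill H V H≤1 V≤1 comm HV≤1 = record
      { fill   = λ a c → choose a (search a c)
      ; fill-H = λ {a} {b} {c} v h → proj₁ (chosen a c (search a c) (exists a b c v h))
      ; fill-V = λ {a} {b} {c} v h → proj₂ (chosen a c (search a c) (exists a b c v h))
      ; unique = unique′
      }
      where
      Mid : S → S → Fin N → Set
      Mid a c k = H a (elem k) ≡ 1 × V (elem k) c ≡ 1

      search : ∀ a c → Dec (∃[ k ] Mid a c k)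
      search a c = Fin.any? (λ k → (H a (elem k) ≟ 1) ×-dec (V (elem k) c ≟ 1))

      choose : ∀ a {c} → Dec (∃[ k ] Mid a c k) → S
      choose a (yes (k , _)) = elem k
      choose a (no _)        = a

      chosen : ∀ a c (x : Dec (∃[ k ] Mid a c k)) → ∃[ k ] Mid a c k →
               H a (choose a x) ≡ 1 × V (choose a x) c ≡ 1
      chosen a c (yes (k , m)) _ = m
      chosen a c (no ¬m)       m = contradiction m ¬m

      exists : ∀ a b c → V a b ≡ 1 → H b c ≡ 1 → ∃[ k ] Mid a c k
      exists a b c v h =
        let k , 1≤ = positive-term _ (≤-trans 1≤term (≤-trans
                       (term≤sum (λ k → V a (elem k) * H (elem k) c) (index b))
                       (≤-reflexive (comm a c))))
        in k , factors-1 _ _ (H≤1 _ _) (V≤1 _ _) 1≤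
        where
        1≤term : 1 ≤ V a (elem (index b)) * H (elem (index b)) c
        1≤term rewrite elem-index b | v | h = ≤-refl

      unique′ : ∀ {a b b′ c} → H a b ≡ 1 → V b c ≡ 1 → H a b′ ≡ 1 → V b′ c ≡ 1 → b ≡ b′
      unique′ {a} {b} {b′} {c} h v h′ v′ with index b Fin.≟ index b′
      ... | yes e = trans (sym (elem-index b)) (trans (cong elem e) (elem-index b′))
      ... | no ne = contradiction (≤-trans two (HV≤1 a c)) λ { (s≤s ()) }
        where
        f : Fin N → ℕ
        f k = H a (elem k) * V (elem k) c
        one : ∀ b → H a b ≡ 1 → V b c ≡ 1 → f (index b) ≡ 1
        one b h v rewrite elem-index b | h | v = refl
        two : 2 ≤ _·_ finite H V a c
        two = ≤-trans (≤-reflexive (sym (cong₂ _+_ (one b h v) (one b′ h′ v′))))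
                (two≤sum f (index b) (index b′) ne)

  -- An injection ℕ × ℕ → ℕ, (a , b) ↦ 2ᵃ(2b+1).
  module Pairing where
    pair : ℕ → ℕ → ℕ
    pair zero    b = suc (b + b)
    pair (suc a) b = pair a b + pair a b

    double-injective : ∀ x y → x + x ≡ y + y → x ≡ y
    double-injective zero    zero    _ = refl
    double-injective (suc x) (suc y) e = cong suc (double-injective x y
      (suc-injective (trans (sym (+-suc x x)) (trans (suc-injective e) (+-suc y y)))))

    odd≢even : ∀ x y → suc (x + x) ≢ y + y
    odd≢even x (suc y) e = odd≢even y x (sym (trans (suc-injective e) (+-suc y y)))

    pair-injective : ∀ a b a′ b′ → pair a b ≡ pair a′ b′ → a ≡ a′ × b ≡ b′
    pair-injective zero    b zero     b′ e = refl , double-injective b b′ (suc-injective e)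
    pair-injective zero    b (suc a′) b′ e = contradiction e (odd≢even b (pair a′ b′))
    pair-injective (suc a) b zero     b′ e = contradiction (sym e) (odd≢even b′ (pair a b))
    pair-injective (suc a) b (suc a′) b′ e =
      let a≡ , b≡ = pair-injective a b a′ b′ (double-injective (pair a b) (pair a′ b′) e)
      in cong suc a≡ , b≡

    code : (ℕ → ℕ) → ℕ → ℕ
    code f zero    = f 0
    code f (suc k) = pair (f (suc k)) (code f k)

    code-injective : ∀ f g k → code f k ≡ code g k → ∀ i → i ≤ k → f i ≡ g i
    code-injective f g zero    e .zero z≤n = e
    code-injective f g (suc k) e i i≤ with m≤n⇒m<n∨m≡n i≤
    ... | inj₁ i<   = code-injective f g k (proj₂ (split e)) i (s≤s⁻¹ i<)
      where split = pair-injective (f (suc k)) (code f k) (g (suc k)) (code g k)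
    ... | inj₂ refl = proj₁ (pair-injective (f (suc k)) (code f k) (g (suc k)) (code g k) e)

    code-cong : ∀ f g k → (∀ i → i ≤ k → f i ≡ g i) → code f k ≡ code g k
    code-cong f g zero    e = e 0 z≤n
    code-cong f g (suc k) e = cong₂ pair (e (suc k) ≤-refl) (code-cong f g k (λ i b → e i (m≤n⇒m≤1+n b)))

  -- All functions from {0,…,k-1} to a list, extended by a default value.
  module Enumeration {A : Set} (default : A) (as : List A) where
    cons : A → (ℕ → A) → ℕ → A
    cons a f zero    = a
    cons a f (suc i) = f i

    functions : ℕ → List (ℕ → A)
    functions zero    = (λ _ → default) ∷ []
    functions (suc k) = List.concatMap (λ a → List.map (cons a) (functions k)) as

    functions-complete : (_~_ : A → A → Set) (g : ℕ → A) → (∀ i → Any (g i ~_) as) →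
      ∀ k → Any (λ f → ∀ i → i < k → g i ~ f i) (functions k)
    functions-complete _~_ g total zero    = here λ _ ()
    functions-complete _~_ g total (suc k) =
      Any.concatMap⁺ _ (Any.map (λ {a} g0~a → Any.map⁺
        (Any.map (λ { h zero _ → g0~a ; h (suc i) (s≤s i<k) → h i i<k })
          (functions-complete _~_ (g ∘ suc) (total ∘ suc) k))) (total 0))

  module GridGraph (Sys : GridSystem) where
    open GridSystem Sys

    record Morphism : Set where
      constructor mor
      field
        {width height} : ℕ
        grid           : Grid N₁ N₂ width height

    open Morphism

    infix 4 _≋_
    record _≋_ (φ χ : Morphism) : Set where
      constructor mk≋
      field
        width≡  : width φ ≡ width χ
        height≡ : height φ ≡ height χ
        at≡     : ∀ p q .b .c .b′ .c′ → at (grid φ) p q b c ≡ at (grid χ) p q b′ c′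

    first last : Morphism → S
    first φ = at (grid φ) 0 0 z≤n z≤n
    last  φ = at (grid φ) (width φ) (height φ) ≤-refl ≤-refl

    vertex : S → Morphism
    vertex a = mor {0} {0} (record { at = λ _ _ _ _ → a ; hstep = λ _ _ () ; vstep = λ _ _ _ () })

    F  : Fill N₁ N₂
    F  = mkFill finite N₁ N₂ N₁≤1 N₂≤1 (λ a c → sym (commute a c)) N₁N₂≤1

    F′ : Fill N₂ N₁
    F′ = mkFill finite N₂ N₁ N₂≤1 N₁≤1 commute
           (λ a c → ≤-trans (≤-reflexive (sym (commute a c))) (N₁N₂≤1 a c))

    ≋-isEquivalence : IsEquivalence _≋_
    ≋-isEquivalence = record
      { refl  = mk≋ refl refl (λ _ _ _ _ _ _ → refl)
      ; sym   = λ { (mk≋ e f h) → mk≋ (sym e) (sym f) (λ p q b c b′ c′ → sym (h p q b′ c′ b c)) }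
      ; trans = λ { (mk≋ refl refl h) (mk≋ e′ f′ h′) → mk≋ e′ f′
          (λ p q b c b′ c′ → trans (h p q b c b c) (h′ p q b c b′ c′)) }
      }

    open IsEquivalence ≋-isEquivalence using () renaming (refl to ≋-refl; sym to ≋-sym; trans to ≋-trans)

    vertex-cong : ∀ {a b} → a ≡ b → vertex a ≋ vertex b
    vertex-cong e = mk≋ refl refl (λ _ _ _ _ _ _ → e)

    vertex-injective : ∀ {a b} → vertex a ≋ vertex b → a ≡ b
    vertex-injective (mk≋ _ _ h) = h 0 0 z≤n z≤n z≤n z≤n

    first-cong : ∀ {φ χ} → φ ≋ χ → first φ ≡ first χ
    first-cong (mk≋ _ _ h) = h 0 0 z≤n z≤n z≤n z≤n

    last-cong : ∀ {φ χ} → φ ≋ χ → last φ ≡ last χ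
    last-cong {φ} {χ} (mk≋ refl refl h) = h (width φ) (height φ) ≤-refl ≤-refl ≤-refl ≤-refl

    record IsComposite (φ₁ φ₂ χ : Morphism) : Set where
      field
        width-+  : width χ ≡ width φ₁ + width φ₂
        height-+ : height χ ≡ height φ₁ + height φ₂
        at-₁     : ∀ p q .b .c .(b′ : p ≤ width φ₁) .(c′ : q ≤ height φ₁) →
                   at (grid χ) p q b c ≡ at (grid φ₁) p q b′ c′
        at-₂     : ∀ p q .b .c .(b′ : p ≤ width φ₂) .(c′ : q ≤ height φ₂) →
                   at (grid χ) (width φ₁ + p) (height φ₁ + q) b c ≡ at (grid φ₂) p q b′ c′

    open IsComposite

    compose : ∀ φ₁ φ₂ → vertex (last φ₁) ≋ vertex (first φ₂) → Morphism
    compose φ₁ φ₂ e = mor (Compose.composite F F′ (grid φ₁) (grid φ₂) (vertex-injective e))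

    compose-isComposite : ∀ φ₁ φ₂ e → IsComposite φ₁ φ₂ (compose φ₁ φ₂ e)
    compose-isComposite φ₁ φ₂ e = record
      { width-+  = refl
      ; height-+ = refl
      ; at-₁     = λ p q b c b′ c′ →
          C.composite-₁ p q b c (recompute (_ ≤? _) b′) (recompute (_ ≤? _) c′)
      ; at-₂     = λ p q b c b′ c′ → C.composite-₂ p q b c b′ c′
      }
      where module C = Compose F F′ (grid φ₁) (grid φ₂) (vertex-injective e)

    composite-unique : ∀ {φ₁ φ₂ χ χ′} → IsComposite φ₁ φ₂ χ → IsComposite φ₁ φ₂ χ′ → χ ≋ χ′
    composite-unique {φ₁} {φ₂} {χ} {χ′} C C′ = go χ χ′ C C′ (width-+ C) (height-+ C) (width-+ C′) (height-+ C′)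
      where
      go : ∀ χ χ′ → IsComposite φ₁ φ₂ χ → IsComposite φ₁ φ₂ χ′ →
           width χ ≡ width φ₁ + width φ₂ → height χ ≡ height φ₁ + height φ₂ →
           width χ′ ≡ width φ₁ + width φ₂ → height χ′ ≡ height φ₁ + height φ₂ → χ ≋ χ′
      go (mor g) (mor g′) C C′ refl refl refl refl = mk≋ refl refl λ p q b c b′ c′ →
        GridUnique.agree F F′ g g′ (width φ₁) (height φ₁) (m≤m+n _ _) (m≤m+n _ _)
          (λ p q b c p≤ q≤ → trans (at-₁ C p q b c p≤ q≤) (sym (at-₁ C′ p q b c p≤ q≤)))
          (λ p q b c ≤p ≤q → upper-eq p q b c ≤p ≤q)
          p q b c
        where
        upper-eq : ∀ p q .b .c → width φ₁ ≤ p → height φ₁ ≤ q → at g p q b c ≡ at g′ p q b c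
        upper-eq p q b c ≤p ≤q = shifted (p ∸ width φ₁) (q ∸ height φ₁) p q
          (sym (m+[n∸m]≡n ≤p)) (sym (m+[n∸m]≡n ≤q)) b c
          where
          shifted : ∀ i j p q → p ≡ width φ₁ + i → q ≡ height φ₁ + j →
                    ∀ .b .c → at g p q b c ≡ at g′ p q b c
          shifted i j _ _ refl refl b c =
            trans (at-₂ C i j b c (+-cancelˡ-≤ (width φ₁) _ _ b) (+-cancelˡ-≤ (height φ₁) _ _ c))
             (sym (at-₂ C′ i j b c (+-cancelˡ-≤ (width φ₁) _ _ b) (+-cancelˡ-≤ (height φ₁) _ _ c)))

    isComposite-resp : ∀ {φ₁ φ₁′ φ₂ φ₂′ χ χ′} → φ₁ ≋ φ₁′ → φ₂ ≋ φ₂′ → χ ≋ χ′ →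
                       IsComposite φ₁ φ₂ χ → IsComposite φ₁′ φ₂′ χ′
    isComposite-resp (mk≋ refl refl h₁) (mk≋ refl refl h₂) (mk≋ refl refl h) C = record
      { width-+  = width-+ C
      ; height-+ = height-+ C
      ; at-₁ = λ p q b c b′ c′ →
          trans (sym (h p q b c b c)) (trans (at-₁ C p q b c b′ c′) (h₁ p q b′ c′ b′ c′))
      ; at-₂ = λ p q b c b′ c′ →
          trans (sym (h _ _ b c b c)) (trans (at-₂ C p q b c b′ c′) (h₂ p q b′ c′ b′ c′))
      }

    first-composite : ∀ {φ₁ φ₂ χ} → IsComposite φ₁ φ₂ χ → first χ ≡ first φ₁
    first-composite C = at-₁ C 0 0 z≤n z≤n z≤n z≤n

    last-composite : ∀ {φ₁ φ₂ χ} → IsComposite φ₁ φ₂ χ → last χ ≡ last φ₂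
    last-composite {φ₁} {φ₂} {χ} C = trans (at-cong (grid χ) (width-+ C) (height-+ C))
      (at-₂ C (width φ₂) (height φ₂) (≤-reflexive (sym (width-+ C))) (≤-reflexive (sym (height-+ C))) ≤-refl ≤-refl)

    identityˡ-composite : ∀ φ → IsComposite (vertex (first φ)) φ φ
    identityˡ-composite φ = record
      { width-+ = refl ; height-+ = refl
      ; at-₁ = λ p q b c b′ c′ → at-cong (grid φ) (n≤0⇒n≡0 (recompute (_ ≤? _) b′)) (n≤0⇒n≡0 (recompute (_ ≤? _) c′))
      ; at-₂ = λ p q b c b′ c′ → refl
      }

    identityʳ-composite : ∀ φ → IsComposite φ (vertex (last φ)) φ
    identityʳ-composite φ = record
      { width-+ = sym (+-identityʳ _) ; height-+ = sym (+-identityʳ _)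
      ; at-₁ = λ p q b c b′ c′ → refl
      ; at-₂ = λ p q b c b′ c′ → at-cong (grid φ)
          (trans (cong (width φ +_) (n≤0⇒n≡0 (recompute (_ ≤? _) b′))) (+-identityʳ _))
          (trans (cong (height φ +_) (n≤0⇒n≡0 (recompute (_ ≤? _) c′))) (+-identityʳ _))
      }

    assoc-composite : ∀ {f g h fg fgh gh} → IsComposite f g fg → IsComposite fg h fgh →
                      IsComposite g h gh → IsComposite f gh fgh
    assoc-composite {f} {g} {h} {fg} {fgh} {gh} A B D = record
      { width-+  = width≡
      ; height-+ = height≡
      ; at-₁     = λ p q b c b′ c′ →
          trans (at-₁ B p q b c (≤fg b′) (≤fg′ c′)) (at-₁ A p q (≤fg b′) (≤fg′ c′) b′ c′)
      ; at-₂     = λ p q b c b′ c′ →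
          _≋_.at≡ tail≋gh p q (b″ b′) (c″ c′) b′ c′
      }
      where
      w≡ : width fgh ≡ width f + (width g + width h)
      w≡ = trans (width-+ B) (trans (cong (_+ width h) (width-+ A)) (+-assoc (width f) _ _))
      h≡ : height fgh ≡ height f + (height g + height h)
      h≡ = trans (height-+ B) (trans (cong (_+ height h) (height-+ A)) (+-assoc (height f) _ _))
      width≡ : width fgh ≡ width f + width gh
      width≡ = trans w≡ (cong (width f +_) (sym (width-+ D)))
      height≡ : height fgh ≡ height f + height gh
      height≡ = trans h≡ (cong (height f +_) (sym (height-+ D)))
      ≤fg : ∀ {p} → .(p ≤ width f) → p ≤ width fg
      ≤fg b = ≤-trans (recompute (_ ≤? _) b) (≤-trans (m≤m+n _ _) (≤-reflexive (sym (width-+ A))))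
      ≤fg′ : ∀ {p} → .(p ≤ height f) → p ≤ height fg
      ≤fg′ b = ≤-trans (recompute (_ ≤? _) b) (≤-trans (m≤m+n _ _) (≤-reflexive (sym (height-+ A))))
      b″ : ∀ {p} → .(p ≤ width gh) → p ≤ width g + width h
      b″ b = ≤-trans (recompute (_ ≤? _) b) (≤-reflexive (width-+ D))
      c″ : ∀ {p} → .(p ≤ height gh) → p ≤ height g + height h
      c″ b = ≤-trans (recompute (_ ≤? _) b) (≤-reflexive (height-+ D))
      tail : Morphism
      tail = mor {width g + width h} {height g + height h}
        (block (grid fgh) (width f) (height f) (≤-reflexive (sym w≡)) (≤-reflexive (sym h≡)))
      tail-composite : IsComposite g h tail
      tail-composite = record
        { width-+  = refl
        ; height-+ = refl
        ; at-₁     = λ p q b c b′ c′ → trans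
            (at-₁ B (width f + p) (height f + q) _ _ (in-fg b′) (in-fg′ c′))
            (at-₂ A p q (in-fg b′) (in-fg′ c′) b′ c′)
        ; at-₂     = λ p q b c b′ c′ → trans
            (at-cong (grid fgh)
              (trans (sym (+-assoc (width f) (width g) p)) (cong (_+ p) (sym (width-+ A))))
              (trans (sym (+-assoc (height f) (height g) q)) (cong (_+ q) (sym (height-+ A)))))
            (at-₂ B p q
              (≤-trans (+-monoʳ-≤ (width fg) b′) (≤-reflexive (sym (width-+ B))))
              (≤-trans (+-monoʳ-≤ (height fg) c′) (≤-reflexive (sym (height-+ B)))) b′ c′)
        }
        where
        in-fg : ∀ {p} → .(p ≤ width g) → width f + p ≤ width fg
        in-fg b = ≤-trans (+-monoʳ-≤ (width f) (recompute (_ ≤? _) b)) (≤-reflexive (sym (width-+ A)))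
        in-fg′ : ∀ {p} → .(p ≤ height g) → height f + p ≤ height fg
        in-fg′ b = ≤-trans (+-monoʳ-≤ (height f) (recompute (_ ≤? _) b)) (≤-reflexive (sym (height-+ A)))
      tail≋gh : tail ≋ gh
      tail≋gh = composite-unique tail-composite D

    degree : Morphism → Degree 2
    degree φ = width φ ∷ height φ ∷ []

    index : S → ℕ
    index a = Fin.toℕ (Inverse.to finite a)

    index-injective : ∀ {a b} → index a ≡ index b → a ≡ b
    index-injective {a} {b} e = trans (sym (Inverse.strictlyInverseʳ finite a))
      (trans (cong (Inverse.from finite) (Fin.toℕ-injective e)) (Inverse.strictlyInverseʳ finite b))

    extend : Morphism → ℕ → ℕ → S
    extend φ p q = at (grid φ) (p ⊓ width φ) (q ⊓ height φ) (m⊓n≤n p _) (m⊓n≤n q _)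

    extend-at : ∀ φ p q .b .c → extend φ p q ≡ at (grid φ) p q b c
    extend-at φ p q b c = at-cong (grid φ)
      (m≤n⇒m⊓n≡m (recompute (_ ≤? _) b)) (m≤n⇒m⊓n≡m (recompute (_ ≤? _) c))

    extend-≋ : ∀ φ χ → width φ ≡ width χ → height φ ≡ height χ →
               (∀ p q → p ≤ width φ → q ≤ height φ → extend φ p q ≡ extend χ p q) → φ ≋ χ
    extend-≋ φ χ e f h = mk≋ e f λ p q b c b′ c′ →
      trans (sym (extend-at φ p q b c))
        (trans (h p q (recompute (_ ≤? _) b) (recompute (_ ≤? _) c)) (extend-at χ p q b′ c′))

    open Pairing

    row : Morphism → ℕ → ℕ
    row φ p = code (λ q → index (extend φ p q)) (height φ)

    cells : Morphism → ℕ
    cells φ = code (row φ) (width φ)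

    encode : Morphism → ℕ
    encode φ = pair (width φ) (pair (height φ) (cells φ))

    encode-cong : ∀ {φ χ} → φ ≋ χ → encode φ ≡ encode χ
    encode-cong {mor {m} {n} f} {mor g} (mk≋ refl refl h) = cong (λ x → pair m (pair n x))
      (code-cong (row (mor f)) (row (mor g)) m λ p _ →
        code-cong (λ q → index (extend (mor f) p q)) (λ q → index (extend (mor g) p q)) n λ q _ →
          cong index (h (p ⊓ m) (q ⊓ n) (m⊓n≤n p m) (m⊓n≤n q n) (m⊓n≤n p m) (m⊓n≤n q n)))

    encode-injective : ∀ {φ χ} → encode φ ≡ encode χ → φ ≋ χ
    encode-injective {φ} {χ} e =
      let w≡ , e₁ = pair-injective (width φ) (pair (height φ) (cells φ))
                                   (width χ) (pair (height χ) (cells χ)) e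
          h≡ , e₂ = pair-injective (height φ) (cells φ) (height χ) (cells χ) e₁
      in go φ χ w≡ h≡ e₂
      where
      go : ∀ φ χ → width φ ≡ width χ → height φ ≡ height χ → cells φ ≡ cells χ → φ ≋ χ
      go (mor {m} {n} f) (mor g) refl refl e = extend-≋ (mor f) (mor g) refl refl λ p q p≤ q≤ →
        index-injective
          (code-injective (λ q → index (extend (mor f) p q)) (λ q → index (extend (mor g) p q)) n
            (code-injective (row (mor f)) (row (mor g)) m e p p≤) q q≤)

    comp-cong : ∀ {f f′ g g′} e e′ → f ≋ f′ → g ≋ g′ → compose f g e ≋ compose f′ g′ e′
    comp-cong {f} {f′} {g} {g′} e e′ f≋ g≋ = composite-unique
      (isComposite-resp f≋ g≋ ≋-refl (compose-isComposite f g e)) (compose-isComposite f′ g′ e′)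

    r-comp : ∀ f g e → vertex (first (compose f g e)) ≋ vertex (first f)
    r-comp f g e = vertex-cong (first-composite (compose-isComposite f g e))

    s-comp : ∀ f g e → vertex (last (compose f g e)) ≋ vertex (last g)
    s-comp f g e = vertex-cong (last-composite (compose-isComposite f g e))

    identityˡ : ∀ f e → compose (vertex (first f)) f e ≋ f
    identityˡ f e = composite-unique
      (compose-isComposite (vertex (first f)) f e) (identityˡ-composite f)

    identityʳ : ∀ f e → compose f (vertex (last f)) e ≋ f
    identityʳ f e = composite-unique
      (compose-isComposite f (vertex (last f)) e) (identityʳ-composite f)

    assoc : ∀ f g h e e′ e″ e‴ → compose (compose f g e) h e′ ≋ compose f (compose g h e″) e‴
    assoc f g h e e′ e″ e‴ = composite-unique
      (assoc-composite (compose-isComposite f g e) (compose-isComposite (compose f g e) h e′)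
                       (compose-isComposite g h e″))
      (compose-isComposite f (compose g h e″) e‴)

    d-cong : ∀ {f g} → f ≋ g → degree f ≡ degree g
    d-cong (mk≋ e f _) = cong₂ (λ m n → m ∷ n ∷ []) e f

    countable : Injection (record { isEquivalence = ≋-isEquivalence }) (≡.setoid ℕ)
    countable = record { to = encode ; cong = encode-cong ; injective = encode-injective }

    gradedCategory : GradedCategory 2
    gradedCategory = record
      { Mor           = Morphism
      ; _≈_           = _≋_
      ; isEquivalence = ≋-isEquivalence
      ; r             = λ φ → vertex (first φ)
      ; s             = λ φ → vertex (last φ)
      ; r-cong        = λ e → vertex-cong (first-cong e)
      ; s-cong        = λ e → vertex-cong (last-cong e)
      ; comp          = compose
      ; comp-cong     = comp-cong
      ; r-r           = λ _ → ≋-refl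
      ; s-r           = λ _ → ≋-refl
      ; r-s           = λ _ → ≋-refl
      ; s-s           = λ _ → ≋-refl
      ; r-comp        = r-comp
      ; s-comp        = s-comp
      ; identityˡ     = identityˡ
      ; identityʳ     = identityʳ
      ; assoc         = assoc
      ; countable     = countable
      ; d             = degree
      ; d-cong        = d-cong
      ; d-r           = λ _ → refl
      ; d-s           = λ _ → refl
      ; d-comp        = λ _ _ _ → refl
      }

    open GradedCategory gradedCategory using (Factorisation)

    factorise : ∀ f m n → degree f ≡ m ⊕ᵈ n → Factorisation f m n
    factorise (mor {w} {h} g) (m₁ ∷ m₂ ∷ []) (n₁ ∷ n₂ ∷ []) refl = record
      { μ          = μ
      ; ν          = ν
      ; composable = e
      ; f≈νμ       = composite-unique {ν} {μ} (record
          { width-+  = +-comm m₁ n₁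
          ; height-+ = +-comm m₂ n₂
          ; at-₁     = λ p q b c b′ c′ → refl
          ; at-₂     = λ p q b c b′ c′ → refl
          }) (compose-isComposite ν μ e)
      ; dμ         = refl
      ; dν         = refl
      }
      where
      ν μ : Morphism
      ν = mor {n₁} {n₂} (block g 0 0 (m≤n+m n₁ m₁) (m≤n+m n₂ m₂))
      μ = mor {m₁} {m₂} (block g n₁ n₂ (≤-reflexive (+-comm n₁ m₁)) (≤-reflexive (+-comm n₂ m₂)))
      e : vertex (last ν) ≋ vertex (first μ)
      e = vertex-cong (at-cong g (sym (+-identityʳ n₁)) (sym (+-identityʳ n₂)))

    factorise-unique : ∀ {f m n} (A B : Factorisation f m n) →
      Factorisation.μ A ≋ Factorisation.μ B × Factorisation.ν A ≋ Factorisation.ν B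
    factorise-unique {f} A B = go A.μ A.ν B.μ B.ν
        (trans A.dμ (sym B.dμ)) (trans A.dν (sym B.dν))
        (isComposite-resp ≋-refl ≋-refl (≋-sym A.f≈νμ) (compose-isComposite A.ν A.μ A.composable))
        (isComposite-resp ≋-refl ≋-refl (≋-sym B.f≈νμ) (compose-isComposite B.ν B.μ B.composable))
      where
      module A = Factorisation A
      module B = Factorisation B
      go : ∀ μ ν μ′ ν′ → degree μ ≡ degree μ′ → degree ν ≡ degree ν′ →
           IsComposite ν μ f → IsComposite ν′ μ′ f → μ ≋ μ′ × ν ≋ ν′
      go (mor {w} {h} g) (mor {w₁} {h₁} g₁) (mor g′) (mor g₁′) refl refl C C′ =
        mk≋ refl refl (λ p q b c b′ c′ → trans
          (sym (at-₂ C p q (in₂ b) (in₂′ c) b c)) (at-₂ C′ p q (in₂ b) (in₂′ c) b′ c′)) ,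
        mk≋ refl refl (λ p q b c b′ c′ → trans
          (sym (at-₁ C p q (in₁ b) (in₁′ c) b c)) (at-₁ C′ p q (in₁ b) (in₁′ c) b′ c′))
        where
        in₁ : ∀ {p} → p ≤ w₁ → p ≤ width f
        in₁ b = ≤-trans b (≤-trans (m≤m+n _ _) (≤-reflexive (sym (width-+ C))))
        in₁′ : ∀ {p} → p ≤ h₁ → p ≤ height f
        in₁′ b = ≤-trans b (≤-trans (m≤m+n _ _) (≤-reflexive (sym (height-+ C))))
        in₂ : ∀ {p} → p ≤ w → w₁ + p ≤ width f
        in₂ b = ≤-trans (+-monoʳ-≤ w₁ b) (≤-reflexive (sym (width-+ C)))
        in₂′ : ∀ {p} → p ≤ h → h₁ + p ≤ height f
        in₂′ b = ≤-trans (+-monoʳ-≤ h₁ b) (≤-reflexive (sym (height-+ C)))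

    graph : HigherRankGraph 2
    graph = record
      { gradedCategory = gradedCategory ; factorise = factorise ; factorise-unique = factorise-unique }

    open HigherRankGraph graph using (Enumerates; _∈Λ[_,_]; Vertex; setoid)

    _≟ˢ_ : (a b : S) → Dec (a ≡ b)
    a ≟ˢ b = map′ index-injective (cong index) (index a ≟ index b)

    _≋?_ : ∀ φ χ → Dec (φ ≋ χ)
    φ ≋? χ = map′ from to
      ((width φ ≟ width χ) ×-dec ((height φ ≟ height χ) ×-dec
        allUpTo? (λ p → allUpTo? (λ q → extend φ p q ≟ˢ extend χ p q) (suc (height φ))) (suc (width φ))))
      where
      Same : Set
      Same = width φ ≡ width χ × height φ ≡ height χ ×
        (∀ {p} → p < suc (width φ) → ∀ {q} → q < suc (height φ) → extend φ p q ≡ extend χ p q)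
      from : Same → φ ≋ χ
      from (e , f , h) = extend-≋ φ χ e f (λ p q b c → h (s≤s b) (s≤s c))
      to : φ ≋ χ → Same
      to (mk≋ refl refl h) = refl , refl , λ {p} _ {q} _ →
        h (p ⊓ width φ) (q ⊓ height φ) (m⊓n≤n p _) (m⊓n≤n q _) (m⊓n≤n p _) (m⊓n≤n q _)

    decSetoid : DecSetoid 0ℓ 0ℓ
    decSetoid = record { isDecEquivalence = record { isEquivalence = ≋-isEquivalence ; _≟_ = _≋?_ } }

    module _ (m n : ℕ) where
      Steps : (ℕ → ℕ → S) → Set
      Steps f = (∀ {p} → p < m → ∀ {q} → q < suc n → N₁ (f p q) (f (suc p) q) ≡ 1) ×
                (∀ {p} → p < suc m → ∀ {q} → q < n → N₂ (f p q) (f p (suc q)) ≡ 1)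

      steps? : ∀ f → Dec (Steps f)
      steps? f =
        allUpTo? (λ p → allUpTo? (λ q → N₁ (f p q) (f (suc p) q) ≟ 1) (suc n)) m ×-dec
        allUpTo? (λ p → allUpTo? (λ q → N₂ (f p q) (f p (suc q)) ≟ 1) n) (suc m)

      toMorphism : ∀ f → Steps f → Morphism
      toMorphism f (hs , vs) = mor {m} {n} (record
        { at    = λ p q _ _ → f p q
        ; hstep = λ p q b c → hs (recompute (_ ≤? _) b) (s≤s (recompute (_ ≤? _) c))
        ; vstep = λ p q b c → vs (s≤s (recompute (_ ≤? _) b)) (recompute (_ ≤? _) c)
        })

      candidate : ∀ f → Dec (Steps f) → List Morphism
      candidate f (yes st) = toMorphism f st ∷ []
      candidate f (no _)   = []

      module _ (default : S) where
        elements : List S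
        elements = List.map (Inverse.from finite) (List.allFin size)

        element : ∀ a → Any (a ≡_) elements
        element a = Any.map⁺ (Any.tabulate⁺ (Inverse.to finite a) (sym (Inverse.strictlyInverseʳ finite a)))

        module Rows = Enumeration default elements
        module Arrays = Enumeration (λ _ → default) (Rows.functions (suc n))

        morphisms : List Morphism
        morphisms = List.concatMap (λ f → candidate f (steps? f)) (Arrays.functions (suc m))

        morphisms-degree : All (λ f → degree f ≡ m ∷ n ∷ []) morphisms
        morphisms-degree = All.concat⁺ (All.map⁺ (All.universal (λ f → one f (steps? f)) (Arrays.functions (suc m))))
          where
          one : ∀ f x → All (λ f → degree f ≡ m ∷ n ∷ []) (candidate f x)
          one f (yes _) = refl All.∷ All.[]
          one f (no _)  = All.[]

        morphisms-complete : ∀ φ → degree φ ≡ m ∷ n ∷ [] → Any (φ ≋_) morphisms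
        morphisms-complete (mor g) refl = Any.concatMap⁺ _ (Any.map
          (λ {f} agree → found f agree (steps? f))
          (Arrays.functions-complete (λ u v → ∀ j → j < suc n → u j ≡ v j) (extend φ)
            (λ p → Rows.functions-complete _≡_ (extend φ p) (λ q → element (extend φ p q)) (suc n)) (suc m)))
          where
          φ = mor g
          found : ∀ f → (∀ i → i < suc m → ∀ j → j < suc n → extend φ i j ≡ f i j) →
                  ∀ x → Any (φ ≋_) (candidate f x)
          found f agree (yes st) = here (mk≋ refl refl λ p q b c _ _ →
            trans (sym (extend-at φ p q b c))
              (agree p (s≤s (recompute (_ ≤? _) b)) q (s≤s (recompute (_ ≤? _) c))))
          found f agree (no ¬st) = contradiction
            ( (λ {p} p< {q} q< → trans (sym (cong₂ N₁ (at-f p q (<⇒≤ p<) (s≤s⁻¹ q<)) (at-f (suc p) q p< (s≤s⁻¹ q<))))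
                                   (hstep g p q p< (s≤s⁻¹ q<)))
            , (λ {p} p< {q} q< → trans (sym (cong₂ N₂ (at-f p q (s≤s⁻¹ p<) (<⇒≤ q<)) (at-f p (suc q) (s≤s⁻¹ p<) q<)))
                                   (vstep g p q (s≤s⁻¹ p<) q<)) ) ¬st
            where
            at-f : ∀ p q (b : p ≤ m) (c : q ≤ n) → at g p q b c ≡ f p q
            at-f p q b c = trans (sym (extend-at φ p q b c)) (agree p (s≤s b) q (s≤s c))

    rowFinite : HigherRankGraph.RowFinite graph
    rowFinite (m ∷ n ∷ []) v _ = List.deduplicate _≋?_ found , record
      { sound    = All.deduplicate⁺ _≋?_ (All.zip
          (All.filter⁺ r? (morphisms-degree m n a) , All.all-filter r? (morphisms m n a)))
      ; complete = λ { f (e , e′) → Membership.∈-deduplicate⁺ setoid _≋?_ (λ x y → ≋-trans y (≋-sym x))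
          (Membership.∈-filter⁺ setoid r? (λ x y → ≋-trans (vertex-cong (first-cong (≋-sym x))) y)
            (morphisms-complete m n a f e) e′) }
      ; distinct = Unique.deduplicate-! decSetoid found
      }
      where
      a = first v
      r? : ∀ f → Dec (vertex (first f) ≋ v)
      r? f = vertex (first f) ≋? v
      found = List.filter r? (morphisms m n a)

    noSources : (∀ a → ∃[ b ] N₁ a b ≡ 1) → (∀ a → ∃[ b ] N₂ a b ≡ 1) →
                HigherRankGraph.NoSources graph
    noSources next₁ next₂ (m ∷ n ∷ []) v v-vertex = mor corner , refl , range v v-vertex first≡
      where
      walk : (S → S) → S → ℕ → S
      walk f a zero    = a
      walk f a (suc k) = f (walk f a k)
      up right : ℕ → S
      up    = walk (proj₁ ∘ next₂) (first v)
      right = walk (proj₁ ∘ next₁) (up n)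
      open Corner F m n right (λ q → up (n ∸ q))
        (λ p _ → proj₂ (next₁ (right p)))
        (λ q q<n → subst (λ k → N₂ (up (n ∸ suc q)) (up k) ≡ 1) (sym (+-∸-assoc 1 q<n))
                     (proj₂ (next₂ (up (n ∸ suc q)))))
        refl
      first≡ : first (mor corner) ≡ first v
      first≡ = trans (corner-left 0 z≤n z≤n) (cong up (n∸n≡0 n))
      range : ∀ v → degree v ≡ 0 ∷ 0 ∷ [] → ∀ {a} → a ≡ first v → vertex a ≋ v
      range (mor g) refl e = mk≋ refl refl λ p q b c b′ c′ → trans e
        (at-cong g (sym (n≤0⇒n≡0 (recompute (_ ≤? _) b))) (sym (n≤0⇒n≡0 (recompute (_ ≤? _) c))))

  𝟙 : ∀ {P : Set} → Dec P → ℕ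
  𝟙 P? = if does P? then 1 else 0

  𝟙≤1 : ∀ {P : Set} (P? : Dec P) → 𝟙 P? ≤ 1
  𝟙≤1 (yes _) = ≤-refl
  𝟙≤1 (no _)  = z≤n

  𝟙-yes : ∀ {P : Set} (P? : Dec P) → P → 𝟙 P? ≡ 1
  𝟙-yes (yes _) _ = refl
  𝟙-yes (no ¬p) p = contradiction p ¬p

  𝟙-no : ∀ {P : Set} (P? : Dec P) → ¬ P → 𝟙 P? ≡ 0
  𝟙-no (yes p) ¬p = contradiction p ¬p
  𝟙-no (no _)  _  = refl

  𝟙-sound : ∀ {P : Set} (P? : Dec P) → 𝟙 P? ≡ 1 → P
  𝟙-sound (yes p) _ = p

  𝟙-cong : ∀ {P Q : Set} (P? : Dec P) (Q? : Dec Q) → (P → Q) → (Q → P) → 𝟙 P? ≡ 𝟙 Q?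
  𝟙-cong (yes p) Q? f g = sym (𝟙-yes Q? (f p))
  𝟙-cong (no ¬p) Q? f g = sym (𝟙-no Q? (¬p ∘ g))

  -- The unpointed tiles, i.e. the classes of the identification of pointed tiles,
  -- are in bijection with the pairs (i , j), as are the unpointed 2t-gons A_ij; a
  -- pair stands for its class, given by representative resp. boundary below.
  Index : ℕ → ℕ → Set
  Index α β = Fin α × Fin β

  index-finite : ∀ α β → Index α β ↔ Fin (α * β)
  index-finite α β = ↔-sym (Fin.*↔× {α} {β})

  SameColumn SameRow : ∀ {α β} → Index α β → Index α β → Set
  SameColumn (i , j) (k , l) = j ≡ l × i ≢ k
  SameRow    (i , j) (k , l) = i ≡ k × j ≢ l

  module Moves (α β : ℕ) (M₁ M₂ : Matrix (Index α β)) (M₁≤1 : ∀ a b → M₁ a b ≤ 1) (M₂≤1 : ∀ a b → M₂ a b ≤ 1)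
               (to₁ : ∀ a b → SameColumn a b → M₁ a b ≡ 1) (from₁ : ∀ a b → M₁ a b ≡ 1 → SameColumn a b)
               (to₂ : ∀ a b → SameRow a b → M₂ a b ≡ 1) (from₂ : ∀ a b → M₂ a b ≡ 1 → SameRow a b)
    where

    fin : Index α β ↔ Fin (α * β)
    fin = index-finite α β

    zero-or-one : ∀ {k} → k ≤ 1 → k ≢ 1 → k ≡ 0
    zero-or-one {zero}        _ _ = refl
    zero-or-one {suc zero}    _ k≢1 = contradiction refl k≢1
    zero-or-one {suc (suc k)} (s≤s ()) _

    equal : ∀ {x y} → x ≤ 1 → y ≤ 1 → (x ≡ 1 → y ≡ 1) → (y ≡ 1 → x ≡ 1) → x ≡ y
    equal {zero} {zero} _ _ _ _ = refl
    equal {zero} {suc zero} _ _ _ g = contradiction (g refl) λ ()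
    equal {suc zero} _ _ f _ = sym (f refl)
    equal {zero} {suc (suc y)} _ (s≤s ()) _ _
    equal {suc (suc x)} (s≤s ()) _ _ _

    elem = Inverse.from fin
    pos  = Inverse.to fin

    elem-pos : ∀ b → elem (pos b) ≡ b
    elem-pos = Inverse.strictlyInverseʳ fin

    pos-elem : ∀ k → pos (elem k) ≡ k
    pos-elem = Inverse.strictlyInverseˡ fin

    product : (M M′ : Matrix (Index α β)) → ∀ a c b → (∀ b′ → b′ ≢ b → M a b′ * M′ b′ c ≡ 0) →
              _·_ fin M M′ a c ≡ M a b * M′ b c
    product M M′ a c b z = trans
      (sum-single (λ k → M a (elem k) * M′ (elem k) c) (pos b)
        (λ k k≢ → z (elem k) (λ e → k≢ (trans (sym (pos-elem k)) (cong pos e)))))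
      (cong (λ b → M a b * M′ b c) (elem-pos b))

    product₁₂ : ∀ a c → _·_ fin M₁ M₂ a c ≡
                M₁ a (proj₁ c , proj₂ a) * M₂ (proj₁ c , proj₂ a) c
    product₁₂ a c = product M₁ M₂ a c _ zeros
      where
      zeros : ∀ b → b ≢ (proj₁ c , proj₂ a) → M₁ a b * M₂ b c ≡ 0
      zeros b b≢ with M₁ a b ≟ 1 | M₂ b c ≟ 1
      ... | yes e | yes f = contradiction
            (cong₂ _,_ (proj₁ (from₂ b c f)) (sym (proj₁ (from₁ a b e)))) b≢
      ... | no ne | _     = cong (_* M₂ b c) (zero-or-one (M₁≤1 a b) ne)
      ... | yes _ | no ne = trans (cong (M₁ a b *_) (zero-or-one (M₂≤1 b c) ne)) (*-comm (M₁ a b) 0)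

    product₂₁ : ∀ a c → _·_ fin M₂ M₁ a c ≡
                M₂ a (proj₁ a , proj₂ c) * M₁ (proj₁ a , proj₂ c) c
    product₂₁ a c = product M₂ M₁ a c _ zeros
      where
      zeros : ∀ b → b ≢ (proj₁ a , proj₂ c) → M₂ a b * M₁ b c ≡ 0
      zeros b b≢ with M₂ a b ≟ 1 | M₁ b c ≟ 1
      ... | yes e | yes f = contradiction
            (cong₂ _,_ (sym (proj₁ (from₂ a b e))) (proj₁ (from₁ b c f))) b≢
      ... | no ne | _     = cong (_* M₁ b c) (zero-or-one (M₂≤1 a b) ne)
      ... | yes _ | no ne = trans (cong (M₂ a b *_) (zero-or-one (M₁≤1 b c) ne)) (*-comm (M₂ a b) 0)

    commute : ∀ a c → _·_ fin M₁ M₂ a c ≡ _·_ fin M₂ M₁ a c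
    commute a@(i , j) c@(k , l) = trans (product₁₂ a c) (trans
      (trans (cong₂ _*_ first second) (*-comm (M₁ (i , l) c) (M₂ a (i , l))))
      (sym (product₂₁ a c)))
      where
      first : M₁ a (k , j) ≡ M₁ (i , l) c
      first = equal (M₁≤1 _ _) (M₁≤1 _ _)
        (λ e → to₁ _ _ (refl , proj₂ (from₁ a (k , j) e)))
        (λ e → to₁ _ _ (refl , proj₂ (from₁ (i , l) c e)))
      second : M₂ (k , j) c ≡ M₂ a (i , l)
      second = equal (M₂≤1 _ _) (M₂≤1 _ _)
        (λ e → to₂ _ _ (refl , proj₂ (from₂ (k , j) c e)))
        (λ e → to₂ _ _ (refl , proj₂ (from₂ a (i , l) e)))

    M₁M₂≤1 : ∀ a c → _·_ fin M₁ M₂ a c ≤ 1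
    M₁M₂≤1 a c = ≤-trans (≤-reflexive (product₁₂ a c)) (*-mono-≤ (M₁≤1 _ _) (M₂≤1 _ _))

    next₁ : 2 ≤ α → ∀ a → ∃[ b ] M₁ a b ≡ 1
    next₁ 2≤α (i , j) = let k , i≢k = other 2≤α i in (k , j) , to₁ _ _ (refl , i≢k)
      where
      other : ∀ {n} → 2 ≤ n → (i : Fin n) → ∃[ k ] i ≢ k
      other (s≤s (s≤s _)) 0F          = 1F , λ ()
      other (s≤s (s≤s _)) (Fin.suc i) = 0F , λ ()

    next₂ : 2 ≤ β → ∀ a → ∃[ b ] M₂ a b ≡ 1
    next₂ 2≤β (i , j) = let l , j≢l = other 2≤β j in (i , l) , to₂ _ _ (refl , j≢l)
      where
      other : ∀ {n} → 2 ≤ n → (i : Fin n) → ∃[ k ] i ≢ k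
      other (s≤s (s≤s _)) 0F          = 1F , λ ()
      other (s≤s (s≤s _)) (Fin.suc i) = 0F , λ ()

  -- letter i r b stands for u_i^{r+1} (or v_i^{r+1}), barred when b is true.
  record Letter (n : ℕ) : Set where
    constructor letter
    field
      subscript   : Fin n
      superscript : Fin 2
      barred      : Bool

  bar : ∀ {n} → Letter n → Letter n
  bar (letter i r b) = letter i r (not b)

  infix 4 _≟ˡ_
  _≟ˡ_ : ∀ {n} → DecidableEquality (Letter n)
  letter i r b ≟ˡ letter i′ r′ b′ = map′
    (λ { (refl , refl , refl) → refl }) (λ { refl → refl , refl , refl })
    ((i Fin.≟ i′) ×-dec ((r Fin.≟ r′) ×-dec (b ≟ᵇ b′)))

  module TileSystem (α β : ℕ) where

    Tile : Set
    Tile = Letter α × Letter β × Letter α × Letter β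

    adjacent₁? : ((x₁ , y₁ , x₂ , y₂) (x₃ , y₃ , x₄ , y₄) : Tile) → Dec (y₁ ≡ bar y₄ × x₁ ≢ bar x₃)
    adjacent₁? (x₁ , y₁ , x₂ , y₂) (x₃ , y₃ , x₄ , y₄) = (y₁ ≟ˡ bar y₄) ×-dec ¬? (x₁ ≟ˡ bar x₃)

    adjacent₂? : ((x₁ , y₁ , x₂ , y₂) (x₃ , y₃ , x₄ , y₄) : Tile) → Dec (x₂ ≡ bar x₃ × y₁ ≢ bar y₃)
    adjacent₂? (x₁ , y₁ , x₂ , y₂) (x₃ , y₃ , x₄ , y₄) = (x₂ ≟ˡ bar x₃) ×-dec ¬? (y₁ ≟ˡ bar y₃)

    M₁ M₂ : Tile → Tile → ℕ
    M₁ A B = 𝟙 (adjacent₁? A B)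
    M₂ A B = 𝟙 (adjacent₂? A B)

    representative : Index α β → Fin 4 → Tile
    representative (i , j) = λ where
        0F → u 0F , v 0F , u 1F , v 1F
        1F → ū 0F , v̄ 1F , ū 1F , v̄ 0F
        2F → u 1F , v 1F , u 0F , v 0F
        3F → ū 1F , v̄ 0F , ū 0F , v̄ 1F
      where
      u ū : Fin 2 → Letter α
      u r = letter i r false
      ū r = letter i r true
      v v̄ : Fin 2 → Letter β
      v r = letter j r false
      v̄ r = letter j r true

    someRepresentatives? : (M : Tile → Tile → ℕ) (A B : Index α β) →
      Dec (∃[ a ] ∃[ b ] M (representative A a) (representative B b) ≡ 1)
    someRepresentatives? M A B =
      Fin.any? λ a → Fin.any? λ b → M (representative A a) (representative B b) ≟ 1

    M′₁ M′₂ : Matrix (Index α β)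
    M′₁ A B = 𝟙 (someRepresentatives? M₁ A B)
    M′₂ A B = 𝟙 (someRepresentatives? M₂ A B)

    subscript-≡ : ∀ {n} {x y : Letter n} → x ≡ bar y → Letter.subscript x ≡ Letter.subscript y
    subscript-≡ refl = refl

    rep-y₁ : ∀ A a → Letter.subscript (proj₁ (proj₂ (representative A a))) ≡ proj₂ A
    rep-y₁ A 0F = refl
    rep-y₁ A 1F = refl
    rep-y₁ A 2F = refl
    rep-y₁ A 3F = refl

    rep-y₂ : ∀ A a → Letter.subscript (proj₂ (proj₂ (proj₂ (representative A a)))) ≡ proj₂ A
    rep-y₂ A 0F = refl
    rep-y₂ A 1F = refl
    rep-y₂ A 2F = refl
    rep-y₂ A 3F = refl

    rep-x₁ : ∀ A a → Letter.subscript (proj₁ (representative A a)) ≡ proj₁ A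
    rep-x₁ A 0F = refl
    rep-x₁ A 1F = refl
    rep-x₁ A 2F = refl
    rep-x₁ A 3F = refl

    rep-x₂ : ∀ A a → Letter.subscript (proj₁ (proj₂ (proj₂ (representative A a)))) ≡ proj₁ A
    rep-x₂ A 0F = refl
    rep-x₂ A 1F = refl
    rep-x₂ A 2F = refl
    rep-x₂ A 3F = refl

    same₁ : ∀ A a b → proj₁ (proj₂ (representative A a)) ≡ bar (proj₂ (proj₂ (proj₂ (representative A b)))) →
            proj₁ (representative A a) ≡ bar (proj₁ (representative A b))
    same₁ A 0F 1F _ = refl
    same₁ A 1F 0F _ = refl
    same₁ A 2F 3F _ = refl
    same₁ A 3F 2F _ = refl
    same₁ A 0F 0F ()
    same₁ A 0F 2F ()
    same₁ A 0F 3F ()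
    same₁ A 1F 1F ()
    same₁ A 1F 2F ()
    same₁ A 1F 3F ()
    same₁ A 2F 0F ()
    same₁ A 2F 1F ()
    same₁ A 2F 2F ()
    same₁ A 3F 0F ()
    same₁ A 3F 1F ()
    same₁ A 3F 3F ()

    same₂ : ∀ A a b → proj₁ (proj₂ (proj₂ (representative A a))) ≡ bar (proj₁ (representative A b)) →
            proj₁ (proj₂ (representative A a)) ≡ bar (proj₁ (proj₂ (representative A b)))
    same₂ A 0F 3F _ = refl
    same₂ A 1F 2F _ = refl
    same₂ A 2F 1F _ = refl
    same₂ A 3F 0F _ = refl
    same₂ A 0F 0F ()
    same₂ A 0F 1F ()
    same₂ A 0F 2F ()
    same₂ A 1F 0F ()
    same₂ A 1F 1F ()
    same₂ A 1F 3F ()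
    same₂ A 2F 0F ()
    same₂ A 2F 2F ()
    same₂ A 2F 3F ()
    same₂ A 3F 1F ()
    same₂ A 3F 2F ()
    same₂ A 3F 3F ()

    from₁ : ∀ A B → M′₁ A B ≡ 1 → SameColumn A B
    from₁ A B e with 𝟙-sound (someRepresentatives? M₁ A B) e
    ... | a , b , m with 𝟙-sound (adjacent₁? (representative A a) (representative B b)) m
    ...   | y≡ , x≢ = j≡l , λ i≡k → x≢ (clash A B a b i≡k j≡l y≡)
      where
      j≡l = trans (sym (rep-y₁ A a)) (trans (subscript-≡ y≡) (rep-y₂ B b))
      clash : ∀ A B a b → proj₁ A ≡ proj₁ B → proj₂ A ≡ proj₂ B →
        proj₁ (proj₂ (representative A a)) ≡ bar (proj₂ (proj₂ (proj₂ (representative B b)))) →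
        proj₁ (representative A a) ≡ bar (proj₁ (representative B b))
      clash A .A a b refl refl = same₁ A a b

    from₂ : ∀ A B → M′₂ A B ≡ 1 → SameRow A B
    from₂ A B e with 𝟙-sound (someRepresentatives? M₂ A B) e
    ... | a , b , m with 𝟙-sound (adjacent₂? (representative A a) (representative B b)) m
    ...   | x≡ , y≢ = i≡k , λ j≡l → y≢ (clash A B a b i≡k j≡l x≡)
      where
      i≡k = trans (sym (rep-x₂ A a)) (trans (subscript-≡ x≡) (rep-x₁ B b))
      clash : ∀ A B a b → proj₁ A ≡ proj₁ B → proj₂ A ≡ proj₂ B →
        proj₁ (proj₂ (proj₂ (representative A a))) ≡ bar (proj₁ (representative B b)) →
        proj₁ (proj₂ (representative A a)) ≡ bar (proj₁ (proj₂ (representative B b)))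
      clash A .A a b refl refl = same₂ A a b

    to₁ : ∀ A B → SameColumn A B → M′₁ A B ≡ 1
    to₁ A@(i , j) B@(k , .j) (refl , i≢k) = 𝟙-yes (someRepresentatives? M₁ A B)
      (0F , 1F , 𝟙-yes (adjacent₁? (representative A 0F) (representative B 1F))
        (refl , λ e → i≢k (subscript-≡ e)))

    to₂ : ∀ A B → SameRow A B → M′₂ A B ≡ 1
    to₂ A@(i , j) B@(.i , l) (refl , j≢l) = 𝟙-yes (someRepresentatives? M₂ A B)
      (0F , 3F , 𝟙-yes (adjacent₂? (representative A 0F) (representative B 3F))
        (refl , λ e → j≢l (subscript-≡ e)))

    M′₁≤1 : ∀ A B → M′₁ A B ≤ 1
    M′₁≤1 A B = 𝟙≤1 (someRepresentatives? M₁ A B)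

    M′₂≤1 : ∀ A B → M′₂ A B ≤ 1
    M′₂≤1 A B = 𝟙≤1 (someRepresentatives? M₂ A B)

    module Rules = Moves α β M′₁ M′₂ M′₁≤1 M′₂≤1 to₁ from₁ to₂ from₂

    system : GridSystem
    system = record
      { S = Index α β ; size = α * β ; finite = index-finite α β ; N₁ = M′₁ ; N₂ = M′₂
      ; N₁≤1 = M′₁≤1 ; N₂≤1 = M′₂≤1
      ; N₁N₂≤1 = Rules.M₁M₂≤1 ; commute = Rules.commute }

    module _ (2≤α : 2 ≤ α) (2≤β : 2 ≤ β) where
      noSources : HigherRankGraph.NoSources (GridGraph.graph system)
      noSources = GridGraph.noSources system (Rules.next₁ 2≤α) (Rules.next₂ 2≤β)

  module PolygonSystem (α β t : ℕ) where

    -- (i , r) stands for the label u_i^{r+1}, resp. v_i^{r+1}.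
    Label : ℕ → Set
    Label n = Fin n × Fin t

    -- The boundary word of A_ij read from its first basepoint.
    boundary : Index α β → List (Label α × Label β)
    boundary (i , j) = List.tabulate (λ r → (i , r) , (j , r))

    U-labels : Index α β → List (Label α)
    U-labels A = List.map proj₁ (boundary A)

    V-labels : Index α β → List (Label β)
    V-labels A = List.map proj₂ (boundary A)

    -- Equality of label sets, which does not depend on basepoint or orientation.
    SameLabels : ∀ {n} → List (Label n) → List (Label n) → Set
    SameLabels xs ys = All (_∈ ys) xs × All (_∈ xs) ys

    sameLabels? : ∀ {n} (xs ys : List (Label n)) → Dec (SameLabels xs ys)
    sameLabels? xs ys = All.all? (_∈? ys) xs ×-dec All.all? (_∈? xs) ys
      where open DecMembership (≡-dec Fin._≟_ Fin._≟_) using (_∈?_)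

    V-adjacent? : ∀ A B → Dec (SameLabels (V-labels A) (V-labels B) × ¬ SameLabels (U-labels A) (U-labels B))
    V-adjacent? A B = sameLabels? (V-labels A) (V-labels B) ×-dec ¬? (sameLabels? (U-labels A) (U-labels B))

    U-adjacent? : ∀ A B → Dec (SameLabels (U-labels A) (U-labels B) × ¬ SameLabels (V-labels A) (V-labels B))
    U-adjacent? A B = sameLabels? (U-labels A) (U-labels B) ×-dec ¬? (sameLabels? (V-labels A) (V-labels B))

    M′ᵁ M′ⱽ : Matrix (Index α β)
    M′ᵁ A B = 𝟙 (U-adjacent? A B)
    M′ⱽ A B = 𝟙 (V-adjacent? A B)

    module _ (1≤t : 1 ≤ t) where
      point : ∀ {t} → 1 ≤ t → Fin t
      point (s≤s _) = 0F

      U-same : ∀ A B → SameLabels (U-labels A) (U-labels B) → proj₁ A ≡ proj₁ B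
      U-same A B (sub , _) with ∈-map⁻ proj₁ (All.lookup sub (∈-map⁺ proj₁ (∈-tabulate⁺ (point 1≤t))))
      ... | _ , m , e with ∈-tabulate⁻ m
      ...   | r , refl = cong proj₁ e

      V-same : ∀ A B → SameLabels (V-labels A) (V-labels B) → proj₂ A ≡ proj₂ B
      V-same A B (sub , _) with ∈-map⁻ proj₂ (All.lookup sub (∈-map⁺ proj₂ (∈-tabulate⁺ (point 1≤t))))
      ... | _ , m , e with ∈-tabulate⁻ m
      ...   | r , refl = cong proj₁ e

      same : ∀ {n} {xs ys : List (Label n)} → xs ≡ ys → SameLabels xs ys
      same refl = All.tabulate (λ x → x) , All.tabulate (λ x → x)

      U-labels-≡ : ∀ A B → proj₁ A ≡ proj₁ B → SameLabels (U-labels A) (U-labels B)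
      U-labels-≡ (i , j) (.i , l) refl = same (trans (map-tabulate _ proj₁) (sym (map-tabulate _ proj₁)))

      V-labels-≡ : ∀ A B → proj₂ A ≡ proj₂ B → SameLabels (V-labels A) (V-labels B)
      V-labels-≡ (i , j) (k , .j) refl = same (trans (map-tabulate _ proj₂) (sym (map-tabulate _ proj₂)))

      to₁ : ∀ A B → SameColumn A B → M′ⱽ A B ≡ 1
      to₁ A B (e , ne) = 𝟙-yes (V-adjacent? A B) (V-labels-≡ A B e , λ s → ne (U-same A B s))

      from₁ : ∀ A B → M′ⱽ A B ≡ 1 → SameColumn A B
      from₁ A B e with 𝟙-sound (V-adjacent? A B) e
      ... | v , u = V-same A B v , λ i≡k → u (U-labels-≡ A B i≡k)

      to₂ : ∀ A B → SameRow A B → M′ᵁ A B ≡ 1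
      to₂ A B (e , ne) = 𝟙-yes (U-adjacent? A B) (U-labels-≡ A B e , λ s → ne (V-same A B s))

      from₂ : ∀ A B → M′ᵁ A B ≡ 1 → SameRow A B
      from₂ A B e with 𝟙-sound (U-adjacent? A B) e
      ... | u , v = U-same A B u , λ j≡l → v (V-labels-≡ A B j≡l)

      module Rules = Moves α β M′ⱽ M′ᵁ (λ A B → 𝟙≤1 (V-adjacent? A B)) (λ A B → 𝟙≤1 (U-adjacent? A B))
                       to₁ from₁ to₂ from₂

      system : GridSystem
      system = record
        { S = Index α β ; size = α * β ; finite = index-finite α β ; N₁ = M′ᵁ ; N₂ = M′ⱽ
        ; N₁≤1 = λ A B → 𝟙≤1 (U-adjacent? A B) ; N₂≤1 = λ A B → 𝟙≤1 (V-adjacent? A B)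
        ; N₁N₂≤1 = λ a c → ≤-trans (≤-reflexive (sym (Rules.commute a c))) (Rules.M₁M₂≤1 a c)
        ; commute = λ a c → sym (Rules.commute a c) }

      noSources : 2 ≤ α → 2 ≤ β → HigherRankGraph.NoSources (GridGraph.graph system)
      noSources 2≤α 2≤β = GridGraph.noSources system (Rules.next₂ 2≤β) (Rules.next₁ 2≤α)

  record RowFiniteGraph (k : ℕ) : Set₁ where
    field
      graph     : HigherRankGraph k
      rowFinite : HigherRankGraph.RowFinite graph
      noSources : HigherRankGraph.NoSources graph

    open HigherRankGraph graph public

  Λ′ : ∀ α β → 2 ≤ α → 2 ≤ β → RowFiniteGraph 2
  Λ′ α β 2≤α 2≤β = record
    { graph     = GridGraph.graph (TileSystem.system α β)
    ; rowFinite = GridGraph.rowFinite (TileSystem.system α β)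
    ; noSources = TileSystem.noSources α β 2≤α 2≤β
    }

  Λ′[_] : ∀ t → 1 ≤ t → ∀ α β → 2 ≤ α → 2 ≤ β → RowFiniteGraph 2
  Λ′[ t ] 1≤t α β 2≤α 2≤β = record
    { graph     = GridGraph.graph (PolygonSystem.system α β t 1≤t)
    ; rowFinite = GridGraph.rowFinite (PolygonSystem.system α β t 1≤t)
    ; noSources = PolygonSystem.noSources α β t 1≤t 2≤α 2≤β
    }

module CStarAlgebras where

  open Reals
  open HigherRankGraphs using (RowFiniteGraph)
  open import Level using (Level; _⊔_; 0ℓ) renaming (suc to lsuc)
  open import Algebra.Bundles using (CommutativeRing; Ring; RawGroup; CommutativeMonoid; AbelianGroup)
  open import Algebra.Module.Structures using (IsLeftModule)
  open import Algebra.Morphism.Structures using (IsGroupIsomorphism; IsGroupHomomorphism; IsMonoidHomomorphism)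
  open import Algebra.Structures using (IsRingWithoutOne)
  import Algebra.Properties.AbelianGroup as AbelianGroupProperties
  import Algebra.Properties.Semiring.Sum as SemiringSum
  import Algebra.Solver.CommutativeMonoid as CommutativeMonoidSolver
  open import Data.Fin.Base as Fin using (Fin; zero; suc; splitAt; join; _↑ˡ_; _↑ʳ_)
  open import Data.Fin.Patterns using (0F; 1F)
  import Data.Fin.Properties as Fin
  open import Data.List.Base as List using (List)
  open import Data.Nat.Base as ℕ using (ℕ)
  open import Data.Product.Base using (Σ-syntax; _×_; _,_; ∃-syntax; proj₁; proj₂)
  open import Data.Rational.Base as ℚ using (ℚ; Positive)
  open import Data.Sum.Base using (_⊎_; inj₁; inj₂; swap; assocʳ; map₁; map₂)
  open import Data.Sum.Algebra using (⊎-comm; ⊎-assoc)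
  open import Data.Sum.Function.Propositional using (_⊎-↔_)
  open import Function.Properties.Inverse using (↔-refl; ↔-sym; ↔-trans)
  open import Function.Base using (_∘_)
  open import Function.Bundles using (_↔_; Inverse)
  open import Relation.Binary.Core using (Rel)
  open import Relation.Binary.PropositionalEquality as ≡ using (_≡_; subst)
  open import Relation.Nullary using (¬_; yes; no; contradiction)
  import Relation.Binary.Reasoning.Setoid as SetoidReasoning

  private
    variable
      c ℓ : Level

  ℂ-ring : Ring 0ℓ 0ℓ
  ℂ-ring = CommutativeRing.ring ℂ-commutativeRing

  -- Not necessarily unital.
  record CStarAlgebra (c ℓ : Level) : Set (lsuc (c ⊔ ℓ)) where
    infix  4 _≈_
    infixl 6 _+_ _-_
    infixl 7 _*_
    infixr 7 _•_
    infix  8 -_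
    infix  9 _⋆
    field
      Carrier : Set c
      _≈_     : Rel Carrier ℓ
      _+_ _*_ : Carrier → Carrier → Carrier
      -_ _⋆   : Carrier → Carrier
      0#      : Carrier
      _•_     : ℂ → Carrier → Carrier
      ‖_‖     : Carrier → ℝ

      isRingWithoutOne : IsRingWithoutOne _≈_ _+_ _*_ -_ 0#
      isLeftModule     : IsLeftModule ℂ-ring _≈_ _+_ 0# -_ _•_
      •-*-assocˡ       : ∀ z a b → (z • a) * b ≈ z • (a * b)
      •-*-assocʳ       : ∀ z a b → a * (z • b) ≈ z • (a * b)

      ⋆-cong       : ∀ {a b} → a ≈ b → a ⋆ ≈ b ⋆
      ⋆-involutive : ∀ a → (a ⋆) ⋆ ≈ a
      ⋆-+          : ∀ a b → (a + b) ⋆ ≈ a ⋆ + b ⋆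
      ⋆-*          : ∀ a b → (a * b) ⋆ ≈ b ⋆ * a ⋆
      ⋆-•          : ∀ z a → (z • a) ⋆ ≈ conj z • a ⋆

    _-_ : Carrier → Carrier → Carrier
    a - b = a + - b

    field
      ‖‖-cong        : ∀ {a b} → a ≈ b → ‖ a ‖ ≃ ‖ b ‖
      ‖‖-nonNegative : ∀ a → 0ℝ ≤ʳ ‖ a ‖
      ‖‖-definite    : ∀ a → ‖ a ‖ ≃ 0ℝ → a ≈ 0#
      ‖‖-triangle    : ∀ a b → ‖ a + b ‖ ≤ʳ ‖ a ‖ +ʳ ‖ b ‖
      -- ‖za‖ = |z| ‖a‖, squared.
      ‖‖-homogeneous : ∀ z a → ‖ z • a ‖ *ʳ ‖ z • a ‖ ≃ ∣ z ∣² *ʳ (‖ a ‖ *ʳ ‖ a ‖)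
      ‖‖-*           : ∀ a b → ‖ a * b ‖ ≤ʳ ‖ a ‖ *ʳ ‖ b ‖
      C⋆-identity    : ∀ a → ‖ a ⋆ * a ‖ ≃ ‖ a ‖ *ʳ ‖ a ‖

      complete : (a : ℕ → Carrier) →
        (∀ ε → Positive ε → ∃[ N ] ∀ m n → N ℕ.≤ m → N ℕ.≤ n → ‖ a m - a n ‖ ≤ʳ fromℚ ε) →
        ∃[ l ] ∀ ε → Positive ε → ∃[ N ] ∀ n → N ℕ.≤ n → ‖ a n - l ‖ ≤ʳ fromℚ ε

    open IsRingWithoutOne isRingWithoutOne public
      hiding (_-_)
    open IsLeftModule isLeftModule public
      using (*ₗ-cong; *ₗ-zeroˡ; *ₗ-distribʳ; *ₗ-identityˡ; *ₗ-assoc; *ₗ-zeroʳ; *ₗ-distribˡ)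

    sumᴸ : List Carrier → Carrier
    sumᴸ = List.foldr _+_ 0#

  -- Classically every ⋆-homomorphism of C⋆-algebras is contractive; this is made
  -- part of the definition because the logic here is constructive.
  record StarHomomorphism (A B : CStarAlgebra c ℓ) : Set (c ⊔ ℓ) where
    private
      module A = CStarAlgebra A
      module B = CStarAlgebra B
    field
      ⟦_⟧         : A.Carrier → B.Carrier
      ⟦⟧-cong     : ∀ {a b} → a A.≈ b → ⟦ a ⟧ B.≈ ⟦ b ⟧
      +-homo      : ∀ a b → ⟦ a A.+ b ⟧ B.≈ ⟦ a ⟧ B.+ ⟦ b ⟧
      *-homo      : ∀ a b → ⟦ a A.* b ⟧ B.≈ ⟦ a ⟧ B.* ⟦ b ⟧
      •-homo      : ∀ z a → ⟦ z A.• a ⟧ B.≈ z B.• ⟦ a ⟧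
      ⋆-homo      : ∀ a → ⟦ a A.⋆ ⟧ B.≈ ⟦ a ⟧ B.⋆
      contractive : ∀ a → B.‖ ⟦ a ⟧ ‖ ≤ʳ A.‖ a ‖

  module _ {k : ℕ} (Λ : RowFiniteGraph k) where
    private
      module Λ = RowFiniteGraph Λ

    record CuntzKriegerFamily (A : CStarAlgebra c ℓ) : Set (c ⊔ ℓ) where
      open CStarAlgebra A
      field
        S                : Λ.Mor → Carrier
        S-cong           : ∀ {λ′ μ} → λ′ Λ.≈ μ → S λ′ ≈ S μ
        partial-isometry : ∀ μ → S μ * S μ ⋆ * S μ ≈ S μ
        vertex-idem      : ∀ v → Λ.Vertex v → S v * S v ≈ S v
        vertex-⋆         : ∀ v → Λ.Vertex v → S v ⋆ ≈ S v
        orthogonal       : ∀ u v → Λ.Vertex u → Λ.Vertex v → ¬ (u Λ.≈ v) → S u * S v ≈ 0#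
        multiplicative   : ∀ μ ν e → S (Λ.comp μ ν e) ≈ S μ * S ν
        source           : ∀ μ → S μ ⋆ * S μ ≈ S (Λ.s μ)
        -- By row-finiteness Λⁿ(v) has an enumeration; the sum does not depend on it.
        vertex-sum       : ∀ v n μs → Λ.Vertex v → Λ.Enumerates μs n v →
                           S v ≈ sumᴸ (List.map (λ μ → S μ * S μ ⋆) μs)

    -- A is C⋆(Λ), by its universal property.
    record IsGraphAlgebra (A : CStarAlgebra c ℓ) : Set (lsuc (c ⊔ ℓ)) where
      open StarHomomorphism
      open CuntzKriegerFamily
      field
        family    : CuntzKriegerFamily A
        universal : (B : CStarAlgebra c ℓ) (T : CuntzKriegerFamily B) →
          let open CStarAlgebra B in
          Σ[ φ ∈ StarHomomorphism A B ]
            (∀ μ → ⟦ φ ⟧ (S family μ) ≈ S T μ) ×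
            ((ψ : StarHomomorphism A B) → (∀ μ → ⟦ ψ ⟧ (S family μ) ≈ S T μ) → ∀ a → ⟦ ψ ⟧ a ≈ ⟦ φ ⟧ a)

  record StarRing (c ℓ : Level) : Set (lsuc (c ⊔ ℓ)) where
    infix 9 _⋆
    field
      ring : Ring c ℓ
    open Ring ring public
    field
      _⋆           : Carrier → Carrier
      ⋆-cong       : ∀ {a b} → a ≈ b → a ⋆ ≈ b ⋆
      ⋆-involutive : ∀ a → (a ⋆) ⋆ ≈ a
      ⋆-+          : ∀ a b → (a + b) ⋆ ≈ a ⋆ + b ⋆
      ⋆-*          : ∀ a b → (a * b) ⋆ ≈ b ⋆ * a ⋆

    ⋆-1 : 1# ⋆ ≈ 1#
    ⋆-1 = begin
      1# ⋆               ≈⟨ *-identityʳ (1# ⋆) ⟨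
      1# ⋆ * 1#          ≈⟨ *-congˡ (⋆-involutive 1#) ⟨
      1# ⋆ * (1# ⋆) ⋆    ≈⟨ ⋆-* (1# ⋆) 1# ⟨
      (1# ⋆ * 1#) ⋆      ≈⟨ ⋆-cong (*-identityʳ (1# ⋆)) ⟩
      (1# ⋆) ⋆           ≈⟨ ⋆-involutive 1# ⟩
      1#                 ∎
      where open SetoidReasoning setoid

    ⋆-0 : 0# ⋆ ≈ 0#
    ⋆-0 = identityʳ-unique (0# ⋆) (0# ⋆) (trans (sym (⋆-+ 0# 0#)) (⋆-cong (+-identityʳ 0#)))
      where open AbelianGroupProperties +-abelianGroup using (identityʳ-unique)

  record StarRingHomomorphism {c₁ ℓ₁ c₂ ℓ₂} (R : StarRing c₁ ℓ₁) (S : StarRing c₂ ℓ₂) :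
                              Set (c₁ ⊔ ℓ₁ ⊔ c₂ ⊔ ℓ₂) where
    private
      module R = StarRing R
      module S = StarRing S
    field
      ⟦_⟧     : R.Carrier → S.Carrier
      ⟦⟧-cong : ∀ {a b} → a R.≈ b → ⟦ a ⟧ S.≈ ⟦ b ⟧
      +-homo  : ∀ a b → ⟦ a R.+ b ⟧ S.≈ ⟦ a ⟧ S.+ ⟦ b ⟧
      *-homo  : ∀ a b → ⟦ a R.* b ⟧ S.≈ ⟦ a ⟧ S.* ⟦ b ⟧
      ⋆-homo  : ∀ a → ⟦ a R.⋆ ⟧ S.≈ ⟦ a ⟧ S.⋆
      1-homo  : ⟦ R.1# ⟧ S.≈ S.1#

    0-homo : ⟦ R.0# ⟧ S.≈ S.0#
    0-homo = identityʳ-unique ⟦ R.0# ⟧ ⟦ R.0# ⟧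
      (S.trans (S.sym (+-homo R.0# R.0#)) (⟦⟧-cong (R.+-identityʳ R.0#)))
      where open AbelianGroupProperties S.+-abelianGroup using (identityʳ-unique)

  ℂ-starRing : StarRing 0ℓ 0ℓ
  ℂ-starRing = record
    { ring = ℂ-ring ; _⋆ = conj ; ⋆-cong = conj-cong ; ⋆-involutive = conj-involutive
    ; ⋆-+ = conj-+ ; ⋆-* = conj-* }

  -- The unitization A ⊕ ℂ; multiplication is (a + z)(b + w) = ab + wa + zb + zw.
  module Unitization (A : CStarAlgebra c ℓ) where
    open CStarAlgebra A
    private
      module C = CommutativeRing ℂ-commutativeRing

    Carrier⁺ : Set c
    Carrier⁺ = Carrier × ℂ

    infix 4 _≈⁺_
    _≈⁺_ : Rel Carrier⁺ ℓ
    (a , z) ≈⁺ (b , w) = a ≈ b × z ≈ᶜ w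

    _+⁺_ _*⁺_ : Carrier⁺ → Carrier⁺ → Carrier⁺
    (a , z) +⁺ (b , w) = a + b , z +ᶜ w
    (a , z) *⁺ (b , w) = a * b + (w • a + z • b) , z *ᶜ w

    +-commutativeMonoid : CommutativeMonoid c ℓ
    +-commutativeMonoid = record { isCommutativeMonoid = +-isCommutativeMonoid }

    open CommutativeMonoidSolver +-commutativeMonoid using (solve; _⊕_; _⊜_)

    •-congʳ : ∀ z {a b} → a ≈ b → z • a ≈ z • b
    •-congʳ z = *ₗ-cong C.refl

    assoc⁺ : ∀ x y u → (x *⁺ y) *⁺ u ≈⁺ x *⁺ (y *⁺ u)
    assoc⁺ (a , x) (b , y) (d , u) = (begin
      (a * b + (y • a + x • b)) * d + (u • (a * b + (y • a + x • b)) + (x *ᶜ y) • d)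
        ≈⟨ +-cong
             (trans (distribʳ d (a * b) (y • a + x • b)) (+-congˡ (trans (distribʳ d (y • a) (x • b))
               (+-cong (•-*-assocˡ y a d) (•-*-assocˡ x b d)))))
             (+-congʳ (trans (*ₗ-distribˡ u (a * b) (y • a + x • b)) (+-congˡ (trans (*ₗ-distribˡ u (y • a) (x • b))
               (+-cong (trans (sym (*ₗ-assoc u y a)) (*ₗ-cong (C.*-comm u y) refl))
                       (trans (sym (*ₗ-assoc u x b)) (trans (*ₗ-cong (C.*-comm u x) refl) (*ₗ-assoc x u b)))))))) ⟩
      (a * b * d + (y • (a * d) + x • (b * d))) +
        ((u • (a * b) + ((y *ᶜ u) • a + x • (u • b))) + (x *ᶜ y) • d)
        ≈⟨ solve 7 (λ p q r s t v w →
             (p ⊕ (q ⊕ r)) ⊕ ((s ⊕ (t ⊕ v)) ⊕ w) ⊜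
             (p ⊕ (s ⊕ q)) ⊕ (t ⊕ (r ⊕ (v ⊕ w)))) refl
             (a * b * d) (y • (a * d)) (x • (b * d)) (u • (a * b)) ((y *ᶜ u) • a) (x • (u • b)) ((x *ᶜ y) • d) ⟩
      (a * b * d + (u • (a * b) + y • (a * d))) +
        ((y *ᶜ u) • a + (x • (b * d) + (x • (u • b) + (x *ᶜ y) • d)))
        ≈⟨ +-cong
             (+-cong (*-assoc a b d) (+-cong (sym (•-*-assocʳ u a b)) (sym (•-*-assocʳ y a d))))
             (+-congˡ (trans (+-congˡ (trans (+-congˡ (*ₗ-assoc x y d)) (sym (*ₗ-distribˡ x (u • b) (y • d)))))
               (sym (*ₗ-distribˡ x (b * d) (u • b + y • d))))) ⟩
      (a * (b * d) + (a * (u • b) + a * (y • d))) +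
        ((y *ᶜ u) • a + x • (b * d + (u • b + y • d)))
        ≈⟨ +-congʳ (trans (+-congˡ (sym (distribˡ a (u • b) (y • d))))
             (sym (distribˡ a (b * d) (u • b + y • d)))) ⟩
      a * (b * d + (u • b + y • d)) + ((y *ᶜ u) • a + x • (b * d + (u • b + y • d))) ∎)
      , C.*-assoc x y u
      where open SetoidReasoning setoid

    distribˡ⁺ : ∀ x y u → x *⁺ (y +⁺ u) ≈⁺ (x *⁺ y) +⁺ (x *⁺ u)
    distribˡ⁺ (a , x) (b , y) (d , u) = trans
      (+-cong (distribˡ a b d) (+-cong (*ₗ-distribʳ a y u) (*ₗ-distribˡ x b d)))
      (solve 6 (λ p q r s t v → (p ⊕ q) ⊕ ((r ⊕ s) ⊕ (t ⊕ v)) ⊜ (p ⊕ (r ⊕ t)) ⊕ (q ⊕ (s ⊕ v))) refl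
        (a * b) (a * d) (y • a) (u • a) (x • b) (x • d))
      , C.distribˡ x y u

    distribʳ⁺ : ∀ x y u → (y +⁺ u) *⁺ x ≈⁺ (y *⁺ x) +⁺ (u *⁺ x)
    distribʳ⁺ (a , x) (b , y) (d , u) = trans
      (+-cong (distribʳ a b d) (+-cong (*ₗ-distribˡ x b d) (*ₗ-distribʳ a y u)))
      (solve 6 (λ p q r s t v → (p ⊕ q) ⊕ ((r ⊕ s) ⊕ (t ⊕ v)) ⊜ (p ⊕ (r ⊕ t)) ⊕ (q ⊕ (s ⊕ v))) refl
        (b * a) (d * a) (x • b) (x • d) (y • a) (u • a))
      , C.distribʳ x y u

    identityˡ⁺ : ∀ x → (0# , 1ᶜ) *⁺ x ≈⁺ x
    identityˡ⁺ (a , x) = trans (+-cong (zeroˡ a) (trans (+-cong (*ₗ-zeroʳ x) (*ₗ-identityˡ a)) (+-identityˡ a))) (+-identityˡ a)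
      , C.*-identityˡ x

    identityʳ⁺ : ∀ x → x *⁺ (0# , 1ᶜ) ≈⁺ x
    identityʳ⁺ (a , x) = trans (+-cong (zeroʳ a) (trans (+-cong (*ₗ-identityˡ a) (*ₗ-zeroʳ x)) (+-identityʳ a))) (+-identityˡ a)
      , C.*-identityʳ x

    unitization : StarRing c ℓ
    unitization = record
      { ring = record
        { Carrier = Carrier⁺ ; _≈_ = _≈⁺_ ; _+_ = _+⁺_ ; _*_ = _*⁺_
        ; -_ = λ (a , z) → - a , -ᶜ z ; 0# = 0# , 0ᶜ ; 1# = 0# , 1ᶜ
        ; isRing = record
          { +-isAbelianGroup = record
            { isGroup = record
              { isMonoid = record
                { isSemigroup = record
                  { isMagma = record
                    { isEquivalence = record
                      { refl  = refl , C.refl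
                      ; sym   = λ (e , f) → sym e , C.sym f
                      ; trans = λ (e , f) (g , h) → trans e g , C.trans f h }
                    ; ∙-cong = λ (e , f) (g , h) → +-cong e g , C.+-cong f h }
                  ; assoc = λ (a , x) (b , y) (d , u) → +-assoc a b d , C.+-assoc x y u }
                ; identity = (λ (a , x) → +-identityˡ a , C.+-identityˡ x)
                           , (λ (a , x) → +-identityʳ a , C.+-identityʳ x) }
              ; inverse = (λ (a , x) → -‿inverseˡ a , C.-‿inverseˡ x)
                        , (λ (a , x) → -‿inverseʳ a , C.-‿inverseʳ x)
              ; ⁻¹-cong = λ (e , f) → -‿cong e , C.-‿cong f }
            ; comm = λ (a , x) (b , y) → +-comm a b , C.+-comm x y }
          ; *-cong = λ (e , f) (g , h) →
              +-cong (*-cong e g) (+-cong (*ₗ-cong h e) (*ₗ-cong f g)) , C.*-cong f h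
          ; *-assoc = assoc⁺
          ; *-identity = identityˡ⁺ , identityʳ⁺
          ; distrib = distribˡ⁺ , distribʳ⁺ } }
      ; _⋆ = λ (a , z) → a ⋆ , conj z
      ; ⋆-cong = λ (e , f) → ⋆-cong e , conj-cong f
      ; ⋆-involutive = λ (a , z) → ⋆-involutive a , conj-involutive z
      ; ⋆-+ = λ (a , z) (b , w) → ⋆-+ a b , conj-+ z w
      ; ⋆-* = λ (a , z) (b , w) → trans (⋆-+ (a * b) (w • a + z • b)) (+-cong (⋆-* a b)
          (trans (⋆-+ (w • a) (z • b)) (trans (+-cong (⋆-• w a) (⋆-• z b)) (+-comm _ _)))) , conj-* z w
      }

    scalar-part : StarRingHomomorphism unitization ℂ-starRing
    scalar-part = record
      { ⟦_⟧ = proj₂ ; ⟦⟧-cong = proj₂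
      ; +-homo = λ _ _ → C.refl ; *-homo = λ _ _ → C.refl ; ⋆-homo = λ _ → C.refl ; 1-homo = C.refl }

    -- x and y are ε-close in the norm max(‖a‖, |z|), which is equivalent to the
    -- C⋆-norm of the unitization.
    Close : ℚ → Carrier⁺ → Carrier⁺ → Set
    Close ε (a , z) (b , w) = ‖ a - b ‖ ≤ʳ fromℚ ε × ∣ z +ᶜ -ᶜ w ∣² ≤ʳ fromℚ (ε ℚ.* ε)

  module Matrices {c ℓ} (R : StarRing c ℓ) where
    open StarRing R hiding (zero)
    open SemiringSum semiring using (sum; sum-cong-≋; sum-replicate-zero; *-distribˡ-sum; *-distribʳ-sum; ∑-comm; sum-permute)

    Mat : ℕ → ℕ → Set c
    Mat m n = Fin m → Fin n → Carrier

    private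
      variable
        m n k l m′ n′ k′ : ℕ

    infix 4 _≈ᴹ_
    _≈ᴹ_ : Mat m n → Mat m n → Set ℓ
    a ≈ᴹ b = ∀ i j → a i j ≈ b i j

    infixl 7 _∙ᴹ_
    _∙ᴹ_ : Mat m n → Mat n k → Mat m k
    (a ∙ᴹ b) i k = sum (λ j → a i j * b j k)

    infix 9 _⋆ᴹ
    _⋆ᴹ : Mat m n → Mat n m
    (a ⋆ᴹ) i j = a j i ⋆

    1ᴹ : Mat n n
    1ᴹ i j with i Fin.≟ j
    ... | yes _ = 1#
    ... | no  _ = 0#

    diagonal : Mat m n → Mat m′ n′ → Fin m ⊎ Fin m′ → Fin n ⊎ Fin n′ → Carrier
    diagonal a b (inj₁ i) (inj₁ j) = a i j
    diagonal a b (inj₂ i) (inj₂ j) = b i j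
    diagonal a b _        _        = 0#

    infixr 6 _⊕_
    _⊕_ : Mat m n → Mat m′ n′ → Mat (m ℕ.+ m′) (n ℕ.+ n′)
    _⊕_ {m = m} {n = n} a b i j = diagonal a b (splitAt m i) (splitAt n j)

    ≈ᴹ-trans : ∀ {a b c : Mat m n} → a ≈ᴹ b → b ≈ᴹ c → a ≈ᴹ c
    ≈ᴹ-trans e f i j = trans (e i j) (f i j)

    ≈ᴹ-sym : ∀ {a b : Mat m n} → a ≈ᴹ b → b ≈ᴹ a
    ≈ᴹ-sym e i j = sym (e i j)

    sum-zero : ∀ {n} (f : Fin n → Carrier) → (∀ i → f i ≈ 0#) → sum f ≈ 0#
    sum-zero {n} f z = trans (sum-cong-≋ z) (sum-replicate-zero n)

    ∙ᴹ-cong : {a a′ : Mat m n} {b b′ : Mat n k} → a ≈ᴹ a′ → b ≈ᴹ b′ → a ∙ᴹ b ≈ᴹ a′ ∙ᴹ b′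
    ∙ᴹ-cong e f i k = sum-cong-≋ (λ j → *-cong (e i j) (f j k))

    ∙ᴹ-assoc : (a : Mat m n) (b : Mat n k) (d : Mat k l) → (a ∙ᴹ b) ∙ᴹ d ≈ᴹ a ∙ᴹ (b ∙ᴹ d)
    ∙ᴹ-assoc {n = n} {k = k} a b d i l = begin
      sum (λ q → sum (λ p → a i p * b p q) * d q l)
        ≈⟨ sum-cong-≋ (λ q → *-distribʳ-sum (d q l) (λ p → a i p * b p q)) ⟩
      sum (λ q → sum (λ p → a i p * b p q * d q l))
        ≈⟨ ∑-comm (λ q p → a i p * b p q * d q l) ⟩
      sum (λ p → sum (λ q → a i p * b p q * d q l))
        ≈⟨ sum-cong-≋ (λ p → trans (sum-cong-≋ (λ q → *-assoc (a i p) (b p q) (d q l)))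
             (sym (*-distribˡ-sum (a i p) (λ q → b p q * d q l)))) ⟩
      sum (λ p → a i p * sum (λ q → b p q * d q l)) ∎
      where open SetoidReasoning setoid

    ⋆-sum : ∀ {n} (f : Fin n → Carrier) → sum f ⋆ ≈ sum (λ i → f i ⋆)
    ⋆-sum {ℕ.zero}  f = ⋆-0
    ⋆-sum {ℕ.suc n} f = trans (⋆-+ _ _) (+-congˡ (⋆-sum (f ∘ suc)))

    ⋆ᴹ-cong : {a b : Mat m n} → a ≈ᴹ b → a ⋆ᴹ ≈ᴹ b ⋆ᴹ
    ⋆ᴹ-cong e i j = ⋆-cong (e j i)

    ⋆ᴹ-∙ᴹ : (a : Mat m n) (b : Mat n k) → (a ∙ᴹ b) ⋆ᴹ ≈ᴹ b ⋆ᴹ ∙ᴹ a ⋆ᴹ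
    ⋆ᴹ-∙ᴹ a b i j = trans (⋆-sum (λ p → a j p * b p i)) (sum-cong-≋ (λ p → ⋆-* (a j p) (b p i)))

    ⋆ᴹ-involutive : (a : Mat m n) → (a ⋆ᴹ) ⋆ᴹ ≈ᴹ a
    ⋆ᴹ-involutive a i j = ⋆-involutive (a i j)

    sum-splitAt : ∀ m {n} (f : Fin m ⊎ Fin n → Carrier) →
      sum {m ℕ.+ n} (f ∘ splitAt m) ≈ sum (f ∘ inj₁) + sum (f ∘ inj₂)
    sum-splitAt ℕ.zero    f = sym (+-identityˡ _)
    sum-splitAt (ℕ.suc m) f = trans (+-congˡ (trans (sum-cong-≋ (λ i → step (splitAt m i)))
        (sum-splitAt m g)))
      (sym (+-assoc _ _ _))
      where
      g : Fin m ⊎ Fin _ → Carrier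
      g (inj₁ i) = f (inj₁ (suc i))
      g (inj₂ i) = f (inj₂ i)
      step : ∀ x → f (map₁ suc x) ≈ g x
      step (inj₁ _) = refl
      step (inj₂ _) = refl

    diagonal-cong : {a a′ : Mat m n} {b b′ : Mat m′ n′} → a ≈ᴹ a′ → b ≈ᴹ b′ →
      ∀ x y → diagonal a b x y ≈ diagonal a′ b′ x y
    diagonal-cong e f (inj₁ i) (inj₁ j) = e i j
    diagonal-cong e f (inj₂ i) (inj₂ j) = f i j
    diagonal-cong e f (inj₁ i) (inj₂ j) = refl
    diagonal-cong e f (inj₂ i) (inj₁ j) = refl

    ⊕-cong : {a a′ : Mat m n} {b b′ : Mat m′ n′} → a ≈ᴹ a′ → b ≈ᴹ b′ → a ⊕ b ≈ᴹ a′ ⊕ b′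
    ⊕-cong {m = m} {n = n} e f i j = diagonal-cong e f (splitAt m i) (splitAt n j)

    ⊕-∙ᴹ : (a : Mat m n) (b : Mat m′ n′) (d : Mat n k) (e : Mat n′ k′) →
           (a ⊕ b) ∙ᴹ (d ⊕ e) ≈ᴹ (a ∙ᴹ d) ⊕ (b ∙ᴹ e)
    ⊕-∙ᴹ {m = m} {n = n} {n′ = n′} {k = k} a b d e i l =
      trans (sum-splitAt n (λ x → diagonal a b (splitAt m i) x * diagonal d e x (splitAt k l)))
            (blocks (splitAt m i) (splitAt k l))
      where
      blocks : ∀ x y →
        sum (λ p → diagonal a b x (inj₁ p) * diagonal d e (inj₁ p) y) +
        sum (λ p → diagonal a b x (inj₂ p) * diagonal d e (inj₂ p) y) ≈
        diagonal (a ∙ᴹ d) (b ∙ᴹ e) x y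
      blocks (inj₁ i) (inj₁ j) = trans (+-congˡ (sum-zero {n′} _ (λ p → zeroˡ _))) (+-identityʳ _)
      blocks (inj₂ i) (inj₂ j) = trans (+-congʳ (sum-zero {n} _ (λ p → zeroˡ _))) (+-identityˡ _)
      blocks (inj₁ i) (inj₂ j) = trans (+-cong (sum-zero {n} _ (λ p → zeroʳ _)) (sum-zero {n′} _ (λ p → zeroˡ _))) (+-identityʳ _)
      blocks (inj₂ i) (inj₁ j) = trans (+-cong (sum-zero {n} _ (λ p → zeroˡ _)) (sum-zero {n′} _ (λ p → zeroʳ _))) (+-identityʳ _)

    ⊕-⋆ᴹ : (a : Mat m n) (b : Mat m′ n′) → (a ⊕ b) ⋆ᴹ ≈ᴹ a ⋆ᴹ ⊕ b ⋆ᴹ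
    ⊕-⋆ᴹ {m = m} {n = n} a b i j = blocks (splitAt n i) (splitAt m j)
      where
      blocks : ∀ x y → diagonal a b y x ⋆ ≈ diagonal (a ⋆ᴹ) (b ⋆ᴹ) x y
      blocks (inj₁ i) (inj₁ j) = refl
      blocks (inj₂ i) (inj₂ j) = refl
      blocks (inj₁ i) (inj₂ j) = ⋆-0
      blocks (inj₂ i) (inj₁ j) = ⋆-0

    1ᴹ-diag : ∀ (i : Fin n) → 1ᴹ i i ≈ 1#
    1ᴹ-diag i with i Fin.≟ i
    ... | yes _ = refl
    ... | no ¬e = contradiction ≡.refl ¬e

    1ᴹ-off : ∀ (i j : Fin n) → ¬ i ≡ j → 1ᴹ i j ≈ 0#
    1ᴹ-off i j i≢j with i Fin.≟ j
    ... | yes e = contradiction e i≢j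
    ... | no _  = refl

    1ᴹ-cong-inj : (f : Fin m → Fin n) → (∀ {i j} → f i ≡ f j → i ≡ j) → ∀ i j → 1ᴹ (f i) (f j) ≈ 1ᴹ i j
    1ᴹ-cong-inj f inj i j with i Fin.≟ j
    ... | yes ≡.refl = 1ᴹ-diag (f i)
    ... | no i≢j     = 1ᴹ-off (f i) (f j) (i≢j ∘ inj)

    ∙ᴹ-identityʳ : (a : Mat m n) → a ∙ᴹ 1ᴹ ≈ᴹ a
    ∙ᴹ-identityʳ {n = ℕ.suc n} a i zero = trans
      (+-cong (trans (*-congˡ (1ᴹ-diag {ℕ.suc n} zero)) (*-identityʳ _))
        (sum-zero {n} _ (λ j → trans (*-congˡ (1ᴹ-off (suc j) zero λ ())) (zeroʳ _))))
      (+-identityʳ _)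
    ∙ᴹ-identityʳ {n = ℕ.suc n} a i (suc k) = trans
      (+-cong (trans (*-congˡ (1ᴹ-off {ℕ.suc n} zero (suc k) λ ())) (zeroʳ _))
        (trans (sum-cong-≋ (λ j → *-congˡ (1ᴹ-cong-inj suc Fin.suc-injective j k)))
          (∙ᴹ-identityʳ (λ i j → a i (suc j)) i k)))
      (+-identityˡ _)

    1ᴹ-⋆ : (1ᴹ {n}) ⋆ᴹ ≈ᴹ 1ᴹ
    1ᴹ-⋆ i j with i Fin.≟ j
    ... | yes ≡.refl = trans (⋆-cong (1ᴹ-diag i)) ⋆-1
    ... | no i≢j     = trans (⋆-cong (1ᴹ-off j i (i≢j ∘ ≡.sym))) ⋆-0

    1ᴹ⊕1ᴹ : ∀ m n → 1ᴹ {m} ⊕ 1ᴹ {n} ≈ᴹ 1ᴹ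
    1ᴹ⊕1ᴹ m n i j = trans (blocks (splitAt m i) (splitAt m j))
      (reflexive (≡.cong₂ 1ᴹ (Fin.join-splitAt m n i) (Fin.join-splitAt m n j)))
      where
      blocks : ∀ x y → diagonal 1ᴹ 1ᴹ x y ≈ 1ᴹ (join m n x) (join m n y)
      blocks (inj₁ i) (inj₁ j) = sym (1ᴹ-cong-inj (_↑ˡ n) (Fin.↑ˡ-injective n _ _) i j)
      blocks (inj₂ i) (inj₂ j) = sym (1ᴹ-cong-inj (m ↑ʳ_) (Fin.↑ʳ-injective m _ _) i j)
      blocks (inj₁ i) (inj₂ j) = sym (1ᴹ-off _ _ (λ e → clash (≡.trans (≡.sym (Fin.splitAt-↑ˡ m i n)) (≡.trans (≡.cong (splitAt m) e) (Fin.splitAt-↑ʳ m n j)))))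
        where
        clash : ∀ {i : Fin m} {j : Fin n} → ¬ (inj₁ i ≡ inj₂ j)
        clash ()
      blocks (inj₂ i) (inj₁ j) = sym (1ᴹ-off _ _ (λ e → clash (≡.trans (≡.sym (Fin.splitAt-↑ʳ m n i)) (≡.trans (≡.cong (splitAt m) e) (Fin.splitAt-↑ˡ m j n)))))
        where
        clash : ∀ {i : Fin n} {j : Fin m} → ¬ (inj₂ i ≡ inj₁ j)
        clash ()

    record Unitary (n : ℕ) : Set (c ⊔ ℓ) where
      field
        matrix    : Mat n n
        isometry  : matrix ⋆ᴹ ∙ᴹ matrix ≈ᴹ 1ᴹ
        coisometry : matrix ∙ᴹ matrix ⋆ᴹ ≈ᴹ 1ᴹ

    1ᵁ : ∀ n → Unitary n
    1ᵁ n = record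
      { matrix     = 1ᴹ
      ; isometry   = ≈ᴹ-trans (∙ᴹ-identityʳ (1ᴹ ⋆ᴹ)) 1ᴹ-⋆
      ; coisometry = ≈ᴹ-trans (∙ᴹ-cong (λ i j → refl) 1ᴹ-⋆) (∙ᴹ-identityʳ 1ᴹ)
      }

    _⁻¹ᵁ : Unitary n → Unitary n
    u ⁻¹ᵁ = record
      { matrix     = matrix ⋆ᴹ
      ; isometry   = ≈ᴹ-trans (∙ᴹ-cong (⋆ᴹ-involutive matrix) (λ i j → refl)) coisometry
      ; coisometry = ≈ᴹ-trans (∙ᴹ-cong {a = matrix ⋆ᴹ} (λ i j → refl) (⋆ᴹ-involutive matrix)) isometry
      }
      where open Unitary u

    infixr 6 _⊕ᵁ_
    _⊕ᵁ_ : Unitary m → Unitary n → Unitary (m ℕ.+ n)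
    _⊕ᵁ_ {m} {n} u v = record
      { matrix     = u.matrix ⊕ v.matrix
      ; isometry   = ≈ᴹ-trans (∙ᴹ-cong (⊕-⋆ᴹ u.matrix v.matrix) (λ i j → refl))
          (≈ᴹ-trans (⊕-∙ᴹ (u.matrix ⋆ᴹ) (v.matrix ⋆ᴹ) u.matrix v.matrix)
            (≈ᴹ-trans (⊕-cong u.isometry v.isometry) (1ᴹ⊕1ᴹ m n)))
      ; coisometry = ≈ᴹ-trans (∙ᴹ-cong {a = u.matrix ⊕ v.matrix} (λ i j → refl) (⊕-⋆ᴹ u.matrix v.matrix))
          (≈ᴹ-trans (⊕-∙ᴹ u.matrix v.matrix (u.matrix ⋆ᴹ) (v.matrix ⋆ᴹ))
            (≈ᴹ-trans (⊕-cong u.coisometry v.coisometry) (1ᴹ⊕1ᴹ m n)))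
      }
      where
      module u = Unitary u
      module v = Unitary v

    record Projection : Set (c ⊔ ℓ) where
      field
        {size}      : ℕ
        matrix      : Mat size size
        idempotent  : matrix ∙ᴹ matrix ≈ᴹ matrix
        selfAdjoint : matrix ⋆ᴹ ≈ᴹ matrix

    open Projection

    infixr 6 _⊕ᴾ_
    _⊕ᴾ_ : Projection → Projection → Projection
    p ⊕ᴾ q = record
      { matrix      = matrix p ⊕ matrix q
      ; idempotent  = ≈ᴹ-trans (⊕-∙ᴹ (matrix p) (matrix q) (matrix p) (matrix q))
                        (⊕-cong (idempotent p) (idempotent q))
      ; selfAdjoint = ≈ᴹ-trans (⊕-⋆ᴹ (matrix p) (matrix q)) (⊕-cong (selfAdjoint p) (selfAdjoint q))
      }

    0ᴾ : Projection
    0ᴾ = record { size = 0 ; matrix = λ () ; idempotent = λ () ; selfAdjoint = λ () }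

    -- Murray–von Neumann equivalence of projections of possibly different sizes.
    infix 4 _∼_
    record _∼_ (p q : Projection) : Set (c ⊔ ℓ) where
      field
        v     : Mat (size q) (size p)
        v⋆v≈p : v ⋆ᴹ ∙ᴹ v ≈ᴹ matrix p
        vv⋆≈q : v ∙ᴹ v ⋆ᴹ ≈ᴹ matrix q

    ∼-refl : ∀ {p} → p ∼ p
    ∼-refl {p} = record
      { v     = matrix p
      ; v⋆v≈p = ≈ᴹ-trans (∙ᴹ-cong (selfAdjoint p) (λ i j → refl)) (idempotent p)
      ; vv⋆≈q = ≈ᴹ-trans (∙ᴹ-cong {a = matrix p} (λ i j → refl) (selfAdjoint p)) (idempotent p)
      }

    ∼-sym : ∀ {p q} → p ∼ q → q ∼ p
    ∼-sym e = record
      { v     = v ⋆ᴹ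
      ; v⋆v≈p = ≈ᴹ-trans (∙ᴹ-cong (⋆ᴹ-involutive v) (λ i j → refl)) vv⋆≈q
      ; vv⋆≈q = ≈ᴹ-trans (∙ᴹ-cong {a = v ⋆ᴹ} (λ i j → refl) (⋆ᴹ-involutive v)) v⋆v≈p
      }
      where open _∼_ e

    -- (wv)⋆(wv) = v⋆(vv⋆)v = (v⋆v)(v⋆v) = p.
    product-projection : (w : Mat k n) (v : Mat n m) {p : Mat m m} →
      v ⋆ᴹ ∙ᴹ v ≈ᴹ p → p ∙ᴹ p ≈ᴹ p → w ⋆ᴹ ∙ᴹ w ≈ᴹ v ∙ᴹ v ⋆ᴹ →
      (w ∙ᴹ v) ⋆ᴹ ∙ᴹ (w ∙ᴹ v) ≈ᴹ p
    product-projection w v e f g =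
      ≈ᴹ-trans (∙ᴹ-cong (⋆ᴹ-∙ᴹ w v) (λ i j → refl))
      (≈ᴹ-trans (∙ᴹ-assoc (v ⋆ᴹ) (w ⋆ᴹ) (w ∙ᴹ v))
      (≈ᴹ-trans (∙ᴹ-cong {a = v ⋆ᴹ} (λ i j → refl)
        (≈ᴹ-trans (≈ᴹ-sym (∙ᴹ-assoc (w ⋆ᴹ) w v))
        (≈ᴹ-trans (∙ᴹ-cong g (λ i j → refl)) (∙ᴹ-assoc v (v ⋆ᴹ) v))))
      (≈ᴹ-trans (≈ᴹ-sym (∙ᴹ-assoc (v ⋆ᴹ) v (v ⋆ᴹ ∙ᴹ v)))
      (≈ᴹ-trans (∙ᴹ-cong e e) f))))

    product-projection′ : (w : Mat k n) (v : Mat n m) {r : Mat k k} →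
      w ∙ᴹ w ⋆ᴹ ≈ᴹ r → r ∙ᴹ r ≈ᴹ r → w ⋆ᴹ ∙ᴹ w ≈ᴹ v ∙ᴹ v ⋆ᴹ →
      (w ∙ᴹ v) ∙ᴹ (w ∙ᴹ v) ⋆ᴹ ≈ᴹ r
    product-projection′ w v e f g =
      ≈ᴹ-trans (∙ᴹ-cong {a = w ∙ᴹ v} (λ i j → refl) (⋆ᴹ-∙ᴹ w v))
      (≈ᴹ-trans (∙ᴹ-assoc w v (v ⋆ᴹ ∙ᴹ w ⋆ᴹ))
      (≈ᴹ-trans (∙ᴹ-cong {a = w} (λ i j → refl)
        (≈ᴹ-trans (≈ᴹ-sym (∙ᴹ-assoc v (v ⋆ᴹ) (w ⋆ᴹ)))
        (≈ᴹ-trans (∙ᴹ-cong (≈ᴹ-sym g) (λ i j → refl)) (∙ᴹ-assoc (w ⋆ᴹ) w (w ⋆ᴹ)))))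
      (≈ᴹ-trans (≈ᴹ-sym (∙ᴹ-assoc w (w ⋆ᴹ) (w ∙ᴹ w ⋆ᴹ)))
      (≈ᴹ-trans (∙ᴹ-cong e e) f))))

    ∼-trans : ∀ {p q r} → p ∼ q → q ∼ r → p ∼ r
    ∼-trans {p} {q} {r} e f = record
      { v     = F.v ∙ᴹ E.v
      ; v⋆v≈p = product-projection F.v E.v E.v⋆v≈p (idempotent p)
                  (≈ᴹ-trans F.v⋆v≈p (≈ᴹ-sym E.vv⋆≈q))
      ; vv⋆≈q = product-projection′ F.v E.v F.vv⋆≈q (idempotent r)
                  (≈ᴹ-trans F.v⋆v≈p (≈ᴹ-sym E.vv⋆≈q))
      }
      where
      module E = _∼_ e
      module F = _∼_ f

    ⊕ᴾ-cong : ∀ {p p′ q q′} → p ∼ p′ → q ∼ q′ → p ⊕ᴾ q ∼ p′ ⊕ᴾ q′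
    ⊕ᴾ-cong e f = record
      { v     = E.v ⊕ F.v
      ; v⋆v≈p = ≈ᴹ-trans (∙ᴹ-cong (⊕-⋆ᴹ E.v F.v) (λ i j → refl))
          (≈ᴹ-trans (⊕-∙ᴹ (E.v ⋆ᴹ) (F.v ⋆ᴹ) E.v F.v) (⊕-cong E.v⋆v≈p F.v⋆v≈p))
      ; vv⋆≈q = ≈ᴹ-trans (∙ᴹ-cong {a = E.v ⊕ F.v} (λ i j → refl) (⊕-⋆ᴹ E.v F.v))
          (≈ᴹ-trans (⊕-∙ᴹ E.v F.v (E.v ⋆ᴹ) (F.v ⋆ᴹ)) (⊕-cong E.vv⋆≈q F.vv⋆≈q))
      }
      where
      module E = _∼_ e
      module F = _∼_ f

    -- Permuting rows and columns does not change the class of a projection.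
    reindex : ∀ {p q} (σ : Fin (size q) ↔ Fin (size p)) →
              (∀ i j → matrix q i j ≈ matrix p (Inverse.to σ i) (Inverse.to σ j)) → q ∼ p
    reindex {p} {q} σ e = record
      { v     = v
      ; v⋆v≈p = λ i j → trans (sum-cong-≋ (λ k → *-congʳ (selfAdjoint p (to i) k)))
          (trans (idempotent p (to i) (to j)) (sym (e i j)))
      ; vv⋆≈q = λ i j → trans (sum-cong-≋ (λ k → *-congˡ (selfAdjoint p (to k) j)))
          (trans (sym (sum-permute (λ k → matrix p i k * matrix p k j) σ)) (idempotent p i j))
      }
      where
      open Inverse σ using (to)
      v : Mat (size p) (size q)
      v i j = matrix p i (to j)

    ⊕ᴾ-comm : ∀ p q → p ⊕ᴾ q ∼ q ⊕ᴾ p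
    ⊕ᴾ-comm p q = reindex σ λ i j → trans
      (entries (splitAt s₁ i) (splitAt s₁ j))
      (sym (reflexive (≡.cong₂ (diagonal (matrix q) (matrix p))
        (Fin.splitAt-join s₂ s₁ (swap (splitAt s₁ i))) (Fin.splitAt-join s₂ s₁ (swap (splitAt s₁ j))))))
      where
      s₁ = size p
      s₂ = size q
      σ : Fin (s₁ ℕ.+ s₂) ↔ Fin (s₂ ℕ.+ s₁)
      σ = ↔-trans Fin.+↔⊎ (↔-trans (⊎-comm _ _) (↔-sym (Fin.+↔⊎ {s₂} {s₁})))
      entries : ∀ x y → diagonal (matrix p) (matrix q) x y ≈ diagonal (matrix q) (matrix p) (swap x) (swap y)
      entries (inj₁ _) (inj₁ _) = refl
      entries (inj₁ _) (inj₂ _) = refl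
      entries (inj₂ _) (inj₁ _) = refl
      entries (inj₂ _) (inj₂ _) = refl

    ⊕ᴾ-assoc : ∀ p q r → (p ⊕ᴾ q) ⊕ᴾ r ∼ p ⊕ᴾ (q ⊕ᴾ r)
    ⊕ᴾ-assoc p q r = reindex σ λ i j → trans
      (entries (splitAt (s₁ ℕ.+ s₂) i) (splitAt (s₁ ℕ.+ s₂) j))
      (sym (reflexive (≡.cong₂ (diagonal (matrix p) (matrix q ⊕ matrix r))
        (Fin.splitAt-join s₁ (s₂ ℕ.+ s₃) (regroup (splitAt (s₁ ℕ.+ s₂) i)))
        (Fin.splitAt-join s₁ (s₂ ℕ.+ s₃) (regroup (splitAt (s₁ ℕ.+ s₂) j))))))
      where
      s₁ = size p
      s₂ = size q
      s₃ = size r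
      σ : Fin ((s₁ ℕ.+ s₂) ℕ.+ s₃) ↔ Fin (s₁ ℕ.+ (s₂ ℕ.+ s₃))
      σ = ↔-trans Fin.+↔⊎ (↔-trans (Fin.+↔⊎ {s₁} {s₂} ⊎-↔ ↔-refl) (↔-trans (⊎-assoc 0ℓ _ _ _)
            (↔-trans (↔-refl ⊎-↔ ↔-sym (Fin.+↔⊎ {s₂} {s₃})) (↔-sym (Fin.+↔⊎ {s₁} {s₂ ℕ.+ s₃})))))
      group : (Fin s₁ ⊎ Fin s₂) ⊎ Fin s₃ → Fin s₁ ⊎ Fin (s₂ ℕ.+ s₃)
      group x = map₂ (join s₂ s₃) (assocʳ x)
      regroup : Fin (s₁ ℕ.+ s₂) ⊎ Fin s₃ → Fin s₁ ⊎ Fin (s₂ ℕ.+ s₃)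
      regroup x = group (map₁ (splitAt s₁) x)
      inner : ∀ x y → diagonal (matrix q) (matrix r) x y ≈ (matrix q ⊕ matrix r) (join s₂ s₃ x) (join s₂ s₃ y)
      inner x y = sym (reflexive (≡.cong₂ (diagonal (matrix q) (matrix r)) (Fin.splitAt-join s₂ s₃ x) (Fin.splitAt-join s₂ s₃ y)))
      Entry = λ x y → diagonal (matrix p) (matrix q ⊕ matrix r) (group x) (group y)
      entries₁₁ : ∀ x y → diagonal (matrix p) (matrix q) x y ≈ Entry (inj₁ x) (inj₁ y)
      entries₁₁ (inj₁ _) (inj₁ _) = refl
      entries₁₁ (inj₁ _) (inj₂ _) = refl
      entries₁₁ (inj₂ _) (inj₁ _) = refl
      entries₁₁ (inj₂ i) (inj₂ j) = inner (inj₁ i) (inj₁ j)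
      entries₁₂ : ∀ x j → 0# ≈ Entry (inj₁ x) (inj₂ j)
      entries₁₂ (inj₁ _) j = refl
      entries₁₂ (inj₂ i) j = inner (inj₁ i) (inj₂ j)
      entries₂₁ : ∀ i y → 0# ≈ Entry (inj₂ i) (inj₁ y)
      entries₂₁ i (inj₁ _) = refl
      entries₂₁ i (inj₂ j) = inner (inj₂ i) (inj₁ j)
      entries : ∀ x y → diagonal (matrix p ⊕ matrix q) (matrix r) x y ≈
                        diagonal (matrix p) (matrix q ⊕ matrix r) (regroup x) (regroup y)
      entries (inj₁ i) (inj₁ j) = entries₁₁ (splitAt s₁ i) (splitAt s₁ j)
      entries (inj₁ i) (inj₂ j) = entries₁₂ (splitAt s₁ i) j
      entries (inj₂ i) (inj₁ j) = entries₂₁ i (splitAt s₁ j)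
      entries (inj₂ i) (inj₂ j) = inner (inj₂ i) (inj₂ j)

    ⊕ᴾ-identityˡ : ∀ p → 0ᴾ ⊕ᴾ p ∼ p
    ⊕ᴾ-identityˡ p = reindex ↔-refl (λ i j → refl)

    V : CommutativeMonoid (c ⊔ ℓ) (c ⊔ ℓ)
    V = record
      { Carrier = Projection ; _≈_ = _∼_ ; _∙_ = _⊕ᴾ_ ; ε = 0ᴾ
      ; isCommutativeMonoid = record
        { isMonoid = record
          { isSemigroup = record
            { isMagma = record
              { isEquivalence = record { refl = ∼-refl ; sym = ∼-sym ; trans = ∼-trans }
              ; ∙-cong = ⊕ᴾ-cong }
            ; assoc = ⊕ᴾ-assoc }
          ; identity = ⊕ᴾ-identityˡ , λ p → ∼-trans (⊕ᴾ-comm p 0ᴾ) (⊕ᴾ-identityˡ p) }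
        ; comm = ⊕ᴾ-comm } }

  module _ {c₁ ℓ₁ c₂ ℓ₂} {R : StarRing c₁ ℓ₁} {S : StarRing c₂ ℓ₂} (f : StarRingHomomorphism R S) where
    private
      module R = StarRing R
      module S = StarRing S
      module MR = Matrices R
      module MS = Matrices S
      module SR = SemiringSum R.semiring
      module SS = SemiringSum S.semiring
    open StarRingHomomorphism f

    sum-homo : ∀ {n} (g : Fin n → R.Carrier) → ⟦ SR.sum g ⟧ S.≈ SS.sum (⟦_⟧ ∘ g)
    sum-homo {ℕ.zero}  g = 0-homo
    sum-homo {ℕ.suc n} g = S.trans (+-homo _ _) (S.+-congˡ (sum-homo (g ∘ suc)))

    apply : ∀ {m n} → MR.Mat m n → MS.Mat m n
    apply a i j = ⟦ a i j ⟧

    apply-∙ᴹ : ∀ {m n k} (a : MR.Mat m n) (b : MR.Mat n k) →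
               MS._≈ᴹ_ (MS._∙ᴹ_ (apply a) (apply b)) (apply (MR._∙ᴹ_ a b))
    apply-∙ᴹ a b i k = S.trans (SS.sum-cong-≋ (λ j → S.sym (*-homo (a i j) (b j k))))
      (S.sym (sum-homo (λ j → a i j R.* b j k)))

    mapᴾ : MR.Projection → MS.Projection
    mapᴾ p = record
      { matrix      = apply matrix
      ; idempotent  = λ i j → S.trans (apply-∙ᴹ matrix matrix i j) (⟦⟧-cong (idempotent i j))
      ; selfAdjoint = λ i j → S.trans (S.sym (⋆-homo (matrix j i))) (⟦⟧-cong (selfAdjoint i j))
      }
      where open MR.Projection p

    mapᴾ-cong : ∀ {p q} → MR._∼_ p q → MS._∼_ (mapᴾ p) (mapᴾ q)
    mapᴾ-cong e = record
      { v     = apply v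
      ; v⋆v≈p = λ i j → S.trans (SS.sum-cong-≋ (λ k → S.*-congʳ (S.sym (⋆-homo (v k i)))))
          (S.trans (apply-∙ᴹ (MR._⋆ᴹ v) v i j) (⟦⟧-cong (v⋆v≈p i j)))
      ; vv⋆≈q = λ i j → S.trans (SS.sum-cong-≋ (λ k → S.*-congˡ (S.sym (⋆-homo (v j k)))))
          (S.trans (apply-∙ᴹ v (MR._⋆ᴹ v) i j) (⟦⟧-cong (vv⋆≈q i j)))
      }
      where open MR._∼_ e

    mapᴾ-⊕ : ∀ p q → MS._∼_ (mapᴾ (p MR.⊕ᴾ q)) (mapᴾ p MS.⊕ᴾ mapᴾ q)
    mapᴾ-⊕ p q = MS.reindex ↔-refl
      (λ i j → entries (splitAt (MR.Projection.size p) i) (splitAt (MR.Projection.size p) j))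
      where
      entries : ∀ x y → ⟦ MR.diagonal (MR.Projection.matrix p) (MR.Projection.matrix q) x y ⟧ S.≈
                        MS.diagonal (apply (MR.Projection.matrix p)) (apply (MR.Projection.matrix q)) x y
      entries (inj₁ _) (inj₁ _) = S.refl
      entries (inj₁ _) (inj₂ _) = 0-homo
      entries (inj₂ _) (inj₁ _) = 0-homo
      entries (inj₂ _) (inj₂ _) = S.refl

    V-homo : IsMonoidHomomorphism (CommutativeMonoid.rawMonoid MR.V) (CommutativeMonoid.rawMonoid MS.V) mapᴾ
    V-homo = record
      { isMagmaHomomorphism = record
        { isRelHomomorphism = record { cong = mapᴾ-cong } ; homo = mapᴾ-⊕ }
      ; ε-homo = MS.reindex ↔-refl λ () }

  -- The Grothendieck group of a commutative monoid; (a , b) stands for a - b.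
  module Grothendieck {c ℓ} (M : CommutativeMonoid c ℓ) where
    open CommutativeMonoid M
    open CommutativeMonoidSolver M using (solve; _⊕_; _⊜_)
    open SetoidReasoning setoid

    infix 4 _≈ᴳ_
    _≈ᴳ_ : Rel (Carrier × Carrier) (c ⊔ ℓ)
    (a , b) ≈ᴳ (d , e) = ∃[ k ] (a ∙ e) ∙ k ≈ (d ∙ b) ∙ k

    group : AbelianGroup c (c ⊔ ℓ)
    group = record
      { Carrier = Carrier × Carrier
      ; _≈_ = _≈ᴳ_
      ; _∙_ = λ (a , b) (d , e) → a ∙ d , b ∙ e
      ; ε = ε , ε
      ; _⁻¹ = λ (a , b) → b , a
      ; isAbelianGroup = record
        { isGroup = record
          { isMonoid = record
            { isSemigroup = record
              { isMagma = record
                { isEquivalence = record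
                  { refl  = ε , refl
                  ; sym   = λ (k , e) → k , sym e
                  ; trans = λ {x} {y} {z} → transᴳ x y z }
                ; ∙-cong = λ {x} {x′} {y} {y′} → congᴳ x x′ y y′ }
              ; assoc = λ (a , b) (d , e) (f , g) → ε , ∙-congʳ (solve 6 (λ a b d e f g →
                  ((a ⊕ d) ⊕ f) ⊕ (b ⊕ (e ⊕ g)) ⊜ (a ⊕ (d ⊕ f)) ⊕ ((b ⊕ e) ⊕ g)) refl a b d e f g) }
            ; identity = (λ (a , b) → ε , ∙-congʳ (∙-cong (identityˡ a) (sym (identityˡ b))))
                       , (λ (a , b) → ε , ∙-congʳ (∙-cong (identityʳ a) (sym (identityʳ b)))) }
          ; inverse = (λ (a , b) → ε , ∙-congʳ (cancel b a)) , (λ (a , b) → ε , ∙-congʳ (cancel a b))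
          ; ⁻¹-cong = λ {(a , b)} {(d , e)} (k , p) → k , (begin
              (b ∙ d) ∙ k  ≈⟨ ∙-congʳ (comm b d) ⟩
              (d ∙ b) ∙ k  ≈⟨ p ⟨
              (a ∙ e) ∙ k  ≈⟨ ∙-congʳ (comm a e) ⟩
              (e ∙ a) ∙ k  ∎) }
        ; comm = λ (a , b) (d , e) → ε , ∙-congʳ (∙-cong (comm a d) (comm e b)) } }
      where
      cancel : ∀ a b → (a ∙ b) ∙ ε ≈ ε ∙ (b ∙ a)
      cancel a b = trans (identityʳ _) (trans (comm a b) (sym (identityˡ _)))

      transᴳ : ∀ x y z → x ≈ᴳ y → y ≈ᴳ z → x ≈ᴳ z
      transᴳ (a , b) (d , e) (f , g) (k , p) (l , q) = (e ∙ d) ∙ (k ∙ l) , (begin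
        (a ∙ g) ∙ ((e ∙ d) ∙ (k ∙ l))
          ≈⟨ solve 6 (λ a g e d k l → (a ⊕ g) ⊕ ((e ⊕ d) ⊕ (k ⊕ l)) ⊜ ((a ⊕ e) ⊕ k) ⊕ ((d ⊕ g) ⊕ l)) refl a g e d k l ⟩
        ((a ∙ e) ∙ k) ∙ ((d ∙ g) ∙ l)
          ≈⟨ ∙-cong p q ⟩
        ((d ∙ b) ∙ k) ∙ ((f ∙ e) ∙ l)
          ≈⟨ solve 6 (λ d b k f e l → ((d ⊕ b) ⊕ k) ⊕ ((f ⊕ e) ⊕ l) ⊜ (f ⊕ b) ⊕ ((e ⊕ d) ⊕ (k ⊕ l))) refl d b k f e l ⟩
        (f ∙ b) ∙ ((e ∙ d) ∙ (k ∙ l)) ∎)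

      congᴳ : ∀ x x′ y y′ → x ≈ᴳ x′ → y ≈ᴳ y′ →
              (proj₁ x ∙ proj₁ y , proj₂ x ∙ proj₂ y) ≈ᴳ (proj₁ x′ ∙ proj₁ y′ , proj₂ x′ ∙ proj₂ y′)
      congᴳ (a , b) (a′ , b′) (d , e) (d′ , e′) (k , p) (l , q) = k ∙ l , (begin
        ((a ∙ d) ∙ (b′ ∙ e′)) ∙ (k ∙ l)
          ≈⟨ shuffle a d b′ e′ k l ⟩
        ((a ∙ b′) ∙ k) ∙ ((d ∙ e′) ∙ l)
          ≈⟨ ∙-cong p q ⟩
        ((a′ ∙ b) ∙ k) ∙ ((d′ ∙ e) ∙ l)
          ≈⟨ shuffle a′ d′ b e k l ⟨
        ((a′ ∙ d′) ∙ (b ∙ e)) ∙ (k ∙ l) ∎)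
        where
        shuffle = solve 6 (λ a d b e k l →
          ((a ⊕ d) ⊕ (b ⊕ e)) ⊕ (k ⊕ l) ⊜ ((a ⊕ b) ⊕ k) ⊕ ((d ⊕ e) ⊕ l)) refl

  module _ {c₁ ℓ₁ c₂ ℓ₂} {M : CommutativeMonoid c₁ ℓ₁} {N : CommutativeMonoid c₂ ℓ₂}
           {f : CommutativeMonoid.Carrier M → CommutativeMonoid.Carrier N}
           (f-homo : IsMonoidHomomorphism (CommutativeMonoid.rawMonoid M) (CommutativeMonoid.rawMonoid N) f) where
    private
      module M = CommutativeMonoid M
      module N = CommutativeMonoid N
    open IsMonoidHomomorphism f-homo

    map² : M.Carrier × M.Carrier → N.Carrier × N.Carrier
    map² (a , b) = f a , f b

    Grothendieck-homo : IsGroupHomomorphism (AbelianGroup.rawGroup (Grothendieck.group M))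
                                            (AbelianGroup.rawGroup (Grothendieck.group N)) map²
    Grothendieck-homo = record
      { isMonoidHomomorphism = record
        { isMagmaHomomorphism = record
          { isRelHomomorphism = record
            { cong = λ {(a , b)} {(d , e)} (k , p) → f k ,
                N.trans (N.sym (three a e k)) (N.trans (⟦⟧-cong p) (three d b k)) }
          ; homo = λ (a , b) (d , e) → N.ε , N.∙-congʳ (N.∙-cong (homo a d) (N.sym (homo b e))) }
        ; ε-homo = N.ε , N.∙-congʳ (N.∙-cong ε-homo (N.sym ε-homo)) }
      ; ⁻¹-homo = λ (a , b) → N.ε , N.refl }
      where
      three : ∀ a b k → f ((a M.∙ b) M.∙ k) N.≈ (f a N.∙ f b) N.∙ f k
      three a b k = N.trans (homo _ _) (N.∙-congʳ (homo a b))

  module _ {c₁ ℓ₁ c₂ ℓ₂} (G : AbelianGroup c₁ ℓ₁) (H : AbelianGroup c₂ ℓ₂)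
           {f : AbelianGroup.Carrier G → AbelianGroup.Carrier H}
           (f-homo : IsGroupHomomorphism (AbelianGroup.rawGroup G) (AbelianGroup.rawGroup H) f) where
    private
      module G = AbelianGroup G
      module H = AbelianGroup H
    open IsGroupHomomorphism f-homo

    kernel : AbelianGroup (c₁ ⊔ ℓ₂) ℓ₁
    kernel = record
      { Carrier = Σ[ x ∈ G.Carrier ] f x H.≈ H.ε
      ; _≈_ = λ (x , _) (y , _) → x G.≈ y
      ; _∙_ = λ (x , p) (y , q) → x G.∙ y ,
          H.trans (homo x y) (H.trans (H.∙-cong p q) (H.identityˡ H.ε))
      ; ε = G.ε , ε-homo
      ; _⁻¹ = λ (x , p) → x G.⁻¹ , H.trans (⁻¹-homo x) (H.trans (H.⁻¹-cong p) ε⁻¹≈ε)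
      ; isAbelianGroup = record
        { isGroup = record
          { isMonoid = record
            { isSemigroup = record
              { isMagma = record
                { isEquivalence = record { refl = G.refl ; sym = G.sym ; trans = G.trans }
                ; ∙-cong = G.∙-cong }
              ; assoc = λ (x , _) (y , _) (z , _) → G.assoc x y z }
            ; identity = (λ (x , _) → G.identityˡ x) , (λ (x , _) → G.identityʳ x) }
          ; inverse = (λ (x , _) → G.inverseˡ x) , (λ (x , _) → G.inverseʳ x)
          ; ⁻¹-cong = G.⁻¹-cong }
        ; comm = λ (x , _) (y , _) → G.comm x y } }
      where open AbelianGroupProperties H using (ε⁻¹≈ε)

  module KTheory (A : CStarAlgebra c ℓ) where
    open Unitization A
    open Matrices unitization

    -- The kernel of K₀(A⁺) → K₀(ℂ), where A⁺ is the unitization of A.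
    K₀ : AbelianGroup (c ⊔ ℓ) (c ⊔ ℓ)
    K₀ = kernel (Grothendieck.group V) (Grothendieck.group (Matrices.V ℂ-starRing))
           (Grothendieck-homo {M = V} {N = Matrices.V ℂ-starRing} (V-homo scalar-part))

    -- A norm-continuous path of unitaries; the norm topology on matrices is the
    -- entrywise one.
    record Homotopic {n} (u v : Unitary n) : Set (c ⊔ ℓ) where
      field
        path       : ∀ t → 0ℝ ≤ʳ t → t ≤ʳ 1ℝ → Unitary n
        start      : ∀ 0≤0 0≤1 → Unitary.matrix (path 0ℝ 0≤0 0≤1) ≈ᴹ Unitary.matrix u
        end        : ∀ 0≤1 1≤1 → Unitary.matrix (path 1ℝ 0≤1 1≤1) ≈ᴹ Unitary.matrix v
        continuous : ∀ t 0≤t t≤1 ε → Positive ε → ∃[ δ ] Positive δ ×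
          (∀ s 0≤s s≤1 → ∣ s -ʳ t ∣ʳ ≤ʳ fromℚ δ → ∀ i j →
            Close ε (Unitary.matrix (path s 0≤s s≤1) i j) (Unitary.matrix (path t 0≤t t≤1) i j))

    -- Homotopy after adding identity matrices to reach a common size.
    StablyHomotopic : Rel (∃[ n ] Unitary n) (c ⊔ ℓ)
    StablyHomotopic (m , u) (n , v) = ∃[ k ] ∃[ l ] Σ[ e ∈ m ℕ.+ k ≡ n ℕ.+ l ]
      Homotopic (subst Unitary e (u ⊕ᵁ 1ᵁ k)) (v ⊕ᵁ 1ᵁ l)

    -- [u] + [v] = [u ⊕ v] and -[u] = [u⋆]; only the operations are recorded, as
    -- isomorphisms do not refer to the group laws.
    K₁ : RawGroup (c ⊔ ℓ) (c ⊔ ℓ)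
    K₁ = record
      { Carrier = ∃[ n ] Unitary n
      ; _≈_     = StablyHomotopic
      ; _∙_     = λ (m , u) (n , v) → m ℕ.+ n , u ⊕ᵁ v
      ; ε       = 0 , 1ᵁ 0
      ; _⁻¹     = λ (n , u) → n , u ⁻¹ᵁ
      }

  K : Fin 2 → CStarAlgebra c ℓ → RawGroup (c ⊔ ℓ) (c ⊔ ℓ)
  K 0F A = AbelianGroup.rawGroup (KTheory.K₀ A)
  K 1F A = KTheory.K₁ A

  infix 4 _≅_
  _≅_ : ∀ {c₁ ℓ₁ c₂ ℓ₂} → RawGroup c₁ ℓ₁ → RawGroup c₂ ℓ₂ → Set (c₁ ⊔ ℓ₁ ⊔ c₂ ⊔ ℓ₂)
  G ≅ H = ∃[ f ] IsGroupIsomorphism G H f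

open HigherRankGraphs public using (Λ′; Λ′[_])
open CStarAlgebras public using (CStarAlgebra; IsGraphAlgebra; K; _≅_)

{-# OPTIONS --safe #-}

-- The matrices M′_U and M′₂ both record "same i, different j", and M′_V and M′₁ both
-- record "same j, different i".  Hence transposing grids identifies Λ′_t(κ) with Λ′(κ)
-- up to exchanging the two coordinates of the degree.  The Cuntz–Krieger relations do not
-- see this exchange, so the two universal C⋆-algebras are isomorphic, and K-theory is
-- functorial.
module Submission where

open import Defs
open import Data.Fin.Base using (Fin; splitAt)
open import Data.Nat.Base using (ℕ; _≤_)

open HigherRankGraphs using
  (Degree; 0ᵈ; module HigherRankGraph; RowFiniteGraph; GridSystem; Grid; at; hstep; vstep; module GridGraph;
   module TileSystem; module PolygonSystem)
open CStarAlgebras using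
  (StarHomomorphism; CuntzKriegerFamily; StarRing; StarRingHomomorphism; module Unitization;
   module Matrices; module Grothendieck; module KTheory; ℂ-starRing; apply; apply-∙ᴹ; mapᴾ;
   V-homo; Grothendieck-homo; kernel)
open Reals using
  (seq; _≃_; mk≃; ≃-refl; ≃-trans; ≃-pointwise; _≤ʳ_; mk≤; fromℚ; 0ℝ; _*ʳ_; *ʳ-cong; ∣_∣²;
   ℝ-commutativeRing; 0ᶜ; _≈ᶜ_; _,ᶜ_; ℂ-commutativeRing)

open import Algebra.Bundles using (AbelianGroup; CommutativeMonoid; CommutativeRing; RawGroup)
open import Algebra.Morphism.Structures using (IsGroupHomomorphism; IsMonoidHomomorphism)
import Algebra.Properties.AbelianGroup as AbelianGroupProperties
open import Data.Fin.Patterns using (0F; 1F)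
import Data.Fin.Properties as Fin
import Data.List.Base as List
import Data.List.Membership.Setoid.Properties as Membership
open import Data.List.Properties using (map-∘)
import Data.List.Relation.Unary.All as All
import Data.List.Relation.Unary.All.Properties as All
import Data.List.Relation.Unary.Unique.Setoid.Properties as Unique
import Data.Nat.Base as ℕ
import Data.Nat.Properties as ℕ
open import Data.Product.Base using (∃-syntax; _×_; _,_; proj₁; proj₂)
open import Data.Rational.Base as ℚ using (ℚ; ½; 0ℚ; Positive)
import Data.Rational.Properties as ℚ
open import Data.Rational.Solver using (module +-*-Solver)
open import Data.Sum.Base using (inj₁; inj₂)
open import Data.Vec.Base using ([]; _∷_)
open import Function.Base using (_∘_; id)
open import Function.Properties.Inverse using (↔-refl)
open import Level using (Level; _⊔_)
open import Relation.Binary.Bundles using (Setoid)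
open import Relation.Binary.Core using (Rel)
open import Relation.Binary.PropositionalEquality as ≡ using (_≡_; subst)
open import Relation.Nullary using (yes; no)

private
  variable
    k m n : ℕ
    c ℓ   : Level

-- Isomorphisms of higher-rank graphs up to reindexing the degrees

-- The Cuntz-Krieger relations see degrees only through the vertices and the sets `Λⁿ(v)`, so
-- degrees may be relabelled by a `twist` that fixes `0ᵈ`. For grids it swaps the two coordinates.
record DegreeTwistedFunctor (Λ Λ′ : RowFiniteGraph k) : Set where
  private
    module Λ  = RowFiniteGraph Λ
    module Λ′ = RowFiniteGraph Λ′
  field
    map       : Λ.Mor → Λ′.Mor
    map-cong  : ∀ {f g} → f Λ.≈ g → map f Λ′.≈ map g
    twist     : Degree k → Degree k
    twist-0   : twist 0ᵈ ≡ 0ᵈ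
    d-map     : ∀ f → Λ′.d (map f) ≡ twist (Λ.d f)
    r-map     : ∀ f → Λ′.r (map f) Λ′.≈ map (Λ.r f)
    s-map     : ∀ f → Λ′.s (map f) Λ′.≈ map (Λ.s f)
    comp-map  : ∀ f g e e′ → map (Λ.comp f g e) Λ′.≈ Λ′.comp (map f) (map g) e′

  map-vertex : ∀ {v} → Λ.Vertex v → Λ′.Vertex (map v)
  map-vertex {v} e = ≡.trans (d-map v) (≡.trans (≡.cong twist e) twist-0)

record DegreeTwistedIsomorphism (Λ Λ′ : RowFiniteGraph k) : Set where
  private
    module Λ  = RowFiniteGraph Λ
    module Λ′ = RowFiniteGraph Λ′
  field
    forward  : DegreeTwistedFunctor Λ Λ′
    backward : DegreeTwistedFunctor Λ′ Λ
  module F = DegreeTwistedFunctor forward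
  module G = DegreeTwistedFunctor backward
  field
    G∘F           : ∀ f → G.map (F.map f) Λ.≈ f
    F∘G           : ∀ f → F.map (G.map f) Λ′.≈ f
    twist-inverse : ∀ n → G.twist (F.twist n) ≡ n
    twist-inverse′ : ∀ n → F.twist (G.twist n) ≡ n

  map-injective : ∀ {f g} → F.map f Λ′.≈ F.map g → f Λ.≈ g
  map-injective {f} {g} e = trans (sym (G∘F f)) (trans (G.map-cong e) (G∘F g))
    where open Setoid Λ.setoid

  -- This transports the index set of the sum in relation (d). For completeness, a morphism `f` of
  -- degree `F.twist n` with range `F.map v` is the image of `G.map f`, whose degree and range
  -- untwist to `n` and `v`. Distinctness is injectivity of `F.map`.
  map-enumerates : ∀ {fs n v} → Λ.Enumerates fs n v →
                   Λ′.Enumerates (List.map F.map fs) (F.twist n) (F.map v)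
  map-enumerates {fs} {n} {v} E = record
    { sound    = All.map⁺ (All.map
        (λ {f} (d≡ , r≈) → ≡.trans (F.d-map f) (≡.cong F.twist d≡) , trans′ (F.r-map f) (F.map-cong r≈))
        sound)
    ; complete = λ f (d≡ , r≈) → Membership.∈-resp-≈ Λ′.setoid (F∘G f)
        (Membership.∈-map⁺ Λ.setoid Λ′.setoid F.map-cong
          (complete (G.map f)
            ( ≡.trans (G.d-map f) (≡.trans (≡.cong G.twist d≡) (twist-inverse n))
            , trans (G.r-map f) (trans (G.map-cong r≈) (G∘F v)) )))
    ; distinct = Unique.map⁺ Λ.setoid Λ′.setoid map-injective distinct
    }
    where
    open Λ.Enumerates E
    open Setoid Λ.setoid using (trans)
    open Setoid Λ′.setoid using () renaming (trans to trans′)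

inverse : {Λ Λ′ : RowFiniteGraph k} → DegreeTwistedIsomorphism Λ Λ′ → DegreeTwistedIsomorphism Λ′ Λ
inverse Φ = record
  { forward = backward ; backward = forward ; G∘F = F∘G ; F∘G = G∘F
  ; twist-inverse = twist-inverse′ ; twist-inverse′ = twist-inverse }
  where open DegreeTwistedIsomorphism Φ

-- Transposition of grids

module _ (Γ Γ′ : GridSystem) where
  private
    module Γ  = GridSystem Γ
    module Γ′ = GridSystem Γ′
    module Λ  = GridGraph Γ
    module Λ′ = GridGraph Γ′

  module Transposition (f : Γ.S → Γ′.S)
    (f₁ : ∀ a b → Γ.N₁ a b ≡ 1 → Γ′.N₂ (f a) (f b) ≡ 1)
    (f₂ : ∀ a b → Γ.N₂ a b ≡ 1 → Γ′.N₁ (f a) (f b) ≡ 1) where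

    transposeᵍ : Grid Γ.N₁ Γ.N₂ m n → Grid Γ′.N₁ Γ′.N₂ n m
    transposeᵍ φ = record
      { at    = λ p q b c → f (at φ q p c b)
      ; hstep = λ p q b c → f₂ _ _ (vstep φ q p c b)
      ; vstep = λ p q b c → f₁ _ _ (hstep φ q p c b)
      }

    transposeᵐ : Λ.Morphism → Λ′.Morphism
    transposeᵐ (Λ.mor φ) = Λ′.mor (transposeᵍ φ)

    transposeᵐ-cong : ∀ {φ χ} → φ Λ.≋ χ → transposeᵐ φ Λ′.≋ transposeᵐ χ
    transposeᵐ-cong (Λ.mk≋ w≡ h≡ at≡) =
      Λ′.mk≋ h≡ w≡ λ p q b c b′ c′ → ≡.cong f (at≡ q p c b c′ b′)

    transposeᵐ-composite : ∀ {φ₁ φ₂ χ} → Λ.IsComposite φ₁ φ₂ χ →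
                           Λ′.IsComposite (transposeᵐ φ₁) (transposeᵐ φ₂) (transposeᵐ χ)
    transposeᵐ-composite C = record
      { width-+  = height-+
      ; height-+ = width-+
      ; at-₁     = λ p q b c b′ c′ → ≡.cong f (at-₁ q p c b c′ b′)
      ; at-₂     = λ p q b c b′ c′ → ≡.cong f (at-₂ q p c b c′ b′)
      }
      where open Λ.IsComposite C

    -- Composites are built by filling in two corners, and this construction need not commute with
    -- transposition on the nose. But the transposed composite restricts to the two transposed
    -- factors, and `composite-unique` says that this determines it.
    transposeᵐ-compose : ∀ φ χ e e′ →
      transposeᵐ (Λ.compose φ χ e) Λ′.≋ Λ′.compose (transposeᵐ φ) (transposeᵐ χ) e′
    transposeᵐ-compose φ χ e e′ = Λ′.composite-unique
      {transposeᵐ φ} {transposeᵐ χ} {transposeᵐ (Λ.compose φ χ e)} {Λ′.compose (transposeᵐ φ) (transposeᵐ χ) e′}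
      (transposeᵐ-composite {φ} {χ} {Λ.compose φ χ e} (Λ.compose-isComposite φ χ e))
      (Λ′.compose-isComposite (transposeᵐ φ) (transposeᵐ χ) e′)

-- For the tile and polygon systems this unfolds to `Λ′` and `Λ′[ t ]`, so a general statement about
-- grid systems applies to both.
gridRowFiniteGraph : (Γ : GridSystem) → HigherRankGraph.NoSources (GridGraph.graph Γ) → RowFiniteGraph 2
gridRowFiniteGraph Γ noSources = record
  { graph = GridGraph.graph Γ ; rowFinite = GridGraph.rowFinite Γ ; noSources = noSources }

module _ (Γ Γ′ : GridSystem)
         (noSources : HigherRankGraph.NoSources (GridGraph.graph Γ))
         (noSources′ : HigherRankGraph.NoSources (GridGraph.graph Γ′)) where
  private
    module Γ  = GridSystem Γ
    module Γ′ = GridSystem Γ′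
    module Λ′ = GridGraph Γ′

  module _ (f : Γ.S → Γ′.S)
    (f₁ : ∀ a b → Γ.N₁ a b ≡ 1 → Γ′.N₂ (f a) (f b) ≡ 1)
    (f₂ : ∀ a b → Γ.N₂ a b ≡ 1 → Γ′.N₁ (f a) (f b) ≡ 1) where
    open Transposition Γ Γ′ f f₁ f₂

    transposition : DegreeTwistedFunctor (gridRowFiniteGraph Γ noSources) (gridRowFiniteGraph Γ′ noSources′)
    transposition = record
      { map      = transposeᵐ
      ; map-cong = transposeᵐ-cong
      ; twist    = λ { (a ∷ b ∷ []) → b ∷ a ∷ [] }
      ; twist-0  = ≡.refl
      ; d-map    = λ _ → ≡.refl
      -- A vertex and its transpose carry the same entry but different step proofs, and `≋` compares
      -- entries only.
      ; r-map    = λ _ → Λ′.mk≋ ≡.refl ≡.refl λ _ _ _ _ _ _ → ≡.refl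
      ; s-map    = λ _ → Λ′.mk≋ ≡.refl ≡.refl λ _ _ _ _ _ _ → ≡.refl
      ; comp-map = transposeᵐ-compose
      }

module _ (Γ Γ′ : GridSystem)
         (noSources : HigherRankGraph.NoSources (GridGraph.graph Γ))
         (noSources′ : HigherRankGraph.NoSources (GridGraph.graph Γ′)) where
  private
    module Γ  = GridSystem Γ
    module Γ′ = GridSystem Γ′
    module Λ  = GridGraph Γ
    module Λ′ = GridGraph Γ′

  transposition-≅ : (f : Γ.S → Γ′.S) (g : Γ′.S → Γ.S) → (∀ a → g (f a) ≡ a) → (∀ b → f (g b) ≡ b) →
    (∀ a b → Γ.N₁ a b ≡ 1 → Γ′.N₂ (f a) (f b) ≡ 1) →
    (∀ a b → Γ.N₂ a b ≡ 1 → Γ′.N₁ (f a) (f b) ≡ 1) →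
    (∀ a b → Γ′.N₁ a b ≡ 1 → Γ.N₂ (g a) (g b) ≡ 1) →
    (∀ a b → Γ′.N₂ a b ≡ 1 → Γ.N₁ (g a) (g b) ≡ 1) →
    DegreeTwistedIsomorphism (gridRowFiniteGraph Γ noSources) (gridRowFiniteGraph Γ′ noSources′)
  transposition-≅ f g gf fg f₁ f₂ g₁ g₂ = record
    { forward        = transposition Γ Γ′ noSources noSources′ f f₁ f₂
    ; backward       = transposition Γ′ Γ noSources′ noSources g g₁ g₂
    ; G∘F            = λ φ → Λ.mk≋ ≡.refl ≡.refl λ p q b c _ _ → gf (at (Λ.Morphism.grid φ) p q b c)
    ; F∘G            = λ φ → Λ′.mk≋ ≡.refl ≡.refl λ p q b c _ _ → fg (at (Λ′.Morphism.grid φ) p q b c)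
    ; twist-inverse  = λ { (_ ∷ _ ∷ []) → ≡.refl }
    ; twist-inverse′ = λ { (_ ∷ _ ∷ []) → ≡.refl }
    }

polygons≅tiles : ∀ α β 2≤α 2≤β t 1≤t →
                 DegreeTwistedIsomorphism (Λ′[ t ] 1≤t α β 2≤α 2≤β) (Λ′ α β 2≤α 2≤β)
polygons≅tiles α β 2≤α 2≤β t 1≤t = transposition-≅
  (Polygon.system 1≤t) Tile.system
  (Polygon.noSources 1≤t 2≤α 2≤β) (Tile.noSources 2≤α 2≤β)
  id id (λ _ → ≡.refl) (λ _ → ≡.refl)
  -- In both systems the suffix ₁ refers to `SameColumn` and ₂ to `SameRow`. For tiles this matches
  -- `N₁` and `N₂`; for polygons `N₁` is `M′ᵁ`, which is the `SameRow` matrix.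
  (λ a b → Tile.to₂ a b ∘ Polygon.from₂ 1≤t a b) (λ a b → Tile.to₁ a b ∘ Polygon.from₁ 1≤t a b)
  (λ a b → Polygon.to₁ 1≤t a b ∘ Tile.from₁ a b) (λ a b → Polygon.to₂ 1≤t a b ∘ Tile.from₂ a b)
  where
  module Tile    = TileSystem α β
  module Polygon = PolygonSystem α β t

-- Pulling back Cuntz–Krieger families

-- Each relation for `Λ` is the corresponding relation for `Λ′` at the image under `F.map`.
-- Orthogonality uses injectivity of `F.map`, and relation (d) in degree `n` becomes relation (d) in
-- degree `F.twist n`.
pullback : {Λ Λ′ : RowFiniteGraph k} {A : CStarAlgebra c ℓ} → DegreeTwistedIsomorphism Λ Λ′ →
           CuntzKriegerFamily Λ′ A → CuntzKriegerFamily Λ A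
pullback {Λ = Λ} {Λ′} {A} Φ T = record
  { S                = S ∘ F.map
  ; S-cong           = S-cong ∘ F.map-cong
  ; partial-isometry = λ μ → partial-isometry (F.map μ)
  ; vertex-idem      = λ v v₀ → vertex-idem (F.map v) (F.map-vertex v₀)
  ; vertex-⋆         = λ v v₀ → vertex-⋆ (F.map v) (F.map-vertex v₀)
  ; orthogonal       = λ u v u₀ v₀ u≉v → orthogonal (F.map u) (F.map v)
      (F.map-vertex u₀) (F.map-vertex v₀) (u≉v ∘ map-injective)
  ; multiplicative   = λ μ ν e →
      let e′ = Λ′.trans (F.s-map μ) (Λ′.trans (F.map-cong e) (Λ′.sym (F.r-map ν)))
      in A.trans (S-cong (F.comp-map μ ν e e′)) (multiplicative (F.map μ) (F.map ν) e′)
  ; source           = λ μ → A.trans (source (F.map μ)) (S-cong (F.s-map μ))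
  ; vertex-sum       = λ v n μs v₀ E → A.trans
      (vertex-sum (F.map v) (F.twist n) (List.map F.map μs) (F.map-vertex v₀) (map-enumerates E))
      (A.reflexive (≡.cong A.sumᴸ (≡.sym (map-∘ μs))))
  }
  where
  open DegreeTwistedIsomorphism Φ
  open CuntzKriegerFamily T
  module A  = CStarAlgebra A
  module Λ′ = Setoid (RowFiniteGraph.setoid Λ′)

-- Isomorphisms of C⋆-algebras

half⁺ : ∀ ε → Positive ε → Positive (½ ℚ.* ε)
half⁺ ε ε⁺ = ℚ.pos*pos⇒pos ½ ε {{ε⁺}}

≤ʳ-trans : ∀ {x y z} → x ≤ʳ y → y ≤ʳ z → x ≤ʳ z
≤ʳ-trans {x} {y} {z} (mk≤ p) (mk≤ q) = mk≤ λ ε ε⁺ →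
  let M , h = p (½ ℚ.* ε) (half⁺ ε ε⁺)
      N , k = q (½ ℚ.* ε) (half⁺ ε ε⁺)
  in M ℕ.⊔ N , λ n b → begin
    seq x n                               ≤⟨ h n (ℕ.m⊔n≤o⇒m≤o M N b) ⟩
    seq y n ℚ.+ ½ ℚ.* ε                   ≤⟨ ℚ.+-monoˡ-≤ (½ ℚ.* ε) (k n (ℕ.m⊔n≤o⇒n≤o M N b)) ⟩
    seq z n ℚ.+ ½ ℚ.* ε ℚ.+ ½ ℚ.* ε       ≡⟨ halves (seq z n) ε ⟩
    seq z n ℚ.+ ε                         ∎
  where
  open ℚ.≤-Reasoning
  open +-*-Solver
  halves : ∀ z ε → z ℚ.+ ½ ℚ.* ε ℚ.+ ½ ℚ.* ε ≡ z ℚ.+ ε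
  halves = solve 2 (λ z ε → z :+ con ½ :* ε :+ con ½ :* ε := z :+ ε) ≡.refl

≤ʳ-reflexive : ∀ {x y} → x ≃ y → x ≤ʳ y
≤ʳ-reflexive {x} {y} (mk≃ e) = mk≤ λ ε ε⁺ →
  let N , h = e ε ε⁺
  in N , λ n b → begin
    seq x n                             ≡⟨ split (seq x n) (seq y n) ⟩
    seq y n ℚ.+ (seq x n ℚ.- seq y n)   ≤⟨ ℚ.+-monoʳ-≤ (seq y n) (ℚ.≤-trans (p≤∣p∣ (seq x n ℚ.- seq y n)) (h n b)) ⟩
    seq y n ℚ.+ ε                       ∎
  where
  open ℚ.≤-Reasoning
  open +-*-Solver
  split : ∀ x y → x ≡ y ℚ.+ (x ℚ.- y)
  split = solve 2 (λ x y → x := y :+ (x :- y)) ≡.refl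
  p≤∣p∣ : ∀ p → p ℚ.≤ ℚ.∣ p ∣
  p≤∣p∣ p with ℚ.≤-total 0ℚ p
  ... | inj₁ 0≤p = ℚ.≤-reflexive (≡.sym (ℚ.0≤p⇒∣p∣≡p 0≤p))
  ... | inj₂ p≤0 = ℚ.≤-trans p≤0 (ℚ.0≤∣p∣ p)

fromℚ-nonNegative : ∀ {ε} → 0ℚ ℚ.≤ ε → 0ℝ ≤ʳ fromℚ ε
fromℚ-nonNegative {ε} 0≤ε = mk≤ λ δ δ⁺ → 0 , λ _ _ → ℚ.≤-trans 0≤ε
  (ℚ.≤-trans (ℚ.≤-reflexive (≡.sym (ℚ.+-identityʳ ε)))
    (ℚ.+-monoʳ-≤ ε (ℚ.<⇒≤ (ℚ.positive⁻¹ δ {{δ⁺}}))))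

module _ {A B : CStarAlgebra c ℓ} (φ : StarHomomorphism A B) where
  private
    module A = CStarAlgebra A
    module B = CStarAlgebra B
  open StarHomomorphism φ

  private
    B+ : AbelianGroup c ℓ
    B+ = record { isAbelianGroup = B.+-isAbelianGroup }
    open AbelianGroupProperties B+ using (identityʳ-unique; inverseˡ-unique)

  StarHomomorphism-0-homo : ⟦ A.0# ⟧ B.≈ B.0#
  StarHomomorphism-0-homo = identityʳ-unique _ _
    (B.trans (B.sym (+-homo A.0# A.0#)) (⟦⟧-cong (A.+-identityʳ A.0#)))

  StarHomomorphism-minus-homo : ∀ a b → ⟦ a A.- b ⟧ B.≈ ⟦ a ⟧ B.- ⟦ b ⟧
  StarHomomorphism-minus-homo a b = B.trans (+-homo a (A.- b)) (B.+-congˡ (inverseˡ-unique _ _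
    (B.trans (B.sym (+-homo (A.- b) b))
      (B.trans (⟦⟧-cong (A.-‿inverseˡ b)) StarHomomorphism-0-homo))))

idˢ : {A : CStarAlgebra c ℓ} → StarHomomorphism A A
idˢ {A = A} = record
  { ⟦_⟧ = id ; ⟦⟧-cong = id
  ; +-homo = λ _ _ → refl ; *-homo = λ _ _ → refl ; •-homo = λ _ _ → refl ; ⋆-homo = λ _ → refl
  ; contractive = λ _ → ≤ʳ-reflexive ≃-refl }
  where open CStarAlgebra A

infixr 9 _∘ˢ_
_∘ˢ_ : {A B C : CStarAlgebra c ℓ} → StarHomomorphism B C → StarHomomorphism A B → StarHomomorphism A C
_∘ˢ_ {C = C} ψ φ = record
  { ⟦_⟧         = ψ.⟦_⟧ ∘ φ.⟦_⟧
  ; ⟦⟧-cong     = ψ.⟦⟧-cong ∘ φ.⟦⟧-cong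
  ; +-homo      = λ a b → trans (ψ.⟦⟧-cong (φ.+-homo a b)) (ψ.+-homo _ _)
  ; *-homo      = λ a b → trans (ψ.⟦⟧-cong (φ.*-homo a b)) (ψ.*-homo _ _)
  ; •-homo      = λ z a → trans (ψ.⟦⟧-cong (φ.•-homo z a)) (ψ.•-homo z _)
  ; ⋆-homo      = λ a → trans (ψ.⟦⟧-cong (φ.⋆-homo a)) (ψ.⋆-homo _)
  ; contractive = λ a → ≤ʳ-trans (ψ.contractive _) (φ.contractive a)
  }
  where
  module φ = StarHomomorphism φ
  module ψ = StarHomomorphism ψ
  open CStarAlgebra C using (trans)

-- Both directions are contractive, so such an isomorphism is automatically isometric.
record _≅ˢ_ (A B : CStarAlgebra c ℓ) : Set (c ⊔ ℓ) where
  field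
    to   : StarHomomorphism A B
    from : StarHomomorphism B A
  open StarHomomorphism
  field
    from∘to : ∀ a → CStarAlgebra._≈_ A (⟦ from ⟧ (⟦ to ⟧ a)) a
    to∘from : ∀ b → CStarAlgebra._≈_ B (⟦ to ⟧ (⟦ from ⟧ b)) b

-- The usual uniqueness of universal objects: the pulled-back families induce homomorphisms both
-- ways, and the composites fix the generators because `F.map` and `G.map` are mutually inverse.
graphAlgebra-≅ : {Λ Λ′ : RowFiniteGraph k} {A B : CStarAlgebra c ℓ} → DegreeTwistedIsomorphism Λ Λ′ →
                 IsGraphAlgebra Λ A → IsGraphAlgebra Λ′ B → A ≅ˢ B
graphAlgebra-≅ {Λ = Λ} {Λ′} {A} {B} Φ isA isB = record
  { to      = φ
  ; from    = ψ
  ; from∘to = agree isA (ψ ∘ˢ φ) λ μ → A.trans (⟦ ψ ⟧-cong (φ-S μ))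
      (A.trans (ψ-S (F.map μ)) (S-cong (family isA) (G∘F μ)))
  ; to∘from = agree isB (φ ∘ˢ ψ) λ μ → B.trans (⟦ φ ⟧-cong (ψ-S μ))
      (B.trans (φ-S (G.map μ)) (S-cong (family isB) (F∘G μ)))
  }
  where
  open DegreeTwistedIsomorphism Φ
  open IsGraphAlgebra
  open CuntzKriegerFamily
  open StarHomomorphism renaming (⟦⟧-cong to ⟦_⟧-cong)
  module A = CStarAlgebra A
  module B = CStarAlgebra B

  φ-universal = universal isA B (pullback Φ (family isB))
  ψ-universal = universal isB A (pullback (inverse Φ) (family isA))
  φ = proj₁ φ-universal
  ψ = proj₁ ψ-universal
  φ-S = proj₁ (proj₂ φ-universal)
  ψ-S = proj₁ (proj₂ ψ-universal)

  -- Both `χ` and `idˢ` extend the universal family itself, and such an extension is unique.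
  agree : ∀ {k} {Λ : RowFiniteGraph k} {A : CStarAlgebra c ℓ} (isA : IsGraphAlgebra Λ A) →
    let open CStarAlgebra A in
    (χ : StarHomomorphism A A) → (∀ μ → ⟦ χ ⟧ (S (family isA) μ) ≈ S (family isA) μ) →
    ∀ a → ⟦ χ ⟧ a ≈ a
  agree {A = A} isA χ χ-S a =
    let _ , _ , unique = universal isA A (family isA)
    in trans (unique χ χ-S a) (sym (unique idˢ (λ _ → refl) a))
    where open CStarAlgebra A

-- Functoriality of K-theory

module _ {A B : CStarAlgebra c ℓ} (φ : StarHomomorphism A B) where
  private
    module A = CStarAlgebra A
    module B = CStarAlgebra B
    module ℂᵣ = CommutativeRing ℂ-commutativeRing
  open StarHomomorphism φ

  unitize : StarRingHomomorphism (Unitization.unitization A) (Unitization.unitization B)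
  unitize = record
    { ⟦_⟧     = λ (a , z) → ⟦ a ⟧ , z
    ; ⟦⟧-cong = λ (a≈ , z≈) → ⟦⟧-cong a≈ , z≈
    ; +-homo  = λ (a , z) (b , w) → +-homo a b , ℂᵣ.refl
    ; *-homo  = λ (a , z) (b , w) → B.trans (+-homo _ _) (B.+-cong (*-homo a b)
        (B.trans (+-homo _ _) (B.+-cong (•-homo w a) (•-homo z b)))) , ℂᵣ.refl
    ; ⋆-homo  = λ (a , z) → ⋆-homo a , ℂᵣ.refl
    ; 1-homo  = StarHomomorphism-0-homo φ , ℂᵣ.refl
    }

  -- Contractivity bounds the algebra part, and `unitize` leaves the scalar part alone. This is what
  -- carries continuous paths to continuous paths.
  unitize-close : ∀ ε x y → Unitization.Close A ε x y →
    Unitization.Close B ε (StarRingHomomorphism.⟦_⟧ unitize x) (StarRingHomomorphism.⟦_⟧ unitize y)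
  unitize-close ε (a , z) (b , w) (a-b≤ε , z-w≤ε) =
    ≤ʳ-trans (≤ʳ-reflexive (B.‖‖-cong (B.sym (StarHomomorphism-minus-homo φ a b))))
      (≤ʳ-trans (contractive (a A.- b)) a-b≤ε) , z-w≤ε

-- Kernels between Grothendieck groups, and K₀

module _ {c₁ ℓ₁ c₂ ℓ₂ c₃ ℓ₃}
  {M : CommutativeMonoid c₁ ℓ₁} {N : CommutativeMonoid c₂ ℓ₂} {P : CommutativeMonoid c₃ ℓ₃} where
  private
    module M = CommutativeMonoid M
    module N = CommutativeMonoid N
    module P = CommutativeMonoid P

  module _
    {f : M.Carrier → N.Carrier} {f⁻¹ : N.Carrier → M.Carrier}
    {g : M.Carrier → P.Carrier} {h : N.Carrier → P.Carrier}
    (f-homo   : IsMonoidHomomorphism M.rawMonoid N.rawMonoid f)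
    (f⁻¹-homo : IsMonoidHomomorphism N.rawMonoid M.rawMonoid f⁻¹)
    (g-homo   : IsMonoidHomomorphism M.rawMonoid P.rawMonoid g)
    (h-homo   : IsMonoidHomomorphism N.rawMonoid P.rawMonoid h)
    (f⁻¹∘f : ∀ x → f⁻¹ (f x) M.≈ x) (f∘f⁻¹ : ∀ y → f (f⁻¹ y) N.≈ y) (h∘f : ∀ x → h (f x) P.≈ g x) where

    private
      module GM = AbelianGroup (Grothendieck.group M)
      module GN = AbelianGroup (Grothendieck.group N)
      module GP = AbelianGroup (Grothendieck.group P)
      module f   = IsGroupHomomorphism (Grothendieck-homo {M = M} {N} f-homo)
      module f⁻¹ = IsGroupHomomorphism (Grothendieck-homo {M = N} {M} f⁻¹-homo)

      -- Formal differences are equal after adding a common summand; here that summand is `ε`.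
      pointwise : ∀ {c ℓ} (M : CommutativeMonoid c ℓ) → let open CommutativeMonoid M in
        ∀ {a a′ b b′} → a ≈ a′ → b ≈ b′ → Grothendieck._≈ᴳ_ M (a , b) (a′ , b′)
      pointwise M a≈ b≈ = ε , ∙-congʳ (∙-cong a≈ (sym b≈))
        where open CommutativeMonoid M

      F : M.Carrier × M.Carrier → N.Carrier × N.Carrier
      F (a , b) = f a , f b

      F⁻¹ : N.Carrier × N.Carrier → M.Carrier × M.Carrier
      F⁻¹ (a , b) = f⁻¹ a , f⁻¹ b

      F⁻¹∘F : ∀ x → F⁻¹ (F x) GM.≈ x
      F⁻¹∘F (a , b) = pointwise M (f⁻¹∘f a) (f⁻¹∘f b)

      F∘F⁻¹ : ∀ y → F (F⁻¹ y) GN.≈ y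
      F∘F⁻¹ (a , b) = pointwise N (f∘f⁻¹ a) (f∘f⁻¹ b)

      g∘f⁻¹ : ∀ y → g (f⁻¹ y) P.≈ h y
      g∘f⁻¹ y = P.trans (P.sym (h∘f (f⁻¹ y))) (IsMonoidHomomorphism.⟦⟧-cong h-homo (f∘f⁻¹ y))

    -- An isomorphism `f` of monoids over `P` induces one of Grothendieck groups over that of `P`,
    -- and so restricts to the kernels. In K₀ the monoid `P` is the one of projections over ℂ, with
    -- `g` and `h` the scalar parts.
    Grothendieck-kernel-≅ :
      AbelianGroup.rawGroup (kernel (Grothendieck.group M) (Grothendieck.group P) (Grothendieck-homo {M = M} {P} g-homo)) ≅
      AbelianGroup.rawGroup (kernel (Grothendieck.group N) (Grothendieck.group P) (Grothendieck-homo {M = N} {P} h-homo))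
    Grothendieck-kernel-≅ =
      -- The image lies in the kernel of `h` because `h ∘ f` agrees with `g`; surjectivity below
      -- uses `g∘f⁻¹` in the same way.
      (λ ((a , b) , x∈ker) → (f a , f b) , GP.trans (pointwise P (h∘f a) (h∘f b)) x∈ker) , record
      { isGroupMonomorphism = record
        { isGroupHomomorphism = record
          { isMonoidHomomorphism = record
            { isMagmaHomomorphism = record
              { isRelHomomorphism = record { cong = f.⟦⟧-cong }
              ; homo = λ (x , _) (y , _) → f.homo x y }
            ; ε-homo = f.ε-homo }
          ; ⁻¹-homo = λ (x , _) → f.⁻¹-homo x }
        ; injective = λ {(x , _)} {(y , _)} e →
            GM.trans (GM.sym (F⁻¹∘F x)) (GM.trans (f⁻¹.⟦⟧-cong e) (F⁻¹∘F y)) }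
      ; surjective = λ (y@(a , b) , y∈ker) →
          (F⁻¹ y , GP.trans (pointwise P (g∘f⁻¹ a) (g∘f⁻¹ b)) y∈ker) ,
          λ e → GN.trans (f.⟦⟧-cong e) (F∘F⁻¹ y)
      }

module _ {A B : CStarAlgebra c ℓ} where
  private
    module A⁺ = Matrices (Unitization.unitization A)
    module B⁺ = Matrices (Unitization.unitization B)
    module Mℂ = Matrices ℂ-starRing
    module ℂᵣ = CommutativeRing ℂ-commutativeRing

  -- The two projections have the same scalar entries, and reindexing along the identity turns
  -- entrywise equality into Murray-von Neumann equivalence.
  scalar-mapᴾ : (φ : StarHomomorphism A B) (p : A⁺.Projection) →
    mapᴾ (Unitization.scalar-part B) (mapᴾ (unitize φ) p) Mℂ.∼ mapᴾ (Unitization.scalar-part A) p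
  scalar-mapᴾ φ p = Mℂ.reindex
      {mapᴾ (Unitization.scalar-part A) p} {mapᴾ (Unitization.scalar-part B) (mapᴾ (unitize φ) p)}
      ↔-refl (λ i j → ℂᵣ.refl {proj₂ (A⁺.Projection.matrix p i j)})

  mapᴾ-inverse : (φ : StarHomomorphism A B) (ψ : StarHomomorphism B A) →
    (∀ a → CStarAlgebra._≈_ A (StarHomomorphism.⟦_⟧ ψ (StarHomomorphism.⟦_⟧ φ a)) a) →
    ∀ p → mapᴾ (unitize ψ) (mapᴾ (unitize φ) p) A⁺.∼ p
  mapᴾ-inverse φ ψ ψ∘φ p = A⁺.reindex {p} {mapᴾ (unitize ψ) (mapᴾ (unitize φ) p)} ↔-refl
    (λ i j → ψ∘φ (proj₁ (A⁺.Projection.matrix p i j)) , ℂᵣ.refl {proj₂ (A⁺.Projection.matrix p i j)})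

K₀-≅ : {A B : CStarAlgebra c ℓ} → A ≅ˢ B → K 0F A ≅ K 0F B
K₀-≅ {A = A} {B} A≅B = Grothendieck-kernel-≅
  {M = Matrices.V (Unitization.unitization A)} {Matrices.V (Unitization.unitization B)} {Matrices.V ℂ-starRing}
  (V-homo (unitize to)) (V-homo (unitize from)) (V-homo (Unitization.scalar-part A)) (V-homo (Unitization.scalar-part B))
  (mapᴾ-inverse to from from∘to) (mapᴾ-inverse from to to∘from) (scalar-mapᴾ to)
  where open _≅ˢ_ A≅B

-- Images of unitary matrices

module _ {c₁ ℓ₁ c₂ ℓ₂} {R : StarRing c₁ ℓ₁} {S : StarRing c₂ ℓ₂} (f : StarRingHomomorphism R S) where
  private
    module R = Matrices R
    module S = Matrices S
  open StarRing S
  open StarRingHomomorphism f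

  apply-1ᴹ : apply f (R.1ᴹ {n}) S.≈ᴹ S.1ᴹ
  apply-1ᴹ i j with i Fin.≟ j
  ... | yes _ = 1-homo
  ... | no  _ = 0-homo

  apply-⊕ : (a : R.Mat m m) (b : R.Mat n n) → apply f (a R.⊕ b) S.≈ᴹ apply f a S.⊕ apply f b
  apply-⊕ {m = m} a b i j = blocks (splitAt m i) (splitAt m j)
    where
    blocks : ∀ x y → ⟦ R.diagonal a b x y ⟧ ≈ S.diagonal (apply f a) (apply f b) x y
    blocks (inj₁ _) (inj₁ _) = refl
    blocks (inj₂ _) (inj₂ _) = refl
    blocks (inj₁ _) (inj₂ _) = 0-homo
    blocks (inj₂ _) (inj₁ _) = 0-homo

  mapᵁ : R.Unitary n → S.Unitary n
  mapᵁ {n} u = record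
    { matrix     = apply f matrix
    ; isometry   = λ i j → trans (S.∙ᴹ-cong {b = apply f matrix} ⋆-apply (λ _ _ → refl) i j)
        (trans (apply-∙ᴹ f (matrix R.⋆ᴹ) matrix i j) (trans (⟦⟧-cong (isometry i j)) (apply-1ᴹ i j)))
    ; coisometry = λ i j → trans (S.∙ᴹ-cong {a = apply f matrix} (λ _ _ → refl) ⋆-apply i j)
        (trans (apply-∙ᴹ f matrix (matrix R.⋆ᴹ) i j) (trans (⟦⟧-cong (coisometry i j)) (apply-1ᴹ i j)))
    }
    where
    open R.Unitary u
    ⋆-apply : apply f matrix S.⋆ᴹ S.≈ᴹ apply f (matrix R.⋆ᴹ)
    ⋆-apply i j = sym (⋆-homo (matrix j i))

  -- Stable homotopy transports a unitary along an equation of sizes, and `mapᵁ` has to pass through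
  -- that transport.
  mapᵁ-subst : (e : m ≡ n) (u : R.Unitary m) → mapᵁ (subst R.Unitary e u) ≡ subst S.Unitary e (mapᵁ u)
  mapᵁ-subst ≡.refl u = ≡.refl

module _ {c ℓ} (R : StarRing c ℓ) where
  open StarRing R
  open Matrices R

  infix 4 _≈ᵁ_
  -- Only the matrices are compared, since equal matrices may come with different proofs of
  -- unitarity.
  _≈ᵁ_ : Unitary n → Unitary n → Set ℓ
  u ≈ᵁ v = Unitary.matrix u ≈ᴹ Unitary.matrix v

  subst-≈ᵁ : (e : m ≡ n) {u v : Unitary m} → u ≈ᵁ v → subst Unitary e u ≈ᵁ subst Unitary e v
  subst-≈ᵁ ≡.refl u≈v = u≈v

-- Stable homotopy of unitaries

module _ (A : CStarAlgebra c ℓ) where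
  open CStarAlgebra A
  open Unitization A
  open Matrices unitization
  open KTheory A
  private
    module A⁺ = StarRing unitization
    module ℝᵣ = CommutativeRing ℝ-commutativeRing
    module ℂᵣ = CommutativeRing ℂ-commutativeRing

  -- Homogeneity is an axiom about squared norms, so with scalar 0 it gives only `‖0‖² ≃ 0`. The
  -- C⋆-identity at 0 gives `‖0‖ ≃ ‖0‖²`, which spares a square root.
  ‖0‖≃0 : ‖ 0# ‖ ≃ 0ℝ
  ‖0‖≃0 = ≃-trans (‖‖-cong (sym (zeroʳ (0# ⋆)))) (≃-trans (C⋆-identity 0#)
    (≃-trans (*ʳ-cong 0≃ 0≃) (≃-trans (‖‖-homogeneous 0ᶜ 0#) ∣0∣²x≃0)))
    where
    0≃ : ‖ 0# ‖ ≃ ‖ 0ᶜ • 0# ‖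
    0≃ = ‖‖-cong (sym (*ₗ-zeroˡ 0#))
    ∣0∣²x≃0 : ∣ 0ᶜ ∣² *ʳ (‖ 0# ‖ *ʳ ‖ 0# ‖) ≃ 0ℝ
    ∣0∣²x≃0 = ≃-trans (*ʳ-cong ∣0∣²≃0 ℝᵣ.refl) (ℝᵣ.zeroˡ _)
      where
      ∣0∣²≃0 : ∣ 0ᶜ ∣² ≃ 0ℝ
      ∣0∣²≃0 = ≃-pointwise λ _ → ≡.refl

  ∣∣²-cong : ∀ {z w} → z ≈ᶜ w → ∣ z ∣² ≃ ∣ w ∣²
  ∣∣²-cong (re≃ ,ᶜ im≃) = ℝᵣ.+-cong (*ʳ-cong re≃ re≃) (*ʳ-cong im≃ im≃)

  close-refl : ∀ ε → Positive ε → ∀ x → Close ε x x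
  close-refl ε ε⁺ (a , z) =
    ≤ʳ-trans (≤ʳ-reflexive (≃-trans (‖‖-cong (-‿inverseʳ a)) ‖0‖≃0))
      (fromℚ-nonNegative (ℚ.<⇒≤ (ℚ.positive⁻¹ ε {{ε⁺}}))) ,
    ≤ʳ-trans (≤ʳ-reflexive (≃-trans (∣∣²-cong (ℂᵣ.-‿inverseʳ z)) (≃-pointwise λ _ → ≡.refl)))
      (fromℚ-nonNegative (ℚ.<⇒≤ (ℚ.positive⁻¹ (ε ℚ.* ε) {{ℚ.pos*pos⇒pos ε {{ε⁺}} ε {{ε⁺}}}})))

  -- The same path serves, since its endpoints are prescribed only up to `≈ᴹ`.
  homotopic-resp : {u u′ v v′ : Unitary n} → _≈ᵁ_ unitization u u′ → _≈ᵁ_ unitization v v′ →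
                   Homotopic u v → Homotopic u′ v′
  homotopic-resp u≈u′ v≈v′ H = record
    { path       = path
    ; start      = λ 0≤0 0≤1 i j → A⁺.trans (start 0≤0 0≤1 i j) (u≈u′ i j)
    ; end        = λ 0≤1 1≤1 i j → A⁺.trans (end 0≤1 1≤1 i j) (v≈v′ i j)
    ; continuous = continuous
    }
    where open Homotopic H

  homotopic-reflexive : {u v : Unitary n} → _≈ᵁ_ unitization u v → Homotopic u v
  homotopic-reflexive {u = u} u≈v = record
    { path       = λ _ _ _ → u
    ; start      = λ _ _ _ _ → A⁺.refl
    ; end        = λ _ _ → u≈v
    -- The path is constant, so every δ works; 1 is an arbitrary choice.
    ; continuous = λ _ _ _ ε ε⁺ → ℚ.1ℚ , _ , λ _ _ _ _ i j → close-refl ε ε⁺ (Unitary.matrix u i j)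
    }

  stablyHomotopic-reflexive : {u v : Unitary n} → _≈ᵁ_ unitization u v → StablyHomotopic (n , u) (n , v)
  -- Padding both sides by an empty block makes the size equation `n + 0 ≡ n + 0`, so no transport
  -- arises.
  stablyHomotopic-reflexive {u = u} {v} u≈v = 0 , 0 , ≡.refl ,
    homotopic-reflexive {u = u ⊕ᵁ 1ᵁ 0} {v ⊕ᵁ 1ᵁ 0} (⊕-cong u≈v λ ())

  stablyHomotopic-resp : {u u′ : Unitary m} {v v′ : Unitary n} → _≈ᵁ_ unitization u u′ → _≈ᵁ_ unitization v v′ →
                         StablyHomotopic (m , u) (n , v) → StablyHomotopic (m , u′) (n , v′)
  stablyHomotopic-resp {u = u} {u′} {v} {v′} u≈u′ v≈v′ (k , l , e , H) = k , l , e ,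
    homotopic-resp
      (subst-≈ᵁ unitization e {u ⊕ᵁ 1ᵁ k} {u′ ⊕ᵁ 1ᵁ k} (⊕-cong u≈u′ (λ _ _ → A⁺.refl)))
      (⊕-cong v≈v′ (λ _ _ → A⁺.refl)) H

module _ {A B : CStarAlgebra c ℓ} (φ : StarHomomorphism A B) where
  private
    module A  = KTheory A
    module B  = KTheory B
    module A⁺ = Matrices (Unitization.unitization A)
    module B⁺ = Matrices (Unitization.unitization B)
    open StarRing (Unitization.unitization B)
    open StarRingHomomorphism (unitize φ)

  -- Since `unitize φ` is unital, the identity block added for stabilisation stays an identity
  -- block.
  mapᵁ-⊕-1ᵁ : ∀ k (u : A⁺.Unitary n) →
    _≈ᵁ_ (Unitization.unitization B) (mapᵁ (unitize φ) (u A⁺.⊕ᵁ A⁺.1ᵁ k)) (mapᵁ (unitize φ) u B⁺.⊕ᵁ B⁺.1ᵁ k)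
  mapᵁ-⊕-1ᵁ k u i j = trans (apply-⊕ (unitize φ) (A⁺.Unitary.matrix u) A⁺.1ᴹ i j)
    (B⁺.⊕-cong {a = apply (unitize φ) (A⁺.Unitary.matrix u)} (λ _ _ → refl) (apply-1ᴹ (unitize φ)) i j)

  -- The image path has the same modulus of continuity, by `unitize-close`.
  homotopic-map : {u v : A⁺.Unitary n} → A.Homotopic u v → B.Homotopic (mapᵁ (unitize φ) u) (mapᵁ (unitize φ) v)
  homotopic-map H = record
    { path       = λ t 0≤t t≤1 → mapᵁ (unitize φ) (path t 0≤t t≤1)
    ; start      = λ 0≤0 0≤1 i j → ⟦⟧-cong (start 0≤0 0≤1 i j)
    ; end        = λ 0≤1 1≤1 i j → ⟦⟧-cong (end 0≤1 1≤1 i j)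
    ; continuous = λ t 0≤t t≤1 ε ε⁺ →
        let δ , δ⁺ , close = continuous t 0≤t t≤1 ε ε⁺
        in δ , δ⁺ , λ s 0≤s s≤1 s-t≤δ i j → unitize-close φ ε
             (A⁺.Unitary.matrix (path s 0≤s s≤1) i j) (A⁺.Unitary.matrix (path t 0≤t t≤1) i j)
             (close s 0≤s s≤1 s-t≤δ i j)
    }
    where open A.Homotopic H

  stablyHomotopic-map : {u : A⁺.Unitary m} {v : A⁺.Unitary n} → A.StablyHomotopic (m , u) (n , v) →
                        B.StablyHomotopic (m , mapᵁ (unitize φ) u) (n , mapᵁ (unitize φ) v)
  stablyHomotopic-map {u = u} {v} (k , l , e , H) = k , l , e ,
    -- The image homotopy starts at `mapᵁ` of a transported stabilised unitary; its endpoints are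
    -- rewritten by moving `mapᵁ` inside, first past `subst` and then past the identity block.
    homotopic-resp B
      (λ i j → trans (reflexive (≡.cong (λ w → B⁺.Unitary.matrix w i j) (mapᵁ-subst (unitize φ) e (u A⁺.⊕ᵁ A⁺.1ᵁ k))))
        (subst-≈ᵁ (Unitization.unitization B) e
          {mapᵁ (unitize φ) (u A⁺.⊕ᵁ A⁺.1ᵁ k)} {mapᵁ (unitize φ) u B⁺.⊕ᵁ B⁺.1ᵁ k} (mapᵁ-⊕-1ᵁ k u) i j))
      (mapᵁ-⊕-1ᵁ l v)
      (homotopic-map {u = subst A⁺.Unitary e (u A⁺.⊕ᵁ A⁺.1ᵁ k)} {v A⁺.⊕ᵁ A⁺.1ᵁ l} H)

-- K₁ A is the case of the unitization of A and stable homotopy.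
unitaryRawGroup : ∀ {c ℓ ℓ′} (R : StarRing c ℓ) → Rel (∃[ n ] Matrices.Unitary R n) ℓ′ → RawGroup (c ⊔ ℓ) ℓ′
unitaryRawGroup R _∼_ = record
  { Carrier = ∃[ n ] Unitary n
  ; _≈_     = _∼_
  ; _∙_     = λ (m , u) (n , v) → m ℕ.+ n , u ⊕ᵁ v
  ; ε       = 0 , 1ᵁ 0
  ; _⁻¹     = λ (n , u) → n , u ⁻¹ᵁ
  }
  where open Matrices R using (Unitary; _⊕ᵁ_; 1ᵁ; _⁻¹ᵁ)

module _ {c₁ ℓ₁ c₂ ℓ₂} {R : StarRing c₁ ℓ₁} {S : StarRing c₂ ℓ₂}
         (f : StarRingHomomorphism R S) (g : StarRingHomomorphism S R) where
  private
    module R = Matrices R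
    module S = Matrices S
    module f = StarRingHomomorphism f
    module g = StarRingHomomorphism g

  -- The relations are abstract, and representatives with equal matrices are exchanged by the two
  -- closure hypotheses rather than by transitivity. Applying `g` to a relation between images gives
  -- injectivity, and applying `f` gives surjectivity.
  unitaryRawGroup-≅ : ∀ {ℓ₃ ℓ₄} →
    (∀ x → StarRing._≈_ R g.⟦ f.⟦ x ⟧ ⟧ x) → (∀ y → StarRing._≈_ S f.⟦ g.⟦ y ⟧ ⟧ y) →
    (_∼ᴿ_ : Rel (∃[ n ] R.Unitary n) ℓ₃) (_∼ˢ_ : Rel (∃[ n ] S.Unitary n) ℓ₄) →
    (∀ {m n} {u u′ : R.Unitary m} {v v′ : R.Unitary n} →
      _≈ᵁ_ R u u′ → _≈ᵁ_ R v v′ → (m , u) ∼ᴿ (n , v) → (m , u′) ∼ᴿ (n , v′)) →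
    (∀ {m n} {u u′ : S.Unitary m} {v v′ : S.Unitary n} →
      _≈ᵁ_ S u u′ → _≈ᵁ_ S v v′ → (m , u) ∼ˢ (n , v) → (m , u′) ∼ˢ (n , v′)) →
    (∀ {n} {u v : S.Unitary n} → _≈ᵁ_ S u v → (n , u) ∼ˢ (n , v)) →
    (∀ {m n} {u : R.Unitary m} {v : R.Unitary n} →
      (m , u) ∼ᴿ (n , v) → (m , mapᵁ f u) ∼ˢ (n , mapᵁ f v)) →
    (∀ {m n} {u : S.Unitary m} {v : S.Unitary n} →
      (m , u) ∼ˢ (n , v) → (m , mapᵁ g u) ∼ᴿ (n , mapᵁ g v)) →
    unitaryRawGroup R _∼ᴿ_ ≅ unitaryRawGroup S _∼ˢ_
  unitaryRawGroup-≅ g∘f f∘g _ _ ∼ᴿ-resp ∼ˢ-resp ∼ˢ-reflexive f-cong g-cong =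
    (λ (n , u) → n , mapᵁ f u) , record
    { isGroupMonomorphism = record
      { isGroupHomomorphism = record
        { isMonoidHomomorphism = record
          { isMagmaHomomorphism = record
            { isRelHomomorphism = record { cong = f-cong }
            ; homo = λ (_ , u) (_ , v) → ∼ˢ-reflexive (apply-⊕ f (R.Unitary.matrix u) (R.Unitary.matrix v)) }
          ; ε-homo = ∼ˢ-reflexive λ () }
        ; ⁻¹-homo = λ (_ , u) → ∼ˢ-reflexive λ i j → f.⋆-homo (R.Unitary.matrix u j i) }
      ; injective = λ H → ∼ᴿ-resp (λ _ _ → g∘f _) (λ _ _ → g∘f _) (g-cong H) }
    ; surjective = λ (n , v) → (n , mapᵁ g v) , λ H →
        ∼ˢ-resp (λ _ _ → StarRing.refl S) (λ _ _ → f∘g _) (f-cong H)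
    }

K₁-≅ : {A B : CStarAlgebra c ℓ} → A ≅ˢ B → K 1F A ≅ K 1F B
K₁-≅ {A = A} {B} A≅B = unitaryRawGroup-≅
  {R = Unitization.unitization A} {Unitization.unitization B} (unitize {A = A} {B} to) (unitize {A = B} {A} from)
  (λ (a , z) → from∘to a , CommutativeRing.refl ℂ-commutativeRing {z})
  (λ (b , z) → to∘from b , CommutativeRing.refl ℂ-commutativeRing {z})
  (KTheory.StablyHomotopic A) (KTheory.StablyHomotopic B)
  (λ {_} {_} {u} {u′} {v} {v′} → stablyHomotopic-resp A {u = u} {u′} {v} {v′})
  (λ {_} {_} {u} {u′} {v} {v′} → stablyHomotopic-resp B {u = u} {u′} {v} {v′})
  (λ {_} {u} {v} → stablyHomotopic-reflexive B {u = u} {v})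
  (λ {_} {_} {u} {v} → stablyHomotopic-map to {u = u} {v})
  (λ {_} {_} {u} {v} → stablyHomotopic-map from {u = u} {v})
  where open _≅ˢ_ A≅B

corollary7p6 : ∀ {c ℓ} (α β : ℕ) (2≤α : 2 ≤ α) (2≤β : 2 ≤ β) (t : ℕ) (1≤t : 1 ≤ t)
    (A B : CStarAlgebra c ℓ) →
    IsGraphAlgebra (Λ′[ t ] 1≤t α β 2≤α 2≤β) A →
    IsGraphAlgebra (Λ′ α β 2≤α 2≤β) B →
    (ε : Fin 2) → K ε A ≅ K ε B
corollary7p6 α β 2≤α 2≤β t 1≤t A B isA isB = λ where
    0F → K₀-≅ A≅B
    1F → K₁-≅ A≅B
  where
  A≅B : A ≅ˢ B
  A≅B = graphAlgebra-≅ (polygons≅tiles α β 2≤α 2≤β t 1≤t) isA isB
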